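{- Let $G=(V,E)$ be a finite simple strongly connected directed graph. Then $$F_{\mathcal TG}=\Phi_G\,F_G,\qquad \Phi_G=\prod_{\substack{W\subsetneq V\\ W\text{ strongly connected}}}\left(\Psi_{V\setminus W}\right)^{m(W)},$$ where the product is over all nonempty proper strongly connected subsets $W$ of $V$.
   Context: $G=(V,E)$ is a finite simple directed graph with edge indeterminates $x_e$. A spanning tree of $G$ is a subgraph on all vertices, with no cycle, one vertex (root) of outdegree $0$ and all others of outdegree $1$. For nonempty $U\subseteq V$, a forest rooted in $U$ is a subgraph on all vertices with no cycle in which vertices of $U$ have outdegree $0$ and all others outdegree $1$. The weight of a tree or forest is the product of $x_e$ over its edges. The tree graph $\mathcal TG$: its vertices are the spanning trees of $G$; for a tree $\mathbf a$ rooted at $r$ and $e\in E$ with $s(e)=r$, the tree $\mathbf b$ obtained from $\mathbf a$ by adding $e$ and deleting the edge of $\mathbf a$ going out of $t(e)$ yields an edge $\mathbf a\to\mathbf b$ of $\mathcal TG$ of weight $x_e$; spanning trees of $\mathcal TG$ (rooted anywhere) are weighted by the product of their edge weights. $F_G$ (resp. $F_{\mathcal TG}$) is the sum of weights of all spanning trees of $G$ (resp. $\mathcal TG$), and $\Psi_U$ is the sum of weights of all forests of $G$ rooted in $U$. Exploration algorithm (depends on a fixed total order of $V$). Input: a spanning tree $\mathbf a$ rooted at $v$. Initialize $A=\{v\}$, $F=\{e: s(e)\neq v\}$, $\mathbf L$ = FIFO list of edges with target $v$, by increasing source. While $\mathbf L$ is nonempty, take its first edge $e$, with source $w$: if $e\in\mathbf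 a$, add $w$ to $A$, delete from $\mathbf L$ (and $F$) all edges with source $w$, and append to $\mathbf L$ all edges of $F$ with target $w$ by increasing source; otherwise delete from $\mathbf L$ and $F$ all edges with source or target $w$. At the end $\phi(\mathbf a)=A$ and $\psi(\mathbf a)$ is the strongly connected component of $v$ in the induced graph $G_{\phi(\mathbf a)}$. For $W$ strongly connected and $w\in W$, $m(W,w)$ is the number of spanning trees $\mathbf a$ rooted at $w$ with $\psi(\mathbf a)=W$; $m(W)$ denotes this number, which is independent of $w\in W$. -}

module Defs where

open import Level using (0ℓ)
open import Algebra.Bundles using (CommutativeRing)
open import Data.Bool.Properties using () renaming (_≟_ to _≟ᵇ_)
open import Data.Fin.Base using (Fin; zero; suc)
open import Data.Fin.Properties using (_≟_; any?; all?)
open import Data.Fin.Subset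
open import Data.Fin.Subset.Properties using (_∈?_; nonempty?; _⊂?_)
open import Data.List.Base
  using (List; []; _∷_; _++_; map; filter; foldr; length; lookup; allFin; concatMap; cartesianProduct)
open import Data.Nat.Base using (ℕ; zero; suc)
import Data.Nat.Properties as ℕ
open import Data.Product.Base using (∃; _×_; _,_; proj₁; proj₂)
open import Data.Sum.Base using (_⊎_; inj₁; inj₂)
open import Data.Vec.Base as Vec using (tabulate)
open import Data.Vec.Properties using (≡-dec)
open import Relation.Binary.Core using (Rel)
open import Relation.Binary.Definitions using (Decidable; DecidableEquality)
open import Relation.Binary.Construct.Closure.ReflexiveTransitive using (Star; ε; _◅_; _◅◅_)
open import Relation.Binary.PropositionalEquality using (_≡_; _≢_; refl)
open import Relation.Nullary.Decidable
  using (Dec; yes; no; does; map′; ¬?; _×-dec_; _⊎-dec_; _→-dec_)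
open import Relation.Nullary.Negation using (¬_)

------------------------------------------------------------------------
-- Decidability of reachability for a decidable relation on a finite set,
-- by eliminating the vertex zero.

private
  Bypass : ∀ {n} → Rel (Fin (suc n)) 0ℓ → Rel (Fin n) 0ℓ
  Bypass R i j = R (suc i) (suc j) ⊎ (R (suc i) zero × R zero (suc j))

  module _ {n} {R : Rel (Fin (suc n)) 0ℓ} where

    unbypass : ∀ {i j} → Star (Bypass R) i j → Star R (suc i) (suc j)
    unbypass ε                     = ε
    unbypass (inj₁ r ◅ rs)         = r ◅ unbypass rs
    unbypass (inj₂ (r , r′) ◅ rs)  = r ◅ r′ ◅ unbypass rs

    mutual
      bypass : ∀ {i j} → Star R (suc i) (suc j) → Star (Bypass R) i j
      bypass ε                      = ε
      bypass (_◅_ {j = suc _} r rs) = inj₁ r ◅ bypass rs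
      bypass (_◅_ {j = zero}  r rs) with leave rs
      ... | _ , r′ , rs′ = inj₂ (r , r′) ◅ rs′

      leave : ∀ {j} → Star R zero (suc j) → ∃ λ k → R zero (suc k) × Star (Bypass R) k j
      leave (_◅_ {j = zero}  _ rs) = leave rs
      leave (_◅_ {j = suc k} r rs) = k , r , bypass rs

    enter : ∀ {i} → Star R (suc i) zero → ∃ λ k → Star (Bypass R) i k × R (suc k) zero
    enter {i} (_◅_ {j = zero}  r _)  = i , ε , r
    enter     (_◅_ {j = suc _} r rs) with enter rs
    ... | k , rs′ , r′ = k , inj₁ r ◅ rs′ , r′

star? : ∀ {n} {R : Rel (Fin n) 0ℓ} → Decidable R → Decidable (Star R)
star? {suc n} {R} R? = dec
  where
  bypass? : Decidable (Star (Bypass R))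
  bypass? = star? λ i j → R? (suc i) (suc j) ⊎-dec (R? (suc i) zero ×-dec R? zero (suc j))

  dec : Decidable (Star R)
  dec zero    zero    = yes ε
  dec zero    (suc j) = map′ (λ (_ , r , rs) → r ◅ unbypass rs) leave
                             (any? λ k → R? zero (suc k) ×-dec bypass? k j)
  dec (suc i) zero    = map′ (λ (_ , rs , r) → unbypass rs ◅◅ r ◅ ε) enter
                             (any? λ k → bypass? i k ×-dec R? (suc k) zero)
  dec (suc i) (suc j) = map′ unbypass bypass (bypass? i j)

------------------------------------------------------------------------

_≟ˢ_ : ∀ {n} → DecidableEquality (Subset n)
_≟ˢ_ = ≡-dec _≟ᵇ_

allSubsets : ∀ n → List (Subset n)
allSubsets zero    = Vec.[] ∷ []
allSubsets (suc n) = map (outside Vec.∷_) (allSubsets n) ++ map (inside Vec.∷_) (allSubsets n)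

------------------------------------------------------------------------

-- A finite directed graph with n vertices and m edges.  The order on
-- Fin n is the fixed total order on the vertices.
record Digraph (n m : ℕ) : Set where
  field
    source target : Fin m → Fin n

-- No loops and no parallel edges; opposite edges u → v and v → u may coexist.
record Simple {n m} (G : Digraph n m) : Set where
  open Digraph G
  field
    noLoop     : ∀ e → source e ≢ target e
    noParallel : ∀ e f → source e ≡ source f → target e ≡ target f → e ≡ f

module Graph {n m} (G : Digraph n m) where
  open Digraph G public

  outgoing : Fin n → Subset m
  outgoing v = tabulate λ e → does (source e ≟ v)

  -- A subgraph on all the vertices is given by its set H of edges.

  outdegree : Subset m → Fin n → ℕ
  outdegree H v = ∣ H ∩ outgoing v ∣

  Step : Subset m → Rel (Fin n) 0ℓ
  Step H u v = ∃ λ e → e ∈ H × source e ≡ u × target e ≡ v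

  step? : ∀ H → Decidable (Step H)
  step? H u v = any? λ e → e ∈? H ×-dec (source e ≟ u ×-dec target e ≟ v)

  -- Directed cycles suffice: where all outdegrees are at most 1, every
  -- undirected cycle is a directed one.
  Acyclic : Subset m → Set
  Acyclic H = ∀ e → e ∈ H → ¬ Star (Step H) (target e) (source e)

  IsForest : Subset n → Subset m → Set
  IsForest U H = (∀ v → v ∈ U → outdegree H v ≡ 0)
               × (∀ v → v ∉ U → outdegree H v ≡ 1)
               × Acyclic H

  isForest? : ∀ U H → Dec (IsForest U H)
  isForest? U H = all? (λ v → v ∈? U →-dec outdegree H v ℕ.≟ 0)
           ×-dec (all? (λ v → ¬? (v ∈? U) →-dec outdegree H v ℕ.≟ 1)
           ×-dec  all? (λ e → e ∈? H →-dec ¬? (star? (step? H) (target e) (source e))))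

  IsTree : Fin n → Subset m → Set
  IsTree r = IsForest ⁅ r ⁆

  isTree? : ∀ r H → Dec (IsTree r H)
  isTree? r = isForest? ⁅ r ⁆

  IsSpanningTree : Subset m → Set
  IsSpanningTree H = ∃ λ r → IsTree r H

  isSpanningTree? : ∀ H → Dec (IsSpanningTree H)
  isSpanningTree? H = any? λ r → isTree? r H

  forests : Subset n → List (Subset m)
  forests U = filter (isForest? U) (allSubsets m)

  spanningTrees : List (Subset m)
  spanningTrees = filter isSpanningTree? (allSubsets m)

  InducedStep : Subset n → Rel (Fin n) 0ℓ
  InducedStep W u v = u ∈ W × v ∈ W × Step ⊤ u v

  Reach : Subset n → Rel (Fin n) 0ℓ
  Reach W = Star (InducedStep W)

  reach? : ∀ W → Decidable (Reach W)
  reach? W = star? λ u v → u ∈? W ×-dec (v ∈? W ×-dec step? ⊤ u v)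

  StronglyConnected : Subset n → Set
  StronglyConnected W = ∀ u v → u ∈ W → v ∈ W → Reach W u v

  stronglyConnected? : ∀ W → Dec (StronglyConnected W)
  stronglyConnected? W = all? λ u → all? λ v → u ∈? W →-dec (v ∈? W →-dec reach? W u v)

  -- The strongly connected component of v in the subgraph induced on W.
  component : Subset n → Fin n → Subset n
  component W v = tabulate λ u → does (u ∈? W ×-dec (reach? W u v ×-dec reach? W v u))

  -- Filtering this list keeps edges sorted by increasing source.
  edgesBySource : List (Fin m)
  edgesBySource = concatMap (λ u → filter (λ e → source e ≟ u) (allFin m)) (allFin n)

  intoVertex dropSource dropVertex : Fin n → List (Fin m) → List (Fin m)
  intoVertex w = filter (λ e → target e ≟ w)
  dropSource w = filter (λ e → ¬? (source e ≟ w))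
  dropVertex w = filter (λ e → ¬? (source e ≟ w) ×-dec ¬? (target e ≟ w))

  -- The first argument only bounds the number of passes.  Each pass removes
  -- from L and F all edges with source w, for a new w different from the
  -- root, so with bound n the loop stops because L is empty.
  explore : ℕ → (a : Subset m) (A : Subset n) (F L : List (Fin m)) → Subset n
  explore zero    a A F L       = A
  explore (suc k) a A F []      = A
  explore (suc k) a A F (e ∷ L) with e ∈? a
  ... | yes _ = explore k a (A ∪ ⁅ source e ⁆) F′ (dropSource (source e) L ++ intoVertex (source e) F′)
    where F′ = dropSource (source e) F
  ... | no _  = explore k a A (dropVertex (source e) F) (dropVertex (source e) L)

  -- φ v a and ψ v a are meant for a spanning tree a rooted at v.
  φ : Fin n → Subset m → Subset n
  φ v a = explore n a ⁅ v ⁆ (dropSource v edgesBySource) (intoVertex v edgesBySource)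

  ψ : Fin n → Subset m → Subset n
  ψ v a = component (φ v a) v

  multiplicity : Subset n → Fin n → ℕ
  multiplicity W w = length (filter (λ a → isTree? w a ×-dec ψ w a ≟ˢ W) (allSubsets m))

  ProperStronglyConnected : Subset n → Set
  ProperStronglyConnected W = Nonempty W × W ⊂ ⊤ × StronglyConnected W

  properStronglyConnected? : ∀ W → Dec (ProperStronglyConnected W)
  properStronglyConnected? W = nonempty? W ×-dec (W ⊂? ⊤ ×-dec stronglyConnected? W)

------------------------------------------------------------------------

module TreeGraph {n m} (G : Digraph n m) where
  open Graph G

  order : ℕ
  order = length spanningTrees

  tree : Fin order → Subset m
  tree = lookup spanningTrees

  -- An edge of the tree graph is a triple (a , e , b): a is rooted at the
  -- source of e, and b arises from a by adding e and deleting the edge of a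
  -- going out of the target of e.
  IsMove : Fin order × Fin m × Fin order → Set
  IsMove (a , e , b) = IsTree (source e) (tree a)
                     × tree b ≡ (tree a ─ outgoing (target e)) ∪ ⁅ e ⁆

  isMove? : ∀ t → Dec (IsMove t)
  isMove? (a , e , b) = isTree? (source e) (tree a)
                  ×-dec tree b ≟ˢ ((tree a ─ outgoing (target e)) ∪ ⁅ e ⁆)

  moves : List (Fin order × Fin m × Fin order)
  moves = filter isMove?
    (cartesianProduct (allFin order) (cartesianProduct (allFin m) (allFin order)))

  size : ℕ
  size = length moves

  treeGraph : Digraph order size
  treeGraph = record
    { source = λ i → proj₁ (lookup moves i)
    ; target = λ i → proj₂ (proj₂ (lookup moves i))
    }

  addedEdge : Fin size → Fin m
  addedEdge i = proj₁ (proj₂ (lookup moves i))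

open TreeGraph public using (treeGraph; addedEdge)

------------------------------------------------------------------------

-- The weights take values in an arbitrary commutative ring.  An identity
-- holding for all commutative rings and all weights is the same thing as an
-- identity between polynomials in indeterminate weights: take the
-- indeterminates of ℤ[x_e] as weights, or conversely specialize them.
module Weighted {c ℓ} (R : CommutativeRing c ℓ) where
  open CommutativeRing R using (Carrier; _+_; _*_; 0#; 1#; semiring)
  open import Algebra.Properties.Semiring.Exp semiring using (_^_)

  sumOver productOver : ∀ {A : Set} → List A → (A → Carrier) → Carrier
  sumOver     xs f = foldr _+_ 0# (map f xs)
  productOver xs f = foldr _*_ 1# (map f xs)

  weight : ∀ {m} → (Fin m → Carrier) → Subset m → Carrier
  weight {m} x H = productOver (filter (_∈? H) (allFin m)) x

  module _ {n m} (G : Digraph n m) (x : Fin m → Carrier) where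
    open Graph G

    treeSum : Carrier
    treeSum = sumOver spanningTrees (weight x)

    Ψ : Subset n → Carrier
    Ψ U = sumOver (forests U) (weight x)

    -- w chooses for each W the vertex at which m(W) = m(W , w W) is computed.
    Φ : (w : Subset n → Fin n) → Carrier
    Φ w = productOver (filter properStronglyConnected? (allSubsets n))
                      (λ W → Ψ (∁ W) ^ multiplicity W (w W))

{-# OPTIONS --safe #-}

-- Let B = X − D be minus the Laplacian of G restricted to W ⊆ V.  The series
-- f_W = det (1 − tB), whose coefficient at tᵏ is the sum of the weights of the
-- acyclic sets of k edges, at most one out of each vertex of W and none out of
-- the other vertices, satisfies Newton's identities with power sums tr Bᵏ: this
-- follows from the matrix forest theorem, so no determinants are needed.
--
-- A closed walk of G acts on the spanning trees rooted at its origin, and those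
-- it fixes correspond to the forests rooted in its support S.  Since S is
-- strongly connected, the exploration algorithm matches these forests with the
-- trees a such that S ⊆ ψ(a), so their number is the sum of the m(W) over W ⊇ S.
-- Therefore the trace of Bᵏ for the tree graph is the sum of the m(W) tr (B_W)ᵏ,
-- its series is the product of the f_W ^ m(W), and the theorem compares the top
-- coefficients.  Newton's identities determine a series in the absence of
-- torsion only: we work over an iterated polynomial ring over ℤ and specialize.

module Submission where

open import Level as Level using (0ℓ; _⊔_)
open import Algebra.Bundles using (CommutativeMonoid; Semiring; CommutativeSemiring; CommutativeRing)
import Algebra.Morphism.RingMonomorphism as RingMonomorphism
open import Algebra.Morphism.Structures using (IsSemiringHomomorphism)
import Algebra.Solver.Ring.NaturalCoefficients.Default as Solver
open import Data.Bool.Base using (Bool; true; false; if_then_else_)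
open import Data.Fin.Base using (Fin; zero; suc)
open import Data.Fin.Induction using (spo-noetherian)
open import Data.Fin.Properties using (_≟_; any?; all?)
open import Data.Fin.Subset hiding (Lift; _-_)
open import Data.Fin.Subset.Properties
import Data.Integer.Base as ℤ
import Data.Integer.Properties as ℤ
open import Data.List.Base
  using (List; []; _∷_; _++_; map; filter; foldr; length; lookup; allFin; cartesianProduct)
open import Data.List.Membership.Propositional using (lose) renaming (_∈_ to _∈ˡ_)
open import Data.List.Membership.Propositional.Properties
  using (∈-filter⁺; ∈-filter⁻; ∈-map⁺; ∈-map⁻; ∈-++⁺ˡ; ∈-++⁺ʳ; ∈-++⁻; ∈-allFin; ∈-lookup;
         ∈-concatMap⁺; ∈-cartesianProduct⁺)
open import Data.List.Membership.Propositional.Properties.WithK using (unique∧set⇒bag)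
import Data.List.Properties as List
open import Data.List.Relation.Binary.BagAndSetEquality using (∼bag⇒↭)
open import Data.List.Relation.Binary.Permutation.Propositional using (_↭_)
open import Data.List.Relation.Binary.Permutation.Propositional.Properties using (↭-length)
open import Data.List.Relation.Unary.All as All using ([]; _∷_)
open import Data.List.Relation.Unary.AllPairs using ([]; _∷_)
open import Data.List.Relation.Unary.Any as Any using (here; there)
open import Data.List.Relation.Unary.Any.Properties using (lookup-index)
open import Data.List.Relation.Unary.Unique.Propositional using (Unique)
import Data.List.Relation.Unary.Unique.Propositional.Properties as Unique
open import Data.Nat.Base as ℕ using (ℕ; zero; suc; z≤n; s≤s)
import Data.Nat.Properties as ℕ
open import Data.Product.Base using (Σ; ∃; _×_; _,_; proj₁; proj₂)
import Data.Sign.Base as Sign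
open import Data.Sum.Base using (_⊎_; inj₁; inj₂; [_,_]′)
open import Data.Unit.Base using (tt) renaming (⊤ to Unit)
import Data.Vec.Base as Vec
import Data.Vec.Properties as Vec
open import Function.Base using (_∘_; id; flip; case_of_)
open import Function.Bundles using (mk⇔)
open import Induction.WellFounded using (WellFounded; Acc; acc)
open import Relation.Binary.Construct.Closure.ReflexiveTransitive
  using (Star; _◅_; _◅◅_) renaming (ε to nil)
open import Relation.Binary.Core using (Rel)
open import Relation.Binary.PropositionalEquality as ≡
  using (_≡_; _≢_; refl; sym; trans; cong; cong₂; subst; module ≡-Reasoning)
import Relation.Binary.Reasoning.Setoid as ≈-Reasoning
open import Relation.Nullary.Decidable
  using (Dec; yes; no; does; map′; ¬?; _×-dec_; _→-dec_; dec-true; dec-false)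
open import Relation.Nullary.Negation using (¬_; contradiction)
open import Relation.Unary using (Pred; Decidable)
open import Defs

-- Finite sums

-- The matrices of `G` and of its tree graph have different sizes, so they are compared through
-- traces alone. The negative diagonal of B is expanded too: a step may stay in place with weight
-- -x_e, e an edge out of the current vertex, and such a step changes neither the support nor the
-- tree. Every term of a trace is then a walk with a support, and the comparison is made term by
-- term, without cancellation. Sorting the trees by the value W of ψ turns the condition that a tree
-- is fixed by a walk into the condition that the walk stays inside W, which is what the trace of
-- B_W counts.
--
-- The series of a whole graph (W = V, or the tree graph) has degree at most the number of vertices
-- minus one, since its B is singular, and its coefficient there is the sum over the spanning trees.
-- In degree 0 the trace identity says that `G` has as many spanning trees as the sum of the m(W)
-- |W|. Since m(V) = 1, both sides fall short by exactly one, so the compared coefficients lie in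
-- the same degree; there the factor of V contributes F_G and every other W a power of Ψ.

module BigOp {c ℓ} (M : CommutativeMonoid c ℓ) where
  open CommutativeMonoid M hiding (refl; sym; trans; reflexive)
  private module ≈ = CommutativeMonoid M
  open import Algebra.Properties.CommutativeSemigroup commutativeSemigroup using (interchange)
  open ≈-Reasoning setoid

  ⨁ : {A : Set} → List A → (A → Carrier) → Carrier
  ⨁ xs f = foldr _∙_ ε (map f xs)

  -- Only the boolean `does P?` enters, so that conditions built with `×-dec` unfold to nested ones
  -- and a proof may split on a decision passed to it as an argument.
  when : ∀ {p} {P : Set p} → Dec P → Carrier → Carrier
  when P? x = if does P? then x else ε

  when-yes : ∀ {p} {P : Set p} (P? : Dec P) {x} → P → when P? x ≡ x
  when-yes P? p rewrite dec-true P? p = refl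

  when-no : ∀ {p} {P : Set p} (P? : Dec P) {x} → ¬ P → when P? x ≡ ε
  when-no P? ¬p rewrite dec-false P? ¬p = refl

  when-ε : ∀ {p} {P : Set p} (P? : Dec P) → when P? ε ≈ ε
  when-ε (yes _) = ≈.refl
  when-ε (no _)  = ≈.refl

  when-cong : ∀ {p q} {P : Set p} {Q : Set q} (P? : Dec P) (Q? : Dec Q) {x y} →
              (P → Q) → (Q → P) → (P → Q → x ≈ y) → when P? x ≈ when Q? y
  when-cong (yes p) Q? P⇒Q Q⇒P x≈y = ≈.trans (x≈y p (P⇒Q p)) (≈.reflexive (sym (when-yes Q? (P⇒Q p))))
  when-cong (no ¬p) Q? P⇒Q Q⇒P x≈y = ≈.reflexive (sym (when-no Q? (¬p ∘ Q⇒P)))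

  when-congʳ : ∀ {p} {P : Set p} (P? : Dec P) {x y} → (P → x ≈ y) → when P? x ≈ when P? y
  when-congʳ P? x≈y = when-cong P? P? id id (λ p _ → x≈y p)

  when-× : ∀ {p q} {P : Set p} {Q : Set q} (P? : Dec P) (Q? : Dec Q) {x} →
           when (P? ×-dec Q?) x ≡ when P? (when Q? x)
  when-× (yes _) (yes _) = refl
  when-× (yes _) (no _)  = refl
  when-× (no _)  _       = refl

  when-comm : ∀ {p q} {P : Set p} {Q : Set q} (P? : Dec P) (Q? : Dec Q) {x} →
              when P? (when Q? x) ≈ when Q? (when P? x)
  when-comm (yes _) Q? = ≈.refl
  when-comm (no _)  Q? = ≈.sym (when-ε Q?)

  when-∙ : ∀ {p} {P : Set p} (P? : Dec P) {x y} → when P? (x ∙ y) ≈ when P? x ∙ when P? y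
  when-∙ (yes _) = ≈.refl
  when-∙ (no _)  = ≈.sym (identityˡ ε)

  module _ {A : Set} where

    ⨁-cong : ∀ (xs : List A) {f g} → (∀ x → f x ≈ g x) → ⨁ xs f ≈ ⨁ xs g
    ⨁-cong []       f≈g = ≈.refl
    ⨁-cong (x ∷ xs) f≈g = ∙-cong (f≈g x) (⨁-cong xs f≈g)

    ⨁-cong-∈ : ∀ (xs : List A) {f g} → (∀ x → x ∈ˡ xs → f x ≈ g x) → ⨁ xs f ≈ ⨁ xs g
    ⨁-cong-∈ []       f≈g = ≈.refl
    ⨁-cong-∈ (x ∷ xs) f≈g = ∙-cong (f≈g x (here refl)) (⨁-cong-∈ xs λ y → f≈g y ∘ there)

    ⨁-ε : ∀ (xs : List A) → ⨁ xs (λ _ → ε) ≈ ε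
    ⨁-ε []       = ≈.refl
    ⨁-ε (x ∷ xs) = ≈.trans (identityˡ _) (⨁-ε xs)

    ⨁-∙ : ∀ (xs : List A) {f g} → ⨁ xs (λ x → f x ∙ g x) ≈ ⨁ xs f ∙ ⨁ xs g
    ⨁-∙ []       = ≈.sym (identityˡ ε)
    ⨁-∙ (x ∷ xs) = ≈.trans (∙-congˡ (⨁-∙ xs)) (interchange _ _ _ _)

    ⨁-++ : ∀ (xs ys : List A) {f} → ⨁ (xs ++ ys) f ≈ ⨁ xs f ∙ ⨁ ys f
    ⨁-++ []       ys = ≈.sym (identityˡ _)
    ⨁-++ (x ∷ xs) ys = ≈.trans (∙-congˡ (⨁-++ xs ys)) (≈.sym (assoc _ _ _))

    ⨁-filter : ∀ {p} {P : Pred A p} (P? : Decidable P) xs {f} →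
               ⨁ (filter P? xs) f ≈ ⨁ xs (λ x → when (P? x) (f x))
    ⨁-filter P? []       = ≈.refl
    ⨁-filter P? (x ∷ xs) with P? x
    ... | yes _ = ∙-congˡ (⨁-filter P? xs)
    ... | no _  = ≈.trans (⨁-filter P? xs) (≈.sym (identityˡ _))

    when-⨁ : ∀ {p} {P : Set p} (P? : Dec P) (xs : List A) {f} →
             when P? (⨁ xs f) ≈ ⨁ xs (λ x → when P? (f x))
    when-⨁ (yes _) xs = ≈.refl
    when-⨁ (no _)  xs = ≈.sym (⨁-ε xs)

    ⨁-map : ∀ {B : Set} (h : B → A) (xs : List B) {f} → ⨁ (map h xs) f ≡ ⨁ xs (f ∘ h)
    ⨁-map h []       = refl
    ⨁-map h (x ∷ xs) = cong (_ ∙_) (⨁-map h xs)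

    ⨁-↭ : ∀ {xs ys : List A} {f} → xs ↭ ys → ⨁ xs f ≈ ⨁ ys f
    ⨁-↭ _↭_.refl          = ≈.refl
    ⨁-↭ (_↭_.prep x p)    = ∙-congˡ (⨁-↭ p)
    ⨁-↭ {f = f} (_↭_.swap {xs} {ys} x y p) = begin
      f x ∙ (f y ∙ ⨁ xs f) ≈⟨ assoc _ _ _ ⟨
      f x ∙ f y ∙ ⨁ xs f   ≈⟨ ∙-cong (comm _ _) (⨁-↭ p) ⟩
      f y ∙ f x ∙ ⨁ ys f   ≈⟨ assoc _ _ _ ⟩
      f y ∙ (f x ∙ ⨁ ys f) ∎
    ⨁-↭ (_↭_.trans p q)   = ≈.trans (⨁-↭ p) (⨁-↭ q)

    -- Read from right to left, it introduces a sum over all values of a function, by which the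
    -- terms of another sum are then sorted.
    ⨁-only : ∀ {p} {P : Pred A p} (P? : Decidable P) {xs} {f : A → Carrier} {z} → Unique xs → z ∈ˡ xs → P z →
             (∀ x → P x → x ≡ z) → ⨁ xs (λ x → when (P? x) (f x)) ≈ f z
    ⨁-only {P = P} P? {x ∷ xs} {f} {z} (x≢ ∷ u) (here refl) Pz P⇒z = begin
      when (P? x) (f x) ∙ ⨁ xs (λ y → when (P? y) (f y)) ≈⟨ ∙-cong (≈.reflexive (when-yes (P? x) Pz)) (⨁-cong-∈ xs vanish) ⟩
      f x ∙ ⨁ xs (λ _ → ε)       ≈⟨ ∙-congˡ (⨁-ε xs) ⟩
      f x ∙ ε                    ≈⟨ identityʳ _ ⟩
      f x                        ∎
      where
      vanish : ∀ y → y ∈ˡ xs → when (P? y) (f y) ≈ ε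
      vanish y y∈xs = ≈.reflexive (when-no (P? y) λ Py → All.lookup x≢ y∈xs (sym (P⇒z y Py)))
    ⨁-only P? {x ∷ xs} {f} (x≢ ∷ u) (there z∈) Pz P⇒z = ≈.trans
      (∙-cong (≈.reflexive (when-no (P? x) λ Px → All.lookup x≢ z∈ (P⇒z x Px))) (⨁-only P? {f = f} u z∈ Pz P⇒z))
      (identityˡ _)

  ⨁-swap : ∀ {A B : Set} (xs : List A) (ys : List B) {f : A → B → Carrier} →
           ⨁ xs (λ x → ⨁ ys (f x)) ≈ ⨁ ys (λ y → ⨁ xs (λ x → f x y))
  ⨁-swap []       ys = ≈.sym (⨁-ε ys)
  ⨁-swap (x ∷ xs) ys {f} = ≈.trans (∙-congˡ (⨁-swap xs ys {f})) (≈.sym (⨁-∙ ys))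

  ⨁-cartesianProduct : ∀ {A B : Set} (xs : List A) (ys : List B) {f} →
                       ⨁ (cartesianProduct xs ys) f ≈ ⨁ xs (λ x → ⨁ ys (λ y → f (x , y)))
  ⨁-cartesianProduct []       ys = ≈.refl
  ⨁-cartesianProduct (x ∷ xs) ys = ≈.trans (⨁-++ (map (x ,_) ys) _)
    (∙-cong (≈.reflexive (⨁-map (x ,_) ys)) (⨁-cartesianProduct xs ys))

  ⨁-allFin-suc : ∀ n {f : Fin (suc n) → Carrier} → ⨁ (allFin (suc n)) f ≡ f zero ∙ ⨁ (allFin n) (f ∘ suc)
  ⨁-allFin-suc n {f} = cong (λ zs → f zero ∙ foldr _∙_ ε zs)
    (trans (List.map-tabulate suc f) (sym (List.map-tabulate id (f ∘ suc))))

  ⨁-lookup : ∀ {A : Set} (xs : List A) {f} → ⨁ (allFin (length xs)) (f ∘ lookup xs) ≡ ⨁ xs f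
  ⨁-lookup []       = refl
  ⨁-lookup (x ∷ xs) {f} = trans (⨁-allFin-suc (length xs)) (cong (f x ∙_) (⨁-lookup xs))

module BigSum {c ℓ} (S : CommutativeSemiring c ℓ) where
  open CommutativeSemiring S hiding (zero; refl; sym; trans; reflexive)
  private module ≈ = CommutativeSemiring S
  open BigOp +-commutativeMonoid public
  open import Algebra.Properties.Semiring.Mult semiring using () renaming (_×_ to _·_)

  *-⨁ : ∀ {A : Set} a (xs : List A) {f} → a * ⨁ xs f ≈ ⨁ xs (λ x → a * f x)
  *-⨁ a []       = zeroʳ a
  *-⨁ a (x ∷ xs) = ≈.trans (distribˡ _ _ _) (+-congˡ (*-⨁ a xs))

  *-when : ∀ {p} {P : Set p} a (P? : Dec P) {x} → a * when P? x ≈ when P? (a * x)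
  *-when a (yes _) = ≈.refl
  *-when a (no _)  = zeroʳ a

  ⨁-const : ∀ {A : Set} (xs : List A) {a} → ⨁ xs (λ _ → a) ≡ length xs · a
  ⨁-const []       = refl
  ⨁-const (x ∷ xs) = cong (_ +_) (⨁-const xs)

-- Bijections between duplicate-free lists

module _ {A B : Set} where

  map-unique : ∀ {f : A → B} {xs} → (∀ {x y} → x ∈ˡ xs → y ∈ˡ xs → f x ≡ f y → x ≡ y) →
               Unique xs → Unique (map f xs)
  map-unique {xs = []}     inj [] = []
  map-unique {f} {x ∷ xs} inj (x≢ ∷ u) =
    All.tabulate fx≢ ∷ map-unique (λ x∈ y∈ → inj (there x∈) (there y∈)) u
    where
    fx≢ : ∀ {z} → z ∈ˡ map f xs → f x ≢ z
    fx≢ z∈ fx≡z with ∈-map⁻ f z∈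
    ... | y , y∈ , refl = All.lookup x≢ y∈ (inj (here refl) (there y∈) fx≡z)

  -- Duplicate-free lists with the same elements are permutations of each other. Injectivity is
  -- asked on the members of `xs` only, because the maps used below forget information in general.
  bijection-↭ : ∀ {f : A → B} {xs ys} → Unique xs → Unique ys →
                (∀ {x} → x ∈ˡ xs → f x ∈ˡ ys) →
                (∀ {x y} → x ∈ˡ xs → y ∈ˡ xs → f x ≡ f y → x ≡ y) →
                (∀ {y} → y ∈ˡ ys → ∃ λ x → x ∈ˡ xs × f x ≡ y) →
                map f xs ↭ ys
  bijection-↭ {f} u v into inj onto = ∼bag⇒↭ (unique∧set⇒bag (map-unique inj u) v
    (mk⇔ (λ z∈ → case ∈-map⁻ f z∈ of λ { (x , x∈ , refl) → into x∈ })
         (λ z∈ → case onto z∈ of λ { (x , x∈ , refl) → ∈-map⁺ f x∈ })))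

lookup-injective : ∀ {A : Set} {xs : List A} → Unique xs → ∀ i j → lookup xs i ≡ lookup xs j → i ≡ j
lookup-injective (_ ∷ _)  zero    zero    _  = refl
lookup-injective (x≢ ∷ _) zero    (suc j) eq = contradiction eq (All.lookup x≢ (∈-lookup j))
lookup-injective (x≢ ∷ _) (suc i) zero    eq = contradiction (sym eq) (All.lookup x≢ (∈-lookup i))
lookup-injective (_ ∷ u)  (suc i) (suc j) eq = cong suc (lookup-injective u i j eq)

open import Algebra.Properties.Semiring.Mult ℕ.+-*-semiring using () renaming (_×_ to _·ℕ_)

k·1≡k : ∀ k → k ·ℕ 1 ≡ k
k·1≡k zero    = refl
k·1≡k (suc k) = cong suc (k·1≡k k)

-- Formal power series

module PowerSeries {c ℓ} (R : CommutativeRing c ℓ) where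
  open CommutativeRing R hiding (zero; refl; sym; trans; reflexive)
  private module ≈ = CommutativeRing R
  open import Algebra.Properties.Semiring.Mult semiring using (×-congʳ) renaming (_×_ to _·_)
  open import Algebra.Properties.CommutativeMonoid.Mult +-commutativeMonoid using (×-distrib-+)
  open Solver commutativeSemiring using (solve; _:=_; _:+_; _:*_; con)
  open ≈-Reasoning setoid

  Series : Set c
  Series = ℕ → Carrier

  infix  4 _≋_
  infixl 6 _⊕_
  infixl 7 _⊛_

  _≋_ : Series → Series → Set ℓ
  f ≋ g = ∀ k → f k ≈ g k

  -- The Cauchy product, from f = f 0 + t (f ∘ suc). The recursion peels off the left factor;
  -- `⊛-suc′` is its mirror image.
  _⊕_ _⊛_ : Series → Series → Series
  (f ⊕ g) k = f k + g k
  (f ⊛ g) zero    = f 0 * g 0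
  (f ⊛ g) (suc k) = f 0 * g (suc k) + (f ∘ suc ⊛ g) k

  𝟎 : Series
  𝟎 _ = 0#

  scalar : Carrier → Series
  scalar a zero    = a
  scalar a (suc _) = 0#

  -- The bounded form serves the strong induction of `Newton-unique`, where the factors are known to
  -- agree only up to degree `k`.
  ⊛-cong-≤ : ∀ k {f f′ g g′} → (∀ j → j ℕ.≤ k → f j ≈ f′ j) → (∀ j → j ℕ.≤ k → g j ≈ g′ j) →
             (f ⊛ g) k ≈ (f′ ⊛ g′) k
  ⊛-cong-≤ zero    p q = *-cong (p 0 z≤n) (q 0 z≤n)
  ⊛-cong-≤ (suc k) p q = +-cong (*-cong (p 0 z≤n) (q (suc k) ℕ.≤-refl))
    (⊛-cong-≤ k (λ j j≤k → p (suc j) (s≤s j≤k)) (λ j j≤k → q j (ℕ.m≤n⇒m≤1+n j≤k)))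

  ⊛-cong : ∀ {f f′ g g′} → f ≋ f′ → g ≋ g′ → f ⊛ g ≋ f′ ⊛ g′
  ⊛-cong p q k = ⊛-cong-≤ k (λ j _ → p j) (λ j _ → q j)

  ⊛-zeroˡ : ∀ {f} → f ≋ 𝟎 → ∀ g → f ⊛ g ≋ 𝟎
  ⊛-zeroˡ p g zero    = ≈.trans (*-congʳ (p 0)) (zeroˡ _)
  ⊛-zeroˡ p g (suc k) = ≈.trans (+-cong (≈.trans (*-congʳ (p 0)) (zeroˡ _)) (⊛-zeroˡ (p ∘ suc) g k)) (+-identityˡ 0#)

  scalar-⊛ : ∀ a g → scalar a ⊛ g ≋ λ k → a * g k
  scalar-⊛ a g zero    = ≈.refl
  scalar-⊛ a g (suc k) = ≈.trans (+-congˡ (⊛-zeroˡ (λ _ → ≈.refl) g k)) (+-identityʳ _)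

  ⊛-distribʳ : ∀ h f g → (f ⊕ g) ⊛ h ≋ f ⊛ h ⊕ g ⊛ h
  ⊛-distribʳ h f g zero    = distribʳ _ _ _
  ⊛-distribʳ h f g (suc k) = ≈.trans (+-congˡ (⊛-distribʳ h (f ∘ suc) (g ∘ suc) k))
    (solve 5 (λ a b c d e → (a :+ b) :* c :+ (d :+ e) := (a :* c :+ d) :+ (b :* c :+ e)) ≈.refl _ _ _ _ _)

  *-⊛-assoc : ∀ a f g → (λ k → a * f k) ⊛ g ≋ λ k → a * (f ⊛ g) k
  *-⊛-assoc a f g zero    = *-assoc _ _ _
  *-⊛-assoc a f g (suc k) = ≈.trans (+-cong (*-assoc _ _ _) (*-⊛-assoc a (f ∘ suc) g k)) (≈.sym (distribˡ _ _ _))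

  ⊛-suc′ : ∀ f g k → (f ⊛ g) (suc k) ≈ f (suc k) * g 0 + (f ⊛ g ∘ suc) k
  ⊛-suc′ f g zero    = +-comm _ _
  ⊛-suc′ f g (suc k) = begin
    f 0 * g (suc (suc k)) + (f ∘ suc ⊛ g) (suc k)
      ≈⟨ +-congˡ (⊛-suc′ (f ∘ suc) g k) ⟩
    f 0 * g (suc (suc k)) + (f (suc (suc k)) * g 0 + (f ∘ suc ⊛ g ∘ suc) k)
      ≈⟨ solve 3 (λ a b c → a :+ (b :+ c) := b :+ (a :+ c)) ≈.refl _ _ _ ⟩
    f (suc (suc k)) * g 0 + (f ⊛ g ∘ suc) (suc k) ∎

  ⊛-comm : ∀ f g → f ⊛ g ≋ g ⊛ f
  ⊛-comm f g zero    = *-comm _ _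
  ⊛-comm f g (suc k) = begin
    f 0 * g (suc k) + (f ∘ suc ⊛ g) k ≈⟨ +-cong (*-comm _ _) (⊛-comm (f ∘ suc) g k) ⟩
    g (suc k) * f 0 + (g ⊛ f ∘ suc) k ≈⟨ ⊛-suc′ g f k ⟨
    (g ⊛ f) (suc k)                   ∎

  ⊛-assoc : ∀ f g h → (f ⊛ g) ⊛ h ≋ f ⊛ (g ⊛ h)
  ⊛-assoc f g h zero    = *-assoc _ _ _
  ⊛-assoc f g h (suc k) = begin
    f 0 * g 0 * h (suc k) + (((λ j → f 0 * g (suc j)) ⊕ f ∘ suc ⊛ g) ⊛ h) k
      ≈⟨ +-cong (*-assoc _ _ _) (⊛-distribʳ h _ _ k) ⟩
    f 0 * (g 0 * h (suc k)) + (((λ j → f 0 * g (suc j)) ⊛ h) k + ((f ∘ suc ⊛ g) ⊛ h) k)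
      ≈⟨ +-congˡ (+-cong (*-⊛-assoc (f 0) (g ∘ suc) h k) (⊛-assoc (f ∘ suc) g h k)) ⟩
    f 0 * (g 0 * h (suc k)) + (f 0 * (g ∘ suc ⊛ h) k + (f ∘ suc ⊛ (g ⊛ h)) k)
      ≈⟨ solve 4 (λ a b c d → a :* b :+ (a :* c :+ d) := a :* (b :+ c) :+ d) ≈.refl _ _ _ _ ⟩
    (f ⊛ (g ⊛ h)) (suc k) ∎

  ⊛-identityˡ : ∀ f → scalar 1# ⊛ f ≋ f
  ⊛-identityˡ f k = ≈.trans (scalar-⊛ 1# f k) (*-identityˡ (f k))

  ⊛-distribˡ : ∀ h f g → h ⊛ (f ⊕ g) ≋ h ⊛ f ⊕ h ⊛ g
  ⊛-distribˡ h f g k = ≈.trans (⊛-comm h _ k)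
    (≈.trans (⊛-distribʳ h f g k) (+-cong (⊛-comm f h k) (⊛-comm g h k)))

  seriesRing : CommutativeRing c ℓ
  seriesRing = record
    { Carrier = Series ; _≈_ = _≋_ ; _+_ = _⊕_ ; _*_ = _⊛_ ; -_ = λ f k → - f k ; 0# = 𝟎 ; 1# = scalar 1#
    ; isCommutativeRing = record
      { isRing = record
        { +-isAbelianGroup = record
          { isGroup = record
            { isMonoid = record
              { isSemigroup = record
                { isMagma = record
                  { isEquivalence = record
                    { refl  = λ _ → ≈.refl
                    ; sym   = λ p k → ≈.sym (p k)
                    ; trans = λ p q k → ≈.trans (p k) (q k) }
                  ; ∙-cong = λ p q k → +-cong (p k) (q k) }
                ; assoc = λ f g h k → +-assoc _ _ _ }
              ; identity = (λ f k → +-identityˡ _) , (λ f k → +-identityʳ _) }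
            ; inverse = (λ f k → -‿inverseˡ _) , (λ f k → -‿inverseʳ _)
            ; ⁻¹-cong = λ p k → -‿cong (p k) }
          ; comm = λ f g k → +-comm _ _ }
        ; *-cong = ⊛-cong
        ; *-assoc = ⊛-assoc
        ; *-identity = ⊛-identityˡ , (λ f k → ≈.trans (⊛-comm f _ k) (⊛-identityˡ f k))
        ; distrib = ⊛-distribˡ , ⊛-distribʳ }
      ; *-comm = ⊛-comm }
    }

  private
    module S = CommutativeRing seriesRing
  open import Algebra.Properties.Semiring.Mult S.semiring using () renaming (_×_ to _·ₛ_) public
  open import Algebra.Properties.Semiring.Exp S.semiring using () renaming (_^_ to _^ₛ_) public
  open import Algebra.Properties.Semiring.Exp semiring using (_^_)

  -- Newton's identities

  -- The derivation t d/dt.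
  θ : Series → Series
  θ f k = k · f k

  θ-⊛ : ∀ f g → θ (f ⊛ g) ≋ θ f ⊛ g ⊕ f ⊛ θ g
  θ-⊛ f g zero    = solve 2 (λ a b → con 0 := con 0 :* b :+ a :* con 0) ≈.refl (f 0) (g 0)
  θ-⊛ f g (suc k) = begin
    (a * b + p k) + k · (a * b + p k)
      ≈⟨ +-congˡ (×-distrib-+ _ _ k) ⟩
    (a * b + p k) + (k · (a * b) + k · p k)
      ≈⟨ +-congˡ (+-cong (×-comm-* k) (θ-⊛ (f ∘ suc) g k)) ⟩
    (a * b + p k) + (a * (k · b) + ((θ (f ∘ suc) ⊛ g) k + (f ∘ suc ⊛ θ g) k))
      ≈⟨ solve 6 (λ a b p c q r → (a :* b :+ p) :+ (a :* c :+ (q :+ r))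
                              := (con 0 :* b :+ (p :+ q)) :+ (a :* (b :+ c) :+ r)) ≈.refl a b (p k) (k · b) _ _ ⟩
    (0# * b + (p k + (θ (f ∘ suc) ⊛ g) k)) + (a * (b + k · b) + (f ∘ suc ⊛ θ g) k)
      ≈⟨ +-congʳ (+-congˡ (⊛-distribʳ g (f ∘ suc) (θ (f ∘ suc)) k)) ⟨
    (θ f ⊛ g ⊕ f ⊛ θ g) (suc k) ∎
    where
    a = f 0
    b = g (suc k)
    p = f ∘ suc ⊛ g
    ×-comm-* : ∀ k → k · (a * b) ≈ a * (k · b)
    ×-comm-* zero    = ≈.sym (zeroʳ a)
    ×-comm-* (suc k) = ≈.trans (+-congˡ (×-comm-* k)) (≈.sym (distribˡ _ _ _))

  -- If f = det (1 − tB), then f satisfies this with T k = tr (Bᵏ).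
  Newton : Series → Series → Set ℓ
  Newton f T = θ f ⊕ f ⊛ T ≋ scalar (T 0) ⊛ f

  Newton-congʳ : ∀ {f T U} → T ≋ U → Newton f T → Newton f U
  Newton-congʳ {f} {T} {U} T≋U N k = begin
    θ f k + (f ⊛ U) k    ≈⟨ +-congˡ (⊛-cong {f} (λ _ → ≈.refl) T≋U k) ⟨
    θ f k + (f ⊛ T) k    ≈⟨ N k ⟩
    (scalar (T 0) ⊛ f) k ≈⟨ scalar-⊛ (T 0) f k ⟩
    T 0 * f k            ≈⟨ *-congʳ (T≋U 0) ⟩
    U 0 * f k            ≈⟨ scalar-⊛ (U 0) f k ⟨
    (scalar (U 0) ⊛ f) k ∎

  private
    ·0 : ∀ k → k · 0# ≈ 0#
    ·0 zero    = ≈.refl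
    ·0 (suc k) = ≈.trans (+-identityˡ _) (·0 k)

  Newton-1 : Newton (scalar 1#) 𝟎
  Newton-1 k = begin
    θ (scalar 1#) k + (scalar 1# ⊛ 𝟎) k ≈⟨ +-cong (θ1 k) (⊛-identityˡ 𝟎 k) ⟩
    0# + 0#                             ≈⟨ +-identityˡ 0# ⟩
    0#                                  ≈⟨ ⊛-zeroˡ {scalar 0#} (λ { zero → ≈.refl ; (suc _) → ≈.refl }) _ k ⟨
    (scalar 0# ⊛ scalar 1#) k           ∎
    where
    θ1 : ∀ k → k · scalar 1# k ≈ 0#
    θ1 zero    = ≈.refl
    θ1 (suc k) = ·0 (suc k)

  -- The identity reads θ f = (T 0 - T) f, so T is, up to its constant term, minus the logarithmic
  -- derivative of f; logarithmic derivatives of a product add up.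
  Newton-⊛ : ∀ {f g T U} → Newton f T → Newton g U → Newton (f ⊛ g) (T ⊕ U)
  Newton-⊛ {f} {g} {T} {U} N M k = begin
    (θ (f ⊛ g) ⊕ (f ⊛ g) ⊛ (T ⊕ U)) k
      ≈⟨ +-congʳ (θ-⊛ f g k) ⟩
    ((θ f ⊛ g ⊕ f ⊛ θ g) ⊕ (f ⊛ g) ⊛ (T ⊕ U)) k
      ≈⟨ solveₛ 6 (λ f g t u f′ g′ → (f′ ⊠ g ⊞ f ⊠ g′) ⊞ (f ⊠ g) ⊠ (t ⊞ u)
           ⊜ (f′ ⊞ f ⊠ t) ⊠ g ⊞ f ⊠ (g′ ⊞ g ⊠ u)) (λ _ → ≈.refl) f g T U (θ f) (θ g) k ⟩
    ((θ f ⊕ f ⊛ T) ⊛ g ⊕ f ⊛ (θ g ⊕ g ⊛ U)) k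
      ≈⟨ +-cong (⊛-cong {g = g} N (λ _ → ≈.refl) k) (⊛-cong {f} (λ _ → ≈.refl) M k) ⟩
    (scalar (T 0) ⊛ f ⊛ g ⊕ f ⊛ (scalar (U 0) ⊛ g)) k
      ≈⟨ solveₛ 4 (λ f g t u → t ⊠ f ⊠ g ⊞ f ⊠ (u ⊠ g) ⊜ (t ⊞ u) ⊠ (f ⊠ g)) (λ _ → ≈.refl)
           f g (scalar (T 0)) (scalar (U 0)) k ⟩
    ((scalar (T 0) ⊕ scalar (U 0)) ⊛ (f ⊛ g)) k
      ≈⟨ ⊛-cong {g = f ⊛ g} scalar-⊕ (λ _ → ≈.refl) k ⟩
    (scalar (T 0 + U 0) ⊛ (f ⊛ g)) k ∎
    where
    open Solver S.commutativeSemiring using () renaming (solve to solveₛ; _:=_ to _⊜_; _:+_ to _⊞_; _:*_ to _⊠_)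
    scalar-⊕ : scalar (T 0) ⊕ scalar (U 0) ≋ scalar (T 0 + U 0)
    scalar-⊕ zero    = ≈.refl
    scalar-⊕ (suc _) = +-identityˡ 0#

  Newton-^ : ∀ {f T} k → Newton f T → Newton (f ^ₛ k) (k ·ₛ T)
  Newton-^ zero    N = Newton-1
  Newton-^ {f} {T} (suc k) N = Newton-⊛ {f} {f ^ₛ k} {T} {k ·ₛ T} N (Newton-^ k N)

  TorsionFree : Set _
  TorsionFree = ∀ k {a} → suc k · a ≈ 0# → a ≈ 0#

  ·-injective : TorsionFree → ∀ k {a b} → suc k · a ≈ suc k · b → a ≈ b
  ·-injective torsionFree k {a} {b} ka≈kb = a-b≈0⇒a≈b (torsionFree k (begin
    suc k · (a + - b)             ≈⟨ ×-distrib-+ a (- b) (suc k) ⟩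
    suc k · a + suc k · (- b)     ≈⟨ +-congʳ ka≈kb ⟩
    suc k · b + suc k · (- b)     ≈⟨ ×-distrib-+ b (- b) (suc k) ⟨
    suc k · (b + - b)             ≈⟨ ×-congʳ (suc k) (-‿inverseʳ b) ⟩
    suc k · 0#                    ≈⟨ ·0 (suc k) ⟩
    0#                            ∎))
    where
    a-b≈0⇒a≈b : a + - b ≈ 0# → a ≈ b
    a-b≈0⇒a≈b = x∙y⁻¹≈ε⇒x≈y a b
      where open import Algebra.Properties.Group +-group using (x∙y⁻¹≈ε⇒x≈y)

  -- Once the terms with `T 0` cancel, degree k + 1 of the identity expresses (k + 1) f (k + 1)
  -- through the coefficients of lower degree. Absence of torsion allows the division by k + 1.
  Newton-unique : TorsionFree → ∀ {f g T} → f 0 ≈ g 0 → Newton f T → Newton g T → f ≋ g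
  Newton-unique torsionFree {f} {g} {T} f₀≈g₀ N M k = agree k k ℕ.≤-refl
    where
    open import Algebra.Properties.Group +-group using (∙-cancelˡ; ∙-cancelʳ)

    recurrence : ∀ {h} → Newton h T → ∀ k → suc k · h (suc k) + (h ⊛ T ∘ suc) k ≈ 0#
    recurrence {h} N k = ∙-cancelˡ (T 0 * h (suc k)) _ _ (begin
      T 0 * h (suc k) + (suc k · h (suc k) + (h ⊛ T ∘ suc) k)
        ≈⟨ solve 4 (λ t h d r → t :* h :+ (d :+ r) := d :+ (h :* t :+ r)) ≈.refl (T 0) (h (suc k)) _ _ ⟩
      suc k · h (suc k) + (h (suc k) * T 0 + (h ⊛ T ∘ suc) k)
        ≈⟨ +-congˡ (⊛-suc′ h T k) ⟨
      suc k · h (suc k) + (h ⊛ T) (suc k)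
        ≈⟨ N (suc k) ⟩
      (scalar (T 0) ⊛ h) (suc k)
        ≈⟨ scalar-⊛ (T 0) h (suc k) ⟩
      T 0 * h (suc k)
        ≈⟨ +-identityʳ _ ⟨
      T 0 * h (suc k) + 0# ∎)

    agree : ∀ k j → j ℕ.≤ k → f j ≈ g j
    agree k       zero    _         = f₀≈g₀
    agree (suc k) (suc j) (s≤s j≤k) = ·-injective torsionFree j (∙-cancelʳ ((g ⊛ T ∘ suc) j) _ _ (begin
      suc j · f (suc j) + (g ⊛ T ∘ suc) j
        ≈⟨ +-congˡ (⊛-cong-≤ j (λ i i≤j → agree k i (ℕ.≤-trans i≤j j≤k)) (λ _ _ → ≈.refl)) ⟨
      suc j · f (suc j) + (f ⊛ T ∘ suc) j ≈⟨ recurrence {f} N j ⟩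
      0#                                  ≈⟨ recurrence {g} M j ⟨
      suc j · g (suc j) + (g ⊛ T ∘ suc) j ∎))

  -- Top coefficients

  -- Here `d` bounds the degree and `a` may vanish; in this form the notion is multiplicative over
  -- every ring, even with zero divisors.
  record Top (f : Series) (d : ℕ) (a : Carrier) : Set ℓ where
    constructor _,_
    field
      vanish : ∀ {k} → d ℕ.< k → f k ≈ 0#
      top    : f d ≈ a
  open Top public

  Top-⊛ : ∀ {f g d e a b} → Top f d a → Top g e b → Top (f ⊛ g) (d ℕ.+ e) (a * b)
  Top-⊛ {f} {g} {zero} {e} {a} {b} F G = vanish′ , top′ e {g} (top G)
    where
    f′≋𝟎 : f ∘ suc ≋ 𝟎
    f′≋𝟎 k = vanish F (s≤s z≤n)
    vanish′ : ∀ {k} → e ℕ.< k → (f ⊛ g) k ≈ 0#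
    vanish′ {suc k} e<k = ≈.trans (+-cong (≈.trans (*-congˡ (vanish G e<k)) (zeroʳ _)) (⊛-zeroˡ f′≋𝟎 g k)) (+-identityˡ 0#)
    top′ : ∀ e {g} → g e ≈ b → (f ⊛ g) e ≈ a * b
    top′ zero    q = *-cong (top F) q
    top′ (suc e) q = ≈.trans (+-cong (*-cong (top F) q) (⊛-zeroˡ f′≋𝟎 _ e)) (+-identityʳ _)
  Top-⊛ {f} {g} {suc d} {e} {a} {b} F G = vanish′ ,
    ≈.trans (+-cong (≈.trans (*-congˡ (vanish G (s≤s (ℕ.m≤n+m e d)))) (zeroʳ _)) (top FG)) (+-identityˡ _)
    where
    FG = Top-⊛ {f ∘ suc} {g} {d} {e} {a} {b} ((λ d<k → vanish F (s≤s d<k)) , top F) G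
    vanish′ : ∀ {k} → suc d ℕ.+ e ℕ.< k → (f ⊛ g) k ≈ 0#
    vanish′ {suc k} (s≤s lt) = ≈.trans
      (+-cong (≈.trans (*-congˡ (vanish G (ℕ.m≤n⇒m≤1+n (ℕ.≤-<-trans (ℕ.m≤n+m e d) lt)))) (zeroʳ _)) (vanish FG lt))
      (+-identityˡ 0#)

  Top-1 : Top (scalar 1#) 0 1#
  Top-1 = (λ { (s≤s _) → ≈.refl }) , ≈.refl

  Top-^ : ∀ {f d a} k → Top f d a → Top (f ^ₛ k) (k ℕ.* d) (a ^ k)
  Top-^ zero    F = Top-1
  Top-^ (suc k) F = Top-⊛ F (Top-^ k F)

-- A torsion-free ring mapping onto given elements of any ring

infix 4 _⟶_

_⟶_ : ∀ {a b ℓ₁ ℓ₂} → CommutativeRing a ℓ₁ → CommutativeRing b ℓ₂ → Set _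
A ⟶ B = Σ (A.Carrier → B.Carrier) (IsSemiringHomomorphism (Semiring.rawSemiring A.semiring) (Semiring.rawSemiring B.semiring))
  where
  module A = CommutativeRing A
  module B = CommutativeRing B

-- Coefficients are listed from the constant one upwards; two polynomials are
-- equal when they have the same coefficients, trailing zeros being ignored.
module Polynomial {c ℓ} (A : CommutativeRing c ℓ) where
  open CommutativeRing A hiding (_-_; zero; refl; sym; trans; reflexive)
  private module ≈ = CommutativeRing A
  open PowerSeries A using (seriesRing; _≋_; _⊕_; _⊛_; scalar; TorsionFree)
  open import Algebra.Properties.Semiring.Mult semiring using () renaming (_×_ to _·_)

  coefficient : List Carrier → ℕ → Carrier
  coefficient []      _       = 0#
  coefficient (a ∷ p) zero    = a
  coefficient (a ∷ p) (suc k) = coefficient p k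

  infixl 6 _+ₚ_
  infixl 7 _*ₚ_ _·ₚ_

  _+ₚ_ : List Carrier → List Carrier → List Carrier
  []      +ₚ q       = q
  (a ∷ p) +ₚ []      = a ∷ p
  (a ∷ p) +ₚ (b ∷ q) = (a + b) ∷ (p +ₚ q)

  _·ₚ_ : Carrier → List Carrier → List Carrier
  a ·ₚ p = map (a *_) p

  _*ₚ_ : List Carrier → List Carrier → List Carrier
  []      *ₚ q = []
  (a ∷ p) *ₚ q = a ·ₚ q +ₚ (0# ∷ (p *ₚ q))

  coefficient-+ : ∀ p q → coefficient (p +ₚ q) ≋ coefficient p ⊕ coefficient q
  coefficient-+ []      q       k       = ≈.sym (+-identityˡ _)
  coefficient-+ (a ∷ p) []      k       = ≈.sym (+-identityʳ _)
  coefficient-+ (a ∷ p) (b ∷ q) zero    = ≈.refl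
  coefficient-+ (a ∷ p) (b ∷ q) (suc k) = coefficient-+ p q k

  coefficient-· : ∀ a p k → coefficient (a ·ₚ p) k ≈ a * coefficient p k
  coefficient-· a []      k       = ≈.sym (zeroʳ a)
  coefficient-· a (b ∷ p) zero    = ≈.refl
  coefficient-· a (b ∷ p) (suc k) = coefficient-· a p k

  coefficient-* : ∀ p q → coefficient (p *ₚ q) ≋ coefficient p ⊛ coefficient q
  coefficient-* []      q k = ≈.sym (PowerSeries.⊛-zeroˡ A (λ _ → ≈.refl) (coefficient q) k)
  coefficient-* (a ∷ p) q k = ≈.trans (coefficient-+ (a ·ₚ q) (0# ∷ (p *ₚ q)) k) (step k)
    where
    step : ∀ k → coefficient (a ·ₚ q) k + coefficient (0# ∷ (p *ₚ q)) k ≈ (coefficient (a ∷ p) ⊛ coefficient q) k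
    step zero    = ≈.trans (+-identityʳ _) (coefficient-· a q 0)
    step (suc k) = +-cong (coefficient-· a q (suc k)) (coefficient-* p q k)

  coefficient-neg : ∀ p k → coefficient (map (-_) p) k ≈ - coefficient p k
  coefficient-neg []      k       = ≈.sym ε⁻¹≈ε
    where open import Algebra.Properties.Group +-group using (ε⁻¹≈ε)
  coefficient-neg (a ∷ p) zero    = ≈.refl
  coefficient-neg (a ∷ p) (suc k) = coefficient-neg p k

  coefficient-1 : coefficient (1# ∷ []) ≋ scalar 1#
  coefficient-1 zero    = ≈.refl
  coefficient-1 (suc k) = ≈.refl

  -- The axioms are pulled back along `coefficient`, which is injective into the power series by the
  -- very definition of equality.
  polynomialRing : CommutativeRing c ℓ
  polynomialRing = record
    { Carrier = List Carrier
    ; _≈_ = λ p q → coefficient p ≋ coefficient q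
    ; _+_ = _+ₚ_ ; _*_ = _*ₚ_ ; -_ = map (-_) ; 0# = [] ; 1# = 1# ∷ []
    ; isCommutativeRing = RingMonomorphism.isCommutativeRing monomorphism
                            (CommutativeRing.isCommutativeRing seriesRing)
    }
    where
    monomorphism = record
      { isRingHomomorphism = record
        { isSemiringHomomorphism = record
          { isNearSemiringHomomorphism = record
            { +-isMonoidHomomorphism = record
              { isMagmaHomomorphism = record
                { isRelHomomorphism = record { cong = id }
                ; homo = coefficient-+ }
              ; ε-homo = λ _ → ≈.refl }
            ; *-homo = coefficient-* }
          ; 1#-homo = coefficient-1 }
        ; -‿homo = coefficient-neg }
      ; injective = id }

  private module P = CommutativeRing polynomialRing

  polynomial-torsionFree : TorsionFree → PowerSeries.TorsionFree polynomialRing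
  polynomial-torsionFree torsionFree k {p} kp≈0 j = torsionFree k (≈.trans (≈.sym (coefficient-× (suc k))) (kp≈0 j))
    where
    open import Algebra.Properties.Semiring.Mult P.semiring using () renaming (_×_ to _·′_)
    coefficient-× : ∀ k → coefficient (k ·′ p) j ≈ k · coefficient p j
    coefficient-× zero    = ≈.refl
    coefficient-× (suc k) = ≈.trans (coefficient-+ p (k ·′ p) j) (+-congˡ (coefficient-× k))

  indeterminate : List Carrier
  indeterminate = 0# ∷ 1# ∷ []

  module _ {d ℓ′} (B : CommutativeRing d ℓ′) (h : A ⟶ B) (b : CommutativeRing.Carrier B) where
    private module B = CommutativeRing B
    open IsSemiringHomomorphism (proj₂ h) using (⟦⟧-cong; +-homo; *-homo; 0#-homo; 1#-homo)
    open Solver B.commutativeSemiring using (solve; _:=_; _:+_; _:*_; con)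
    open ≈-Reasoning B.setoid
    private ⟦_⟧ = proj₁ h

    evaluate : List Carrier → B.Carrier
    evaluate []      = B.0#
    evaluate (a ∷ p) = ⟦ a ⟧ B.+ b B.* evaluate p

    -- Equal polynomials may be lists of different lengths; this disposes of the excess zeros in
    -- `evaluate-cong`.
    evaluate-≈0 : ∀ p → (∀ k → coefficient p k ≈ 0#) → evaluate p B.≈ B.0#
    evaluate-≈0 []      z = B.refl
    evaluate-≈0 (a ∷ p) z = begin
      ⟦ a ⟧ B.+ b B.* evaluate p ≈⟨ B.+-cong (⟦⟧-cong (z 0)) (B.*-congˡ (evaluate-≈0 p (z ∘ suc))) ⟩
      ⟦ 0# ⟧ B.+ b B.* B.0#      ≈⟨ B.+-cong 0#-homo (B.zeroʳ b) ⟩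
      B.0# B.+ B.0#              ≈⟨ B.+-identityˡ _ ⟩
      B.0#                       ∎

    evaluate-cong : ∀ p q → p P.≈ q → evaluate p B.≈ evaluate q
    evaluate-cong []      q       p≈q = B.sym (evaluate-≈0 q (λ k → ≈.sym (p≈q k)))
    evaluate-cong (a ∷ p) []      p≈q = evaluate-≈0 (a ∷ p) p≈q
    evaluate-cong (a ∷ p) (a′ ∷ q) p≈q =
      B.+-cong (⟦⟧-cong (p≈q 0)) (B.*-congˡ (evaluate-cong p q (p≈q ∘ suc)))

    evaluate-+ : ∀ p q → evaluate (p +ₚ q) B.≈ evaluate p B.+ evaluate q
    evaluate-+ []      q        = B.sym (B.+-identityˡ _)
    evaluate-+ (a ∷ p) []       = B.sym (B.+-identityʳ _)
    evaluate-+ (a ∷ p) (a′ ∷ q) = begin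
      ⟦ a + a′ ⟧ B.+ b B.* evaluate (p +ₚ q)
        ≈⟨ B.+-cong (+-homo a a′) (B.*-congˡ (evaluate-+ p q)) ⟩
      (⟦ a ⟧ B.+ ⟦ a′ ⟧) B.+ b B.* (evaluate p B.+ evaluate q)
        ≈⟨ solve 5 (λ a a′ b p q → (a :+ a′) :+ b :* (p :+ q) := (a :+ b :* p) :+ (a′ :+ b :* q)) B.refl _ _ _ _ _ ⟩
      evaluate (a ∷ p) B.+ evaluate (a′ ∷ q) ∎

    evaluate-· : ∀ a p → evaluate (a ·ₚ p) B.≈ ⟦ a ⟧ B.* evaluate p
    evaluate-· a []       = B.sym (B.zeroʳ _)
    evaluate-· a (a′ ∷ p) = begin
      ⟦ a * a′ ⟧ B.+ b B.* evaluate (a ·ₚ p)           ≈⟨ B.+-cong (*-homo a a′) (B.*-congˡ (evaluate-· a p)) ⟩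
      ⟦ a ⟧ B.* ⟦ a′ ⟧ B.+ b B.* (⟦ a ⟧ B.* evaluate p)
        ≈⟨ solve 4 (λ a a′ b p → a :* a′ :+ b :* (a :* p) := a :* (a′ :+ b :* p)) B.refl _ _ _ _ ⟩
      ⟦ a ⟧ B.* evaluate (a′ ∷ p) ∎

    evaluate-* : ∀ p q → evaluate (p *ₚ q) B.≈ evaluate p B.* evaluate q
    evaluate-* []      q = B.sym (B.zeroˡ _)
    evaluate-* (a ∷ p) q = begin
      evaluate (a ·ₚ q +ₚ (0# ∷ (p *ₚ q)))
        ≈⟨ evaluate-+ (a ·ₚ q) _ ⟩
      evaluate (a ·ₚ q) B.+ (⟦ 0# ⟧ B.+ b B.* evaluate (p *ₚ q))
        ≈⟨ B.+-cong (evaluate-· a q) (B.+-cong 0#-homo (B.*-congˡ (evaluate-* p q))) ⟩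
      ⟦ a ⟧ B.* evaluate q B.+ (B.0# B.+ b B.* (evaluate p B.* evaluate q))
        ≈⟨ solve 4 (λ a q b p → a :* q :+ (con 0 :+ b :* (p :* q)) := (a :+ b :* p) :* q) B.refl _ _ _ _ ⟩
      evaluate (a ∷ p) B.* evaluate q ∎

    evaluate-constant : ∀ a → evaluate (a ∷ []) B.≈ ⟦ a ⟧
    evaluate-constant a = B.trans (B.+-congˡ (B.zeroʳ b)) (B.+-identityʳ _)

    evaluate-indeterminate : evaluate indeterminate B.≈ b
    evaluate-indeterminate = begin
      ⟦ 0# ⟧ B.+ b B.* evaluate (1# ∷ []) ≈⟨ B.+-cong 0#-homo (B.*-congˡ (B.trans (evaluate-constant 1#) 1#-homo)) ⟩
      B.0# B.+ b B.* B.1#                 ≈⟨ solve 1 (λ b → con 0 :+ b :* con 1 := b) B.refl b ⟩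
      b                                   ∎

    evaluate-hom : polynomialRing ⟶ B
    evaluate-hom = evaluate , record
      { isNearSemiringHomomorphism = record
        { +-isMonoidHomomorphism = record
          { isMagmaHomomorphism = record
            { isRelHomomorphism = record { cong = λ {p} {q} → evaluate-cong p q }
            ; homo = evaluate-+ }
          ; ε-homo = B.refl }
        ; *-homo = evaluate-* }
      ; 1#-homo = B.trans (evaluate-constant 1#) 1#-homo }

-- The integers as initial ring

module FromInteger {c ℓ} (R : CommutativeRing c ℓ) where
  open CommutativeRing R hiding (zero; refl; sym; trans; reflexive)
  private module ≈ = CommutativeRing R
  open import Algebra.Properties.Semiring.Mult semiring using (×1-homo-*; ×-homo-+) renaming (_×_ to _·_)
  open import Algebra.Properties.Ring ring using (-‿distribˡ-*; -‿distribʳ-*)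
  open import Algebra.Properties.AbelianGroup +-abelianGroup using (⁻¹-∙-comm; ⁻¹-involutive; ε⁻¹≈ε)
  open ≈-Reasoning setoid

  fromℤ : ℤ.ℤ → Carrier
  fromℤ (ℤ.+ n)      = n · 1#
  fromℤ (ℤ.-[1+ n ]) = - (suc n · 1#)

  fromℤ-⊖ : ∀ m n → fromℤ (m ℤ.⊖ n) ≈ m · 1# + - (n · 1#)
  fromℤ-⊖ zero    zero    = ≈.sym (-‿inverseʳ 0#)
  fromℤ-⊖ zero    (suc n) = ≈.sym (+-identityˡ _)
  fromℤ-⊖ (suc m) zero    = ≈.sym (≈.trans (+-congˡ ε⁻¹≈ε) (+-identityʳ _))
  fromℤ-⊖ (suc m) (suc n) = begin
    fromℤ (suc m ℤ.⊖ suc n)               ≡⟨ cong fromℤ (ℤ.[1+m]⊖[1+n]≡m⊖n m n) ⟩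
    fromℤ (m ℤ.⊖ n)                       ≈⟨ fromℤ-⊖ m n ⟩
    a + - b                               ≈⟨ +-congʳ (+-identityʳ a) ⟨
    (a + 0#) + - b                        ≈⟨ +-congʳ (+-congˡ (-‿inverseʳ 1#)) ⟨
    (a + (1# + - 1#)) + - b               ≈⟨ +-congʳ (≈.trans (≈.sym (+-assoc _ _ _)) (+-congʳ (+-comm _ _))) ⟩
    (1# + a + - 1#) + - b                 ≈⟨ +-assoc _ _ _ ⟩
    1# + a + (- 1# + - b)                 ≈⟨ +-congˡ (⁻¹-∙-comm 1# b) ⟩
    1# + a + - (1# + b)                   ∎
    where
    a = m · 1#
    b = n · 1#

  fromℤ-+ : ∀ i j → fromℤ (i ℤ.+ j) ≈ fromℤ i + fromℤ j
  fromℤ-+ (ℤ.+ m)      (ℤ.+ n)      = ×-homo-+ 1# m n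
  fromℤ-+ (ℤ.+ m)      (ℤ.-[1+ n ]) = fromℤ-⊖ m (suc n)
  fromℤ-+ (ℤ.-[1+ m ]) (ℤ.+ n)      = ≈.trans (fromℤ-⊖ n (suc m)) (+-comm _ _)
  fromℤ-+ (ℤ.-[1+ m ]) (ℤ.-[1+ n ]) = begin
    - ((suc (suc (m ℕ.+ n))) · 1#)    ≡⟨ cong (λ k → - (suc k · 1#)) (ℕ.+-suc m n) ⟨
    - ((suc m ℕ.+ suc n) · 1#)        ≈⟨ -‿cong (×-homo-+ 1# (suc m) (suc n)) ⟩
    - (suc m · 1# + suc n · 1#)       ≈⟨ ⁻¹-∙-comm _ _ ⟨
    - (suc m · 1#) + - (suc n · 1#)   ∎

  fromℤ-neg : ∀ n → fromℤ (Sign.- ℤ.◃ n) ≈ - (n · 1#)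
  fromℤ-neg zero    = ≈.sym ε⁻¹≈ε
  fromℤ-neg (suc n) = ≈.refl

  fromℤ-pos : ∀ n → fromℤ (Sign.+ ℤ.◃ n) ≈ n · 1#
  fromℤ-pos zero    = ≈.refl
  fromℤ-pos (suc n) = ≈.refl

  fromℤ-* : ∀ i j → fromℤ (i ℤ.* j) ≈ fromℤ i * fromℤ j
  fromℤ-* (ℤ.+ m)      (ℤ.+ n)      = ≈.trans (fromℤ-pos (m ℕ.* n)) (×1-homo-* m n)
  fromℤ-* (ℤ.+ m)      (ℤ.-[1+ n ]) = ≈.trans (fromℤ-neg (m ℕ.* suc n))
    (≈.trans (-‿cong (×1-homo-* m (suc n))) (-‿distribʳ-* _ _))
  fromℤ-* (ℤ.-[1+ m ]) (ℤ.+ n)      = ≈.trans (fromℤ-neg (suc m ℕ.* n))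
    (≈.trans (-‿cong (×1-homo-* (suc m) n)) (-‿distribˡ-* _ _))
  fromℤ-* (ℤ.-[1+ m ]) (ℤ.-[1+ n ]) = begin
    fromℤ (Sign.+ ℤ.◃ (suc m ℕ.* suc n)) ≈⟨ fromℤ-pos (suc m ℕ.* suc n) ⟩
    (suc m ℕ.* suc n) · 1#               ≈⟨ ×1-homo-* (suc m) (suc n) ⟩
    a * b                                ≈⟨ ⁻¹-involutive _ ⟨
    - - (a * b)                          ≈⟨ -‿cong (-‿distribˡ-* a b) ⟩
    - (- a * b)                          ≈⟨ -‿distribʳ-* (- a) b ⟩
    - a * - b                            ∎
    where
    a = suc m · 1#
    b = suc n · 1#

  fromℤ-hom : ℤ.+-*-commutativeRing ⟶ R
  fromℤ-hom = fromℤ , record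
    { isNearSemiringHomomorphism = record
      { +-isMonoidHomomorphism = record
        { isMagmaHomomorphism = record
          { isRelHomomorphism = record { cong = λ { refl → ≈.refl } }
          ; homo = fromℤ-+ }
        ; ε-homo = ≈.refl }
      ; *-homo = fromℤ-* }
    ; 1#-homo = +-identityʳ 1# }

ℤ-torsionFree : PowerSeries.TorsionFree ℤ.+-*-commutativeRing
ℤ-torsionFree k {i} ki≡0 with ℤ.i*j≡0⇒i≡0∨j≡0 (ℤ.+ suc k) (trans (sym (·-ℤ (suc k))) ki≡0)
  where
  open import Algebra.Properties.Semiring.Mult ℤ.+-*-semiring using () renaming (_×_ to _·_)
  ·-ℤ : ∀ k → k · i ≡ (ℤ.+ k) ℤ.* i
  ·-ℤ zero    = sym (ℤ.*-zeroˡ i)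
  ·-ℤ (suc k) = trans (cong (λ j → i ℤ.+ j) (·-ℤ k)) (sym (ℤ.suc-* (ℤ.+ k) i))
... | inj₂ i≡0 = i≡0

module _ {c ℓ} (R : CommutativeRing c ℓ) where
  private module R = CommutativeRing R

  record TorsionFreeCover {m} (x : Fin m → R.Carrier) : Set (Level.suc 0ℓ ⊔ c ⊔ ℓ) where
    field
      ring        : CommutativeRing 0ℓ 0ℓ
      torsionFree : PowerSeries.TorsionFree ring
      hom         : ring ⟶ R
      var         : Fin m → CommutativeRing.Carrier ring
      hom-var     : ∀ e → proj₁ hom (var e) R.≈ x e

  -- Induction on the number of edges: each edge adjoins one indeterminate, to be evaluated at the
  -- weight of that edge.
  torsionFreeCover : ∀ {m} (x : Fin m → R.Carrier) → TorsionFreeCover x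
  torsionFreeCover {zero} x = record
    { ring        = ℤ.+-*-commutativeRing
    ; torsionFree = ℤ-torsionFree
    ; hom         = FromInteger.fromℤ-hom R
    ; var         = λ ()
    ; hom-var     = λ () }
  torsionFreeCover {suc m} x = record
    { ring        = polynomialRing
    ; torsionFree = polynomial-torsionFree torsionFree
    ; hom         = evaluate-hom R hom (x zero)
    ; var         = λ { zero → indeterminate ; (suc e) → var e ∷ [] }
    ; hom-var     = λ { zero    → evaluate-indeterminate R hom (x zero)
                      ; (suc e) → R.trans (evaluate-constant R hom (x zero) (var e)) (hom-var e) } }
    where
    open TorsionFreeCover (torsionFreeCover (x ∘ suc))
    open Polynomial ring

-- Subsets of Fin n

module _ {n} {P : Fin n → Set} (P? : ∀ i → Dec (P i)) where

  -- `outgoing` and `component` are definitionally of this form, so their membership lemmas are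
  -- instances of the next two.
  ⟪_⟫ : Subset n
  ⟪_⟫ = Vec.tabulate (does ∘ P?)

  ∈⟪⟫⁺ : ∀ {i} → P i → i ∈ ⟪_⟫
  ∈⟪⟫⁺ {i} p = Vec.lookup⇒[]= i ⟪_⟫ (trans (Vec.lookup∘tabulate (does ∘ P?) i) (dec-true (P? i) p))

  ∈⟪⟫⁻ : ∀ {i} → i ∈ ⟪_⟫ → P i
  ∈⟪⟫⁻ {i} i∈ with P? i | trans (sym (Vec.lookup∘tabulate (does ∘ P?) i)) (Vec.[]=⇒lookup i∈)
  ... | yes p | _ = p

module _ {n : ℕ} where

  ∪ˡ : ∀ {p q : Subset n} {i} → i ∈ p → i ∈ p ∪ q
  ∪ˡ i∈p = x∈p∪q⁺ (inj₁ i∈p)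

  ∪ʳ : ∀ {p q : Subset n} {i} → i ∈ q → i ∈ p ∪ q
  ∪ʳ i∈q = x∈p∪q⁺ (inj₂ i∈q)

  ∈⁅⁆ : ∀ {i j : Fin n} → i ≡ j → i ∈ ⁅ j ⁆
  ∈⁅⁆ refl = x∈⁅x⁆ _

  ⁅⁆⊆ : ∀ {p : Subset n} {i} → i ∈ p → ⁅ i ⁆ ⊆ p
  ⁅⁆⊆ {p} i∈p j∈ = subst (_∈ p) (sym (x∈⁅y⁆⇒x≡y _ j∈)) i∈p

  ∈─⁻ : ∀ (p q : Subset n) {i} → i ∈ p ─ q → i ∈ p × i ∉ q
  ∈─⁻ p q i∈ = p─q⊆p p q i∈ , λ i∈q → disjoint p q i∈ i∈q
    where
    disjoint : ∀ {n} (p q : Subset n) {i} → i ∈ p ─ q → i ∉ q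
    disjoint (_ Vec.∷ p) (inside Vec.∷ q)  (Vec.there i∈) (Vec.there i∈q) = disjoint p q i∈ i∈q
    disjoint (_ Vec.∷ p) (outside Vec.∷ q) (Vec.there i∈) (Vec.there i∈q) = disjoint p q i∈ i∈q

  ∣p∣≡0⇒∉ : ∀ {p : Subset n} → ∣ p ∣ ≡ 0 → ∀ {i} → i ∉ p
  ∣p∣≡0⇒∉ {p} eq {i} i∈p = ℕ.<⇒≱ (ℕ.≤-reflexive (sym (∣⁅x⁆∣≡1 i)))
    (subst (∣ ⁅ i ⁆ ∣ ℕ.≤_) eq (p⊆q⇒∣p∣≤∣q∣ (⁅⁆⊆ i∈p)))

  ∉⇒∣p∣≡0 : ∀ {p : Subset n} → (∀ {i} → i ∉ p) → ∣ p ∣ ≡ 0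
  ∉⇒∣p∣≡0 {p} ∉p rewrite Empty-unique {p = p} (λ (i , i∈) → ∉p i∈) = ∣⊥∣≡0 n

  ∣p∣≡1⇒∃! : ∀ {p : Subset n} → ∣ p ∣ ≡ 1 → ∃ λ i → i ∈ p × ∀ {j} → j ∈ p → i ≡ j
  ∣p∣≡1⇒∃! {p} eq with nonempty? p
  ... | no empty = contradiction (trans (sym eq) (∉⇒∣p∣≡0 λ i∈ → empty (_ , i∈))) λ ()
  ... | yes (i , i∈p) = i , i∈p , λ {j} j∈p → case i ≟ j of λ where
    (yes i≡j) → i≡j
    (no i≢j)  → contradiction
      (p⊂q⇒∣p∣<∣q∣ {p = ⁅ i ⁆} {q = p} (⁅⁆⊆ i∈p , j , j∈p , i≢j ∘ sym ∘ x∈⁅y⁆⇒x≡y i))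
      (ℕ.≤⇒≯ (ℕ.≤-reflexive (trans eq (sym (∣⁅x⁆∣≡1 i)))))

  ∃!⇒∣p∣≡1 : ∀ {p : Subset n} {i} → i ∈ p → (∀ {j} → j ∈ p → i ≡ j) → ∣ p ∣ ≡ 1
  ∃!⇒∣p∣≡1 {p} {i} i∈p unique = trans (cong ∣_∣ p≡⁅i⁆) (∣⁅x⁆∣≡1 i)
    where
    p≡⁅i⁆ : p ≡ ⁅ i ⁆
    p≡⁅i⁆ = ⊆-antisym (λ j∈ → subst (_∈ ⁅ i ⁆) (unique j∈) (x∈⁅x⁆ i))
                      (⁅⁆⊆ i∈p)

∈-allSubsets : ∀ {n} (p : Subset n) → p ∈ˡ allSubsets n
∈-allSubsets Vec.[]                        = here refl
∈-allSubsets {suc n} (outside Vec.∷ p) = ∈-++⁺ˡ (∈-map⁺ (outside Vec.∷_) (∈-allSubsets p))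
∈-allSubsets {suc n} (inside Vec.∷ p)  = ∈-++⁺ʳ (map (outside Vec.∷_) (allSubsets n)) (∈-map⁺ (inside Vec.∷_) (∈-allSubsets p))

allSubsets-unique : ∀ n → Unique (allSubsets n)
allSubsets-unique zero    = [] ∷ []
allSubsets-unique (suc n) = Unique.++⁺ (Unique.map⁺ (proj₂ ∘ Vec.∷-injective) (allSubsets-unique n))
  (Unique.map⁺ (proj₂ ∘ Vec.∷-injective) (allSubsets-unique n))
  λ (x∈ , y∈) → case (∈-map⁻ (outside Vec.∷_) x∈ , ∈-map⁻ (inside Vec.∷_) y∈) of λ { ((_ , _ , refl) , (_ , _ , ())) }

-- Forests

module Forests {n m} (G : Digraph n m) where
  open Graph G public

  edgeSets : List (Subset m)
  edgeSets = allSubsets m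

  ∈-outgoing⁺ : ∀ {e v} → source e ≡ v → e ∈ outgoing v
  ∈-outgoing⁺ {v = v} = ∈⟪⟫⁺ (λ e → source e ≟ v)

  ∈-outgoing⁻ : ∀ {e v} → e ∈ outgoing v → source e ≡ v
  ∈-outgoing⁻ {v = v} = ∈⟪⟫⁻ (λ e → source e ≟ v)

  Root : Subset m → Fin n → Set
  Root H v = ∀ {e} → e ∈ H → source e ≢ v

  root? : ∀ H v → Dec (Root H v)
  root? H v = map′ (λ r {e} → r e) (λ r e → r {e}) (all? λ e → e ∈? H →-dec ¬? (source e ≟ v))

  Functional : Subset m → Set
  Functional H = ∀ {e f} → e ∈ H → f ∈ H → source e ≡ source f → e ≡ f

  functional? : ∀ H → Dec (Functional H)
  functional? H = map′ (λ p {e} {f} → p e f) (λ p e f → p {e} {f})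
    (all? λ e → all? λ f → e ∈? H →-dec (f ∈? H →-dec (source e ≟ source f →-dec (e ≟ f))))

  Path : Subset m → Fin n → Fin n → Set
  Path H = Star (Step H)

  path? : ∀ H u v → Dec (Path H u v)
  path? H = star? (step? H)

  edge : ∀ {H e} → e ∈ H → Path H (source e) (target e)
  edge e∈H = (_ , e∈H , refl , refl) ◅ nil

  path-⊆ : ∀ {H K u v} → H ⊆ K → Path H u v → Path K u v
  path-⊆ H⊆K nil = nil
  path-⊆ H⊆K ((e , e∈ , p , q) ◅ π) = (e , H⊆K e∈ , p , q) ◅ path-⊆ H⊆K π

  root-path : ∀ {H u v} → Root H u → Path H u v → u ≡ v
  root-path r nil = refl
  root-path r ((e , e∈ , p , _) ◅ _) = contradiction p (r e∈)

  -- Functionality leaves no choice along a path, so both paths follow the same edges until one of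
  -- them stops at a root.
  root-unique : ∀ {H u r r′} → Functional H → Path H u r → Root H r → Path H u r′ → Root H r′ → r ≡ r′
  root-unique functional nil root ρ root′ = root-path root ρ
  root-unique functional ((f , f∈ , refl , _) ◅ π) root nil root′ = contradiction refl (root′ f∈)
  root-unique functional ((f , f∈ , refl , refl) ◅ π) root ((g , g∈ , s≡ , refl) ◅ ρ) root′
    with functional f∈ g∈ (sym s≡)
  ... | refl = root-unique functional π root ρ root′

  outdegree≡0⇒root : ∀ {H v} → outdegree H v ≡ 0 → Root H v
  outdegree≡0⇒root eq e∈H s≡v = ∣p∣≡0⇒∉ eq (x∈p∩q⁺ (e∈H , ∈-outgoing⁺ s≡v))

  root⇒outdegree≡0 : ∀ {H v} → Root H v → outdegree H v ≡ 0
  root⇒outdegree≡0 {H} {v} r = ∉⇒∣p∣≡0 λ e∈ → let e∈H , e∈out = x∈p∩q⁻ H (outgoing v) e∈ in r e∈H (∈-outgoing⁻ e∈out)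

  nonroot : ∀ {H v} → ¬ Root H v → ∃ λ e → e ∈ H × source e ≡ v
  nonroot {H} {v} ¬r with any? (λ e → e ∈? H ×-dec (source e ≟ v))
  ... | yes p = p
  ... | no ¬p = contradiction (λ {e} e∈H s≡v → ¬p (e , e∈H , s≡v)) ¬r

  -- In an acyclic set, reachability by at least one step is a strict order; on finitely many
  -- vertices it is noetherian, so following outgoing edges must end.
  acyclic⇒path-to-root : ∀ {H} → Acyclic H → ∀ u → ∃ λ r → Root H r × Path H u r
  acyclic⇒path-to-root {H} acyclic u = climb u (noetherian u)
    where
    _⊏_ : Rel (Fin n) 0ℓ
    u ⊏ v = ∃ λ w → Step H u w × Path H w v

    noetherian : WellFounded (flip _⊏_)
    noetherian = spo-noetherian record
      { isEquivalence = ≡.isEquivalence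
      ; irrefl        = λ { refl (_ , (e , e∈ , refl , refl) , π) → acyclic e e∈ π }
      ; trans         = λ (w , s , π) (w′ , s′ , π′) → w , s , π ◅◅ s′ ◅ π′
      ; <-resp-≈      = ≡.resp₂ _⊏_ }

    climb : ∀ u → Acc (flip _⊏_) u → ∃ λ r → Root H r × Path H u r
    climb u (acc rec) with root? H u
    ... | yes r = u , r , nil
    ... | no ¬r with nonroot ¬r
    ...   | e , e∈ , refl with climb (target e) (rec (_ , (e , e∈ , refl , refl) , nil))
    ...     | r , root , π = r , root , edge e∈ ◅◅ π

  -- A functional set offers no way out of a cycle. By induction on the path to the root, its first
  -- edge is the edge of the cycle, and the cycle rotated by one edge passes through the next
  -- vertex; at the end the root would have an outgoing edge.
  path-to-root⇒acyclic : ∀ {H} → Functional H → (∀ u → ∃ λ r → Root H r × Path H u r) → Acyclic H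
  path-to-root⇒acyclic {H} functional toRoot e e∈ π with toRoot (source e)
  ... | r , root , ρ = noCycle ρ e e∈ refl π
    where
    noCycle : ∀ {u} → Path H u r → ∀ e → e ∈ H → source e ≡ u → ¬ Path H (target e) u
    noCycle nil e e∈ s≡u _ = root e∈ s≡u
    noCycle ((f , f∈ , refl , refl) ◅ ρ) e e∈ s≡u π with functional e∈ f∈ s≡u
    ... | refl = step π refl
      where
      step : ∀ {u} → Path H (target e) u → u ≢ source e
      step nil                           t≡s  = noCycle ρ e e∈ (sym t≡s) nil
      step ((g , g∈ , s≡ , refl) ◅ π) refl = noCycle ρ g g∈ s≡ (π ◅◅ edge e∈)

  -- The working form of `IsForest`: degree counts and acyclicity become functionality and a path
  -- from every vertex to `U`, which can be followed through exchanges of edges.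
  record Rooted (U : Subset n) (H : Subset m) : Set where
    field
      roots      : ∀ {v} → v ∈ U → Root H v
      functional : Functional H
      reaches    : ∀ v → ∃ λ u → u ∈ U × Path H v u

  isForest⇒rooted : ∀ {U H} → IsForest U H → Rooted U H
  isForest⇒rooted {U} {H} (deg0 , deg1 , acyclic) = record
    { roots = roots ; functional = functional ; reaches = reaches }
    where
    roots : ∀ {v} → v ∈ U → Root H v
    roots v∈U = outdegree≡0⇒root (deg0 _ v∈U)

    functional : Functional H
    functional {e} {f} e∈ f∈ s≡ with source e ∈? U
    ... | yes s∈U = contradiction refl (roots s∈U e∈)
    ... | no s∉U with ∣p∣≡1⇒∃! (deg1 _ s∉U)
    ...   | g , _ , unique = trans (sym (unique (x∈p∩q⁺ (e∈ , ∈-outgoing⁺ refl))))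
                                   (unique (x∈p∩q⁺ (f∈ , ∈-outgoing⁺ (sym s≡))))

    reaches : ∀ v → ∃ λ u → u ∈ U × Path H v u
    reaches v with acyclic⇒path-to-root acyclic v
    ... | r , root , π with r ∈? U
    ...   | yes r∈U = r , r∈U , π
    ...   | no r∉U with ∣p∣≡1⇒∃! (deg1 r r∉U)
    ...     | e , e∈ , _ = let e∈H , e∈out = x∈p∩q⁻ H (outgoing r) e∈ in contradiction (∈-outgoing⁻ e∈out) (root e∈H)

  rooted⇒isForest : ∀ {U H} → Rooted U H → IsForest U H
  rooted⇒isForest {U} {H} F = (λ v v∈U → root⇒outdegree≡0 (roots v∈U)) , deg1 ,
    path-to-root⇒acyclic functional (λ u → let r , r∈U , π = reaches u in r , roots r∈U , π)
    where
    open Rooted F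
    deg1 : ∀ v → v ∉ U → outdegree H v ≡ 1
    deg1 v v∉U with reaches v
    ... | _ , v∈U , nil = contradiction v∈U v∉U
    ... | _ , _ , (e , e∈ , refl , _) ◅ _ = ∃!⇒∣p∣≡1 (x∈p∩q⁺ (e∈ , ∈-outgoing⁺ refl)) λ f∈ →
      let f∈H , f∈out = x∈p∩q⁻ H (outgoing v) f∈ in functional e∈ f∈H (sym (∈-outgoing⁻ f∈out))

  rooted-root : ∀ {U H v} → Rooted U H → Root H v → v ∈ U
  rooted-root {U} F r with Rooted.reaches F _
  ... | u , u∈U , π = subst (_∈ U) (sym (root-path r π)) u∈U

  tree-root-unique : ∀ {H u v} → Rooted ⁅ u ⁆ H → Rooted ⁅ v ⁆ H → u ≡ v
  tree-root-unique {u = u} {v} F F′ = x∈⁅y⁆⇒x≡y v (rooted-root F′ (Rooted.roots F (x∈⁅x⁆ u)))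

  restrict : Subset m → Subset n → Subset m
  restrict H S = ⟪ (λ e → e ∈? H ×-dec ¬? (source e ∈? S)) ⟫

  ∈-restrict⁺ : ∀ {H S e} → e ∈ H → source e ∉ S → e ∈ restrict H S
  ∈-restrict⁺ {H} {S} e∈ s∉ = ∈⟪⟫⁺ (λ e → e ∈? H ×-dec ¬? (source e ∈? S)) (e∈ , s∉)

  ∈-restrict⁻ : ∀ {H S e} → e ∈ restrict H S → e ∈ H × source e ∉ S
  ∈-restrict⁻ {H} {S} = ∈⟪⟫⁻ (λ e → e ∈? H ×-dec ¬? (source e ∈? S))

  -- Cut at its first vertex in `S`, a path uses only edges whose sources lie outside `S`.
  firstVisit : ∀ S {H u w} → Path H u w → w ∈ S → ∃ λ s → s ∈ S × Path (restrict H S) u s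
  firstVisit S {u = u} π w∈S with u ∈? S
  ... | yes u∈S = u , u∈S , nil
  firstVisit S nil                          w∈S | no u∉S = contradiction w∈S u∉S
  firstVisit S ((e , e∈ , refl , refl) ◅ π) w∈S | no u∉S with firstVisit S π w∈S
  ... | s , s∈S , ρ = s , s∈S , edge (∈-restrict⁺ e∈ u∉S) ◅◅ ρ

  restrict-rooted : ∀ {U S H} → Rooted U H → U ⊆ S → Rooted S (restrict H S)
  restrict-rooted {U} {S} {H} F U⊆S = record
    { roots      = λ v∈S e∈ s≡v → proj₂ (∈-restrict⁻ {H} e∈) (subst (_∈ S) (sym s≡v) v∈S)
    ; functional = λ e∈ f∈ → functional (proj₁ (∈-restrict⁻ {H} {S} e∈)) (proj₁ (∈-restrict⁻ {H} {S} f∈))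
    ; reaches    = λ v → let u , u∈U , π = reaches v in firstVisit S π (U⊆S u∈U) }
    where open Rooted F

  move : Subset m → Fin m → Subset m
  move H e = (H ─ outgoing (target e)) ∪ ⁅ e ⁆

  ∈-move⁻ : ∀ {H e f} → f ∈ move H e → (f ∈ H × source f ≢ target e) ⊎ f ≡ e
  ∈-move⁻ {H} {e} f∈ with x∈p∪q⁻ _ _ f∈
  ... | inj₁ f∈─ = let f∈H , f∉out = ∈─⁻ H (outgoing (target e)) f∈─ in inj₁ (f∈H , f∉out ∘ ∈-outgoing⁺)
  ... | inj₂ f∈e = inj₂ (x∈⁅y⁆⇒x≡y e f∈e)

  ∈-move⁺ : ∀ {H e f} → f ∈ H → source f ≢ target e → f ∈ move H e
  ∈-move⁺ f∈H s≢t = ∪ˡ (x∈p∧x∉q⇒x∈p─q f∈H (s≢t ∘ ∈-outgoing⁻))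

  new∈move : ∀ {H} e → e ∈ move H e
  new∈move e = ∪ʳ (x∈⁅x⁆ e)

  move-tree : ∀ {H e} → source e ≢ target e → Rooted ⁅ source e ⁆ H → Rooted ⁅ target e ⁆ (move H e)
  move-tree {H} {e} s≢t T = record { roots = roots′ ; functional = functional′ ; reaches = reaches′ }
    where
    open Rooted T
    root-s : Root H (source e)
    root-s = roots (x∈⁅x⁆ _)

    roots′ : ∀ {v} → v ∈ ⁅ target e ⁆ → Root (move H e) v
    roots′ v∈ f∈ s≡v with x∈⁅y⁆⇒x≡y _ v∈ | ∈-move⁻ {H} f∈
    ... | refl | inj₁ (_ , s≢) = s≢ s≡v
    ... | refl | inj₂ refl     = s≢t s≡v

    functional′ : Functional (move H e)
    functional′ f∈ g∈ s≡ with ∈-move⁻ {H} f∈ | ∈-move⁻ {H} g∈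
    ... | inj₁ (f∈H , _) | inj₁ (g∈H , _) = functional f∈H g∈H s≡
    ... | inj₁ (f∈H , _) | inj₂ refl      = contradiction s≡ (root-s f∈H)
    ... | inj₂ refl      | inj₁ (g∈H , _) = contradiction (sym s≡) (root-s g∈H)
    ... | inj₂ refl      | inj₂ refl      = refl

    -- Cut at the first visit to an end of `e`, a path of `H` avoids the deleted edge. If it has
    -- arrived at the old root, the new edge `e` takes it to the new one.
    ends = ⁅ source e ⁆ ∪ ⁅ target e ⁆

    restrict⊆move : restrict H ends ⊆ move H e
    restrict⊆move f∈ = let f∈H , s∉ = ∈-restrict⁻ {H} f∈ in
      ∈-move⁺ f∈H λ s≡t → s∉ (∪ʳ (∈⁅⁆ s≡t))

    reaches′ : ∀ v → ∃ λ u → u ∈ ⁅ target e ⁆ × Path (move H e) v u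
    reaches′ v with reaches v
    ... | u , u∈ , π with firstVisit ends π (∪ˡ u∈)
    ...   | s , s∈ , ρ with x∈p∪q⁻ ⁅ source e ⁆ ⁅ target e ⁆ s∈
    ...     | inj₂ s∈t = s , s∈t , path-⊆ restrict⊆move ρ
    ...     | inj₁ s∈s with x∈⁅y⁆⇒x≡y _ s∈s
    ...       | refl = target e , x∈⁅x⁆ _ , path-⊆ restrict⊆move ρ ◅◅ edge (new∈move {H} e)

  -- Grafting: a path runs through the forest `K` down to `S` and is then led to `v` inside `K ∪ τ`.
  -- Functionality survives because `K` has no edges out of `S` and `τ` has no others.
  ∪-tree : ∀ {S K τ v} → Rooted S K → (∀ {e} → e ∈ τ → source e ∈ S) → Functional τ →
           v ∈ S → Root τ v → (∀ {u} → u ∈ S → Path (K ∪ τ) u v) → Rooted ⁅ v ⁆ (K ∪ τ)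
  ∪-tree {S} {K} {τ} {v} F τ⊆S τ-functional v∈S τ-root toRoot = record
    { roots = λ u∈ → λ e∈ s≡u → rootᵥ e∈ (trans s≡u (x∈⁅y⁆⇒x≡y v u∈))
    ; functional = functional′
    ; reaches = λ u → let s , s∈S , π = reaches u in v , x∈⁅x⁆ v , path-⊆ (p⊆p∪q τ) π ◅◅ toRoot s∈S }
    where
    open Rooted F
    rootᵥ : Root (K ∪ τ) v
    rootᵥ e∈ with x∈p∪q⁻ K τ e∈
    ... | inj₁ e∈K = roots v∈S e∈K
    ... | inj₂ e∈τ = τ-root e∈τ

    functional′ : Functional (K ∪ τ)
    functional′ e∈ f∈ s≡ with x∈p∪q⁻ K τ e∈ | x∈p∪q⁻ K τ f∈
    ... | inj₁ e∈K | inj₁ f∈K = functional e∈K f∈K s≡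
    ... | inj₁ e∈K | inj₂ f∈τ = contradiction s≡ (roots (τ⊆S f∈τ) e∈K)
    ... | inj₂ e∈τ | inj₁ f∈K = contradiction (sym s≡) (roots (τ⊆S e∈τ) f∈K)
    ... | inj₂ e∈τ | inj₂ f∈τ = τ-functional e∈τ f∈τ s≡

-- The exploration algorithm

module Exploration {n m} (G : Digraph n m) (simple : Simple G) where
  open Forests G public
  open Simple simple

  private
    dropSource⁺ : ∀ {w e L} → e ∈ˡ L → source e ≢ w → e ∈ˡ dropSource w L
    dropSource⁺ {w} = ∈-filter⁺ (λ e → ¬? (source e ≟ w))

    dropSource⁻ : ∀ {w e L} → e ∈ˡ dropSource w L → e ∈ˡ L × source e ≢ w
    dropSource⁻ {w} {L = L} = ∈-filter⁻ (λ e → ¬? (source e ≟ w)) {xs = L}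

    intoVertex⁺ : ∀ {w e L} → e ∈ˡ L → target e ≡ w → e ∈ˡ intoVertex w L
    intoVertex⁺ {w} = ∈-filter⁺ (λ e → target e ≟ w)

    intoVertex⁻ : ∀ {w e L} → e ∈ˡ intoVertex w L → e ∈ˡ L × target e ≡ w
    intoVertex⁻ {w} {L = L} = ∈-filter⁻ (λ e → target e ≟ w) {xs = L}

    dropVertex⁺ : ∀ {w e L} → e ∈ˡ L → source e ≢ w → target e ≢ w → e ∈ˡ dropVertex w L
    dropVertex⁺ {w} e∈ s≢ t≢ = ∈-filter⁺ (λ e → ¬? (source e ≟ w) ×-dec ¬? (target e ≟ w)) e∈ (s≢ , t≢)

    dropVertex⁻ : ∀ {w e L} → e ∈ˡ dropVertex w L → e ∈ˡ L × source e ≢ w × target e ≢ w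
    dropVertex⁻ {w} {L = L} = ∈-filter⁻ (λ e → ¬? (source e ≟ w) ×-dec ¬? (target e ≟ w)) {xs = L}

    ∈-edgesBySource : ∀ e → e ∈ˡ edgesBySource
    ∈-edgesBySource e = ∈-concatMap⁺ (λ u → filter (λ f → source f ≟ u) (allFin m))
      (lose (∈-allFin (source e)) (∈-filter⁺ (λ f → source f ≟ source e) (∈-allFin e) refl))

  ∉∪ : ∀ {k} {p q : Subset k} {i} → i ∉ p → i ∉ q → i ∉ p ∪ q
  ∉∪ {p = p} {q} ∉p ∉q i∈ = [ ∉p , ∉q ]′ (x∈p∪q⁻ p q i∈)

  -- D is the set of the vertices whose edge towards A was not in the tree.
  record Invariant (k : ℕ) (A D : Subset n) (F L : List (Fin m)) : Set where
    field
      disjoint : ∀ {u} → u ∈ A → u ∉ D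
      F⁺ : ∀ {e} → source e ∉ A → source e ∉ D → target e ∉ D → e ∈ˡ F
      F⁻ : ∀ {e} → e ∈ˡ F → source e ∉ A × source e ∉ D
      L⁺ : ∀ {e} → target e ∈ A → source e ∉ A → source e ∉ D → e ∈ˡ L
      L⁻ : ∀ {e} → e ∈ˡ L → source e ∉ A × source e ∉ D × target e ∈ A
      fuel : n ℕ.< k ℕ.+ ∣ A ∪ D ∣

  no-fuel : ∀ {A D F L} → ¬ Invariant 0 A D F L
  no-fuel {A} {D} I = ℕ.<⇒≱ (Invariant.fuel I) (∣p∣≤n (A ∪ D))

  -- Each pass puts a new vertex into `A` or `D`, so the unit of fuel spent is regained in the size
  -- of `A ∪ D`. That size never exceeds `n`, whence `no-fuel`.
  burn : ∀ {k} {A D A′ D′ : Subset n} {w} → A ⊆ A′ → D ⊆ D′ → w ∉ A → w ∉ D → w ∈ A′ ∪ D′ →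
         n ℕ.< suc k ℕ.+ ∣ A ∪ D ∣ → n ℕ.< k ℕ.+ ∣ A′ ∪ D′ ∣
  burn {k} {A} {D} {A′} {D′} {w} A⊆ D⊆ w∉A w∉D w∈ lt = ℕ.≤-trans lt
    (ℕ.≤-trans (ℕ.≤-reflexive (sym (ℕ.+-suc k _))) (ℕ.+-monoʳ-≤ k (p⊂q⇒∣p∣<∣q∣
      ( (λ x∈ → x∈p∪q⁺ ([ inj₁ ∘ A⊆ , inj₂ ∘ D⊆ ]′ (x∈p∪q⁻ A D x∈)))
      , w , w∈ , ∉∪ w∉A w∉D))))

  module _ {k A D F e L} (I : Invariant (suc k) A D F (e ∷ L)) where
    open Invariant I
    private
      w  = source e
      F′ = dropSource w F
      w∉A : w ∉ A
      w∉A = proj₁ (L⁻ (here refl))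
      w∉D : w ∉ D
      w∉D = proj₁ (proj₂ (L⁻ (here refl)))
      w∈⁅w⁆ = x∈⁅x⁆ w
      ∉⇒≢ : ∀ {p : Subset n} {f} → source f ∉ p ∪ ⁅ w ⁆ → source f ≢ w
      ∉⇒≢ {p} s∉ s≡w = s∉ (x∈p∪q⁺ {p = p} (inj₂ (∈⁅⁆ s≡w)))
      ≢⇒∉ : ∀ {p : Subset n} {u} → u ∉ p → u ≢ w → u ∉ p ∪ ⁅ w ⁆
      ≢⇒∉ u∉ u≢w = ∉∪ u∉ (u≢w ∘ x∈⁅y⁆⇒x≡y w)
      ∉ˡ : ∀ {p : Subset n} {u} → u ∉ p ∪ ⁅ w ⁆ → u ∉ p
      ∉ˡ u∉ u∈p = u∉ (∪ˡ u∈p)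
      tail : ∀ {f} → f ∈ˡ e ∷ L → source f ≢ w → f ∈ˡ L
      tail (here refl) s≢ = contradiction refl s≢
      tail (there f∈)  s≢ = f∈

    accept : Invariant k (A ∪ ⁅ w ⁆) D F′ (dropSource w L ++ intoVertex w F′)
    accept = record
      { disjoint = λ u∈ u∈D → [ (λ u∈A → disjoint u∈A u∈D) , (λ u∈w → w∉D (subst (_∈ D) (x∈⁅y⁆⇒x≡y w u∈w) u∈D)) ]′ (x∈p∪q⁻ A ⁅ w ⁆ u∈)
      ; F⁺ = λ s∉A s∉D t∉D → dropSource⁺ (F⁺ (∉ˡ s∉A) s∉D t∉D) (∉⇒≢ {A} s∉A)
      ; F⁻ = λ f∈ → let f∈F , s≢w = dropSource⁻ {L = F} f∈ ; s∉A , s∉D = F⁻ f∈F in ≢⇒∉ s∉A s≢w , s∉D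
      ; L⁺ = λ {f} t∈ s∉A s∉D → case x∈p∪q⁻ A ⁅ w ⁆ t∈ of λ where
          (inj₁ t∈A) → ∈-++⁺ˡ (dropSource⁺ (tail (L⁺ t∈A (∉ˡ s∉A) s∉D) (∉⇒≢ {A} s∉A)) (∉⇒≢ {A} s∉A))
          (inj₂ t∈w) → ∈-++⁺ʳ (dropSource w L) (intoVertex⁺ (dropSource⁺
            (F⁺ (∉ˡ s∉A) s∉D λ t∈D → w∉D (subst (_∈ D) (x∈⁅y⁆⇒x≡y w t∈w) t∈D)) (∉⇒≢ {A} s∉A)) (x∈⁅y⁆⇒x≡y w t∈w))
      ; L⁻ = λ f∈ → case ∈-++⁻ (dropSource w L) f∈ of λ where
          (inj₁ f∈L) → let f∈L , s≢w = dropSource⁻ {L = L} f∈L ; s∉A , s∉D , t∈A = L⁻ (there f∈L) in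
            ≢⇒∉ s∉A s≢w , s∉D , ∪ˡ t∈A
          (inj₂ f∈F) → let f∈F′ , t≡w = intoVertex⁻ {L = F′} f∈F ; f∈F , s≢w = dropSource⁻ {L = F} f∈F′ ; s∉A , s∉D = F⁻ f∈F in
            ≢⇒∉ s∉A s≢w , s∉D , ∪ʳ (∈⁅⁆ t≡w)
      ; fuel = burn {k} {A} {D} (p⊆p∪q ⁅ w ⁆) id w∉A w∉D (∪ˡ (∪ʳ w∈⁅w⁆)) fuel }

    reject : Invariant k A (D ∪ ⁅ w ⁆) (dropVertex w F) (dropVertex w L)
    reject = record
      { disjoint = λ u∈A → ≢⇒∉ (disjoint u∈A) λ u≡w → w∉A (subst (_∈ A) u≡w u∈A)
      ; F⁺ = λ s∉A s∉D t∉D → dropVertex⁺ (F⁺ s∉A (∉ˡ s∉D) (∉ˡ t∉D)) (∉⇒≢ {D} s∉D)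
          (λ t≡w → t∉D (∪ʳ (∈⁅⁆ t≡w)))
      ; F⁻ = λ f∈ → let f∈F , s≢w , _ = dropVertex⁻ {L = F} f∈ ; s∉A , s∉D = F⁻ f∈F in s∉A , ≢⇒∉ s∉D s≢w
      ; L⁺ = λ t∈A s∉A s∉D → dropVertex⁺ (tail (L⁺ t∈A s∉A (∉ˡ s∉D)) (∉⇒≢ {D} s∉D)) (∉⇒≢ {D} s∉D)
          (λ t≡w → w∉A (subst (_∈ A) t≡w t∈A))
      ; L⁻ = λ f∈ → let f∈L , s≢w , _ = dropVertex⁻ {L = L} f∈ ; s∉A , s∉D , t∈A = L⁻ (there f∈L) in s∉A , ≢⇒∉ s∉D s≢w , t∈A
      ; fuel = burn {k} {A} {D} id (p⊆p∪q ⁅ w ⁆) w∉A w∉D (∪ʳ (∪ʳ w∈⁅w⁆)) fuel }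

  initial : ∀ v → Invariant n ⁅ v ⁆ ⊥ (dropSource v edgesBySource) (intoVertex v edgesBySource)
  initial v = record
    { disjoint = λ _ → ∉⊥
    ; F⁺ = λ s∉ _ _ → dropSource⁺ (∈-edgesBySource _) (x∉⁅y⁆⇒x≢y s∉)
    ; F⁻ = λ e∈ → x≢y⇒x∉⁅y⁆ (proj₂ (dropSource⁻ {L = edgesBySource} e∈)) , ∉⊥
    ; L⁺ = λ t∈ _ _ → intoVertex⁺ (∈-edgesBySource _) (x∈⁅y⁆⇒x≡y v t∈)
    -- The initial list holds all edges into `v`; a loop at `v` would have its source already in
    -- `A`, which `noLoop` excludes.
    ; L⁻ = λ {e} e∈ → let t≡v = proj₂ (intoVertex⁻ {L = edgesBySource} e∈) in
        (λ s∈ → noLoop e (trans (x∈⁅y⁆⇒x≡y v s∈) (sym t≡v))) , ∉⊥ , ∈⁅⁆ t≡v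
    ; fuel = ℕ.≤-trans (ℕ.≤-reflexive (ℕ.+-comm 1 n)) (ℕ.+-monoʳ-≤ n (ℕ.≤-trans
        (ℕ.≤-reflexive (sym (∣⁅x⁆∣≡1 v))) (∣p∣≤∣p∪q∣ ⁅ v ⁆ ⊥))) }

  explore-accept : ∀ k {a A F e L} → e ∈ a → explore (suc k) a A F (e ∷ L) ≡
    explore k a (A ∪ ⁅ source e ⁆) (dropSource (source e) F)
      (dropSource (source e) L ++ intoVertex (source e) (dropSource (source e) F))
  explore-accept k {a} {e = e} e∈a with e ∈? a
  ... | yes _  = refl
  ... | no e∉a = contradiction e∈a e∉a

  explore-reject : ∀ k {a A F e L} → e ∉ a →
    explore (suc k) a A F (e ∷ L) ≡ explore k a A (dropVertex (source e) F) (dropVertex (source e) L)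
  explore-reject k {a} {e = e} e∉a with e ∈? a
  ... | yes e∈a = contradiction e∈a e∉a
  ... | no _    = refl

  -- A vertex joins the explored set only through one of its outgoing edges, and edges move from `F`
  -- to `L` but never reappear once removed from both.
  explore-dropped : ∀ k {a A F L u} → u ∉ A → (∀ {e} → e ∈ˡ L → source e ≢ u) → (∀ {e} → e ∈ˡ F → source e ≢ u) →
                    u ∉ explore k a A F L
  explore-dropped zero    u∉A ∉L ∉F = u∉A
  explore-dropped (suc k) {L = []} u∉A ∉L ∉F = u∉A
  explore-dropped (suc k) {a} {A} {F} {e ∷ L} {u} u∉A ∉L ∉F with e ∈? a
  ... | yes _ = explore-dropped k
    (∉∪ u∉A (λ u∈ → ∉L (here refl) (sym (x∈⁅y⁆⇒x≡y (source e) u∈))))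
    (λ f∈ → case ∈-++⁻ (dropSource (source e) L) f∈ of λ where
      (inj₁ f∈L) → ∉L (there (proj₁ (dropSource⁻ {L = L} f∈L)))
      (inj₂ f∈F) → ∉F (proj₁ (dropSource⁻ {L = F} (proj₁ (intoVertex⁻ {L = dropSource (source e) F} f∈F)))))
    (λ f∈ → ∉F (proj₁ (dropSource⁻ {L = F} f∈)))
  ... | no _ = explore-dropped k u∉A
    (λ f∈ → ∉L (there (proj₁ (dropVertex⁻ {L = L} f∈))))
    (λ f∈ → ∉F (proj₁ (dropVertex⁻ {L = F} f∈)))

  module _ {S : Subset n} where

    -- The two runs make the same decisions: rejecting an edge going out of S
    -- would exclude its source from the explored set.
    explore-agree : ∀ k {A D F L a b} → Invariant k A D F L →
      S ⊆ explore k a A F L → S ⊆ explore k b A F L →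
      (∀ {e} → source e ∉ S → e ∈ a → e ∈ b) → (∀ {e} → source e ∉ S → e ∈ b → e ∈ a) →
      ∀ {u} → u ∈ S → u ∉ A → ∃ λ e → source e ≡ u × e ∈ a × e ∈ b
    explore-agree zero    I Sa Sb _ _ u∈S u∉A = contradiction (Sa u∈S) u∉A
    explore-agree (suc k) {L = []} I Sa Sb _ _ u∈S u∉A = contradiction (Sa u∈S) u∉A
    explore-agree (suc k) {A} {D} {F} {e ∷ L} {a} {b} I Sa Sb a⇒b b⇒a {u} u∈S u∉A with e ∈? a | e ∈? b
    ... | yes e∈a | yes e∈b = case source e ≟ u of λ where
      (yes s≡u) → e , s≡u , e∈a , e∈b
      (no s≢u)  → explore-agree k (accept I) Sa Sb a⇒b b⇒a u∈S (∉∪ u∉A λ u∈ → s≢u (sym (x∈⁅y⁆⇒x≡y _ u∈)))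
    ... | no _    | no _    = explore-agree k (reject I) Sa Sb a⇒b b⇒a u∈S u∉A
    ... | yes e∈a | no e∉b  = case source e ∈? S of λ where
      (no s∉S)  → contradiction (a⇒b s∉S e∈a) e∉b
      (yes s∈S) → contradiction (Sb s∈S) (explore-dropped k (proj₁ (Invariant.L⁻ I (here refl)))
        (λ f∈ → proj₁ (proj₂ (dropVertex⁻ {L = L} f∈))) (λ f∈ → proj₁ (proj₂ (dropVertex⁻ {L = F} f∈))))
    ... | no e∉a  | yes e∈b = case source e ∈? S of λ where
      (no s∉S)  → contradiction (b⇒a s∉S e∈b) e∉a
      (yes s∈S) → contradiction (Sa s∈S) (explore-dropped k (proj₁ (Invariant.L⁻ I (here refl)))
        (λ f∈ → proj₁ (proj₂ (dropVertex⁻ {L = L} f∈))) (λ f∈ → proj₁ (proj₂ (dropVertex⁻ {L = F} f∈))))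

    -- Outside `S` the trees agree by hypothesis. At a vertex of `S` other than the root,
    -- `explore-agree` supplies an edge common to both, and functionality makes it the only edge
    -- there.
    φ-injective : ∀ {v a b} → Rooted ⁅ v ⁆ a → Rooted ⁅ v ⁆ b → S ⊆ φ v a → S ⊆ φ v b →
                  restrict a S ≡ restrict b S → a ≡ b
    φ-injective {v} Ta Tb Sa Sb eq = ⊆-antisym (incl Ta Tb Sa Sb eq) (incl Tb Ta Sb Sa (sym eq))
      where
      incl : ∀ {a b} → Rooted ⁅ v ⁆ a → Rooted ⁅ v ⁆ b → S ⊆ φ v a → S ⊆ φ v b → restrict a S ≡ restrict b S → a ⊆ b
      incl {a} {b} Ta Tb Sa Sb eq {e} e∈a with source e ∈? S
      ... | no s∉S = proj₁ (∈-restrict⁻ {b} {S} (subst (e ∈_) eq (∈-restrict⁺ e∈a s∉S)))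
      ... | yes s∈S with explore-agree n (initial v) Sa Sb
              (λ {f} s∉ f∈ → proj₁ (∈-restrict⁻ {b} {S} (subst (f ∈_) eq (∈-restrict⁺ f∈ s∉))))
              (λ {f} s∉ f∈ → proj₁ (∈-restrict⁻ {a} {S} (subst (f ∈_) (sym eq) (∈-restrict⁺ f∈ s∉))))
              s∈S (λ s∈v → Rooted.roots Ta s∈v e∈a refl)
      ...   | f , s≡ , f∈a , f∈b = subst (_∈ b) (Rooted.functional Ta f∈a e∈a s≡) f∈b

    module _ (SC : StronglyConnected S) {K : Subset m} where

      -- What remains to be chosen from the state (A, F, L) onwards. `explored` speaks of every `a`
      -- that matches `K ∪ τ` at the vertices outside `A`, because the final tree also contains the
      -- edges accepted earlier, which go out of vertices of `A` and are not in this `τ`.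
      record Completion k A F L : Set where
        field
          τ          : Subset m
          sources    : ∀ {e} → e ∈ τ → source e ∈ S × source e ∉ A
          functional : Functional τ
          reaches    : ∀ {u} → u ∈ S → ∃ λ w → w ∈ A × Path (K ∪ τ) u w
          explored   : ∀ {a} → K ∪ τ ⊆ a → (∀ {e} → e ∈ a → source e ∉ A → e ∈ K ∪ τ) → S ⊆ explore k a A F L

      -- Explore while answering yes for the vertices of S and consulting K for
      -- the others; τ collects the edges accepted for the vertices of S.
      complete : ∀ k {A D F L} → Invariant k A D F L → (∀ {u} → u ∈ S → u ∉ D) →
                 (∃ λ s → s ∈ S × s ∈ A) → Completion k A F L
      complete zero I S∩D _ = contradiction I no-fuel
      complete (suc k) {A} {D} {L = []} I S∩D (s , s∈S , s∈A) = record
        { τ = ⊥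
        ; sources = λ e∈ → contradiction e∈ ∉⊥
        ; functional = λ e∈ → contradiction e∈ ∉⊥
        ; reaches = λ u∈S → _ , S⊆A u∈S , nil
        ; explored = λ _ _ → S⊆A }
        where
        -- With the list empty, no edge leads into `A` from an undecided vertex. Vertices of `S` are
        -- never rejected, so membership in `A` spreads backwards along paths in `S`, and strong
        -- connectivity carries it from `s` to all of `S`.
        back : ∀ {u t} → Reach S u t → t ∈ A → u ∈ A
        back nil t∈A = t∈A
        back ((u∈S , _ , e , _ , refl , refl) ◅ π) t∈A with source e ∈? A
        ... | yes s∈A = s∈A
        ... | no s∉A  = case Invariant.L⁺ I (back π t∈A) s∉A (S∩D u∈S) of λ ()
        S⊆A : S ⊆ A
        S⊆A u∈S = back (SC _ _ u∈S s∈S) s∈A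
      complete (suc k) {A} {D} {F} {e ∷ L} I S∩D (s , s∈S , s∈A) with source e ∈? S | e ∈? K
      ... | yes w∈S | _ = record
        { τ = τ ∪ ⁅ e ⁆
        ; sources = λ f∈ → case x∈p∪q⁻ τ ⁅ e ⁆ f∈ of λ where
            (inj₁ f∈τ) → let s∈ , s∉ = sources f∈τ in s∈ , λ s∈A → s∉ (∪ˡ s∈A)
            (inj₂ f∈e) → subst (λ f → source f ∈ S × source f ∉ A) (sym (x∈⁅y⁆⇒x≡y e f∈e)) (w∈S , w∉A)
        ; functional = λ f∈ g∈ s≡ → case (x∈p∪q⁻ τ ⁅ e ⁆ f∈ , x∈p∪q⁻ τ ⁅ e ⁆ g∈) of λ where
            (inj₁ f∈τ , inj₁ g∈τ) → functional f∈τ g∈τ s≡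
            (inj₁ f∈τ , inj₂ g∈e) → contradiction (trans s≡ (cong source (x∈⁅y⁆⇒x≡y e g∈e))) (τ∌w f∈τ)
            (inj₂ f∈e , inj₁ g∈τ) → contradiction (trans (sym s≡) (cong source (x∈⁅y⁆⇒x≡y e f∈e))) (τ∌w g∈τ)
            (inj₂ f∈e , inj₂ g∈e) → trans (x∈⁅y⁆⇒x≡y e f∈e) (sym (x∈⁅y⁆⇒x≡y e g∈e))
        ; reaches = λ u∈S → let w , w∈ , π = reaches u∈S in case x∈p∪q⁻ A ⁅ source e ⁆ w∈ of λ where
            (inj₁ w∈A) → w , w∈A , path-⊆ weaken π
            (inj₂ w∈e) → target e , t∈A , 
              path-⊆ weaken π ◅◅ subst (λ w → Path (K ∪ (τ ∪ ⁅ e ⁆)) w (target e)) (sym (x∈⁅y⁆⇒x≡y _ w∈e)) (edge e∈new)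
        ; explored = λ {a} K∪τ⊆a a⊆ → subst (S ⊆_) (sym (explore-accept k (K∪τ⊆a e∈new)))
            (explored (K∪τ⊆a ∘ weaken) λ f∈a s∉ → strengthen (a⊆ f∈a (λ s∈A → s∉ (∪ˡ s∈A))) s∉) }
        where
        open Completion (complete k (accept I) S∩D (s , s∈S , ∪ˡ s∈A))
        w∉A = proj₁ (Invariant.L⁻ I (here refl))
        t∈A = proj₂ (proj₂ (Invariant.L⁻ I (here refl)))
        τ∌w : ∀ {f} → f ∈ τ → source f ≢ source e
        τ∌w f∈τ s≡ = proj₂ (sources f∈τ) (∪ʳ (∈⁅⁆ s≡))
        e∈new : e ∈ K ∪ (τ ∪ ⁅ e ⁆)
        e∈new = ∪ʳ (∪ʳ (x∈⁅x⁆ e))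
        weaken : K ∪ τ ⊆ K ∪ (τ ∪ ⁅ e ⁆)
        weaken f∈ = x∈p∪q⁺ ([ inj₁ , (λ f∈τ → inj₂ (∪ˡ f∈τ)) ]′ (x∈p∪q⁻ K τ f∈))
        strengthen : ∀ {f} → f ∈ K ∪ (τ ∪ ⁅ e ⁆) → source f ∉ A ∪ ⁅ source e ⁆ → f ∈ K ∪ τ
        strengthen f∈ s∉ with x∈p∪q⁻ K (τ ∪ ⁅ e ⁆) f∈
        ... | inj₁ f∈K = ∪ˡ f∈K
        ... | inj₂ f∈′ with x∈p∪q⁻ τ ⁅ e ⁆ f∈′
        ...   | inj₁ f∈τ = ∪ʳ f∈τ
        ...   | inj₂ f∈e with x∈⁅y⁆⇒x≡y e f∈e
        ...     | refl = contradiction (∪ʳ (x∈⁅x⁆ _)) s∉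
      ... | no w∉S | yes e∈K = record
        { τ = τ
        ; sources = λ f∈τ → let s∈ , s∉ = sources f∈τ in s∈ , λ s∈A → s∉ (∪ˡ s∈A)
        ; functional = functional
        ; reaches = λ u∈S → let w , w∈ , π = reaches u∈S in case x∈p∪q⁻ A ⁅ source e ⁆ w∈ of λ where
            (inj₁ w∈A) → w , w∈A , π
            (inj₂ w∈e) → target e , t∈A , 
              (π ◅◅ subst (λ w → Path (K ∪ τ) w (target e)) (sym (x∈⁅y⁆⇒x≡y _ w∈e)) (edge (∪ˡ e∈K)))
        ; explored = λ {a} K∪τ⊆a a⊆ → subst (S ⊆_) (sym (explore-accept k (K∪τ⊆a (∪ˡ e∈K))))
            (explored K∪τ⊆a λ f∈a s∉ → a⊆ f∈a (λ s∈A → s∉ (∪ˡ s∈A))) }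
        where
        open Completion (complete k (accept I) S∩D (s , s∈S , ∪ˡ s∈A))
        t∈A = proj₂ (proj₂ (Invariant.L⁻ I (here refl)))
      ... | no w∉S | no e∉K = record
        { τ = τ
        ; sources = sources
        ; functional = functional
        ; reaches = reaches
        ; explored = λ {a} K∪τ⊆a a⊆ → subst (S ⊆_)
            (sym (explore-reject k λ e∈a → [ e∉K , (λ e∈τ → w∉S (proj₁ (sources e∈τ))) ]′
              (x∈p∪q⁻ K τ (a⊆ e∈a (proj₁ (Invariant.L⁻ I (here refl))))))) (explored K∪τ⊆a a⊆) }
        where
        open Completion (complete k (reject I)
          (λ u∈S → ∉∪ (S∩D u∈S) λ u∈ → w∉S (subst (_∈ S) (x∈⁅y⁆⇒x≡y _ u∈) u∈S)) (s , s∈S , s∈A))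

      -- In the initial state `A` is `⁅ v ⁆`: the completed paths therefore end at `v`, and `τ`
      -- leaves the vertices of `S` other than `v`, so `K ∪ τ` is a tree rooted at `v`.
      φ-surjective : ∀ {v} → v ∈ S → Rooted S K → ∃ λ a → Rooted ⁅ v ⁆ a × S ⊆ φ v a × restrict a S ≡ K
      φ-surjective {v} v∈S F = K ∪ τ ,
        ∪-tree F (proj₁ ∘ sources) functional v∈S (λ e∈ s≡v → proj₂ (sources e∈) (∈⁅⁆ s≡v))
          (λ u∈S → let w , w∈v , π = reaches u∈S in subst (Path (K ∪ τ) _) (x∈⁅y⁆⇒x≡y v w∈v) π) ,
        explored id (λ e∈ _ → e∈) ,
        ⊆-antisym
          (λ e∈ → let e∈∪ , s∉S = ∈-restrict⁻ {K ∪ τ} e∈ in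
            [ id , (λ e∈τ → contradiction (proj₁ (sources e∈τ)) s∉S) ]′ (x∈p∪q⁻ K τ e∈∪))
          (λ e∈K → ∈-restrict⁺ (∪ˡ e∈K) λ s∈S → Rooted.roots F s∈S e∈K refl)
        where open Completion (complete n (initial v) (λ _ → ∉⊥) (v , v∈S , x∈⁅x⁆ v))

-- Multiplicities

module Multiplicities {n m} (G : Digraph n m) (simple : Simple G) where
  open Exploration G simple public
  open Simple simple
  open BigSum ℕ.+-*-commutativeSemiring

  length-filter : ∀ {A : Set} {p} {P : Pred A p} (P? : Decidable P) xs →
                  length (filter P? xs) ≡ ⨁ xs (λ x → when (P? x) 1)
  length-filter P? xs = trans (sym (trans (⨁-const (filter P? xs)) (k·1≡k (length (filter P? xs))))) (⨁-filter P? xs)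

  ∈-forests⁺ : ∀ {U H} → Rooted U H → H ∈ˡ forests U
  ∈-forests⁺ {U} F = ∈-filter⁺ (isForest? U) (∈-allSubsets _) (rooted⇒isForest F)

  ∈-forests⁻ : ∀ {U H} → H ∈ˡ forests U → Rooted U H
  ∈-forests⁻ {U} H∈ = isForest⇒rooted (proj₂ (∈-filter⁻ (isForest? U) {xs = allSubsets m} H∈))

  -- Applied to two families of trees rooted at `v`: those with `S ⊆ ψ v a`, and those fixed by a
  -- closed walk with support `S`. Both are in bijection with the same forests through `restrict`,
  -- hence equinumerous.
  restrict-count : ∀ {p v S} {P : Subset m → Set p} (P? : ∀ H → Dec (IsTree v H × P H)) → v ∈ S →
    (∀ {a b} → Rooted ⁅ v ⁆ a → Rooted ⁅ v ⁆ b → P a → P b → restrict a S ≡ restrict b S → a ≡ b) →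
    (∀ {K} → Rooted S K → ∃ λ a → Rooted ⁅ v ⁆ a × P a × restrict a S ≡ K) →
    length (filter P? edgeSets) ≡ length (forests S)
  restrict-count {v = v} {S} {P} P? v∈S inj onto = trans (sym (List.length-map (λ H → restrict H S) (filter P? edgeSets)))
    (↭-length (bijection-↭ {f = λ H → restrict H S}
      (Unique.filter⁺ P? (allSubsets-unique m)) (Unique.filter⁺ (isForest? S) (allSubsets-unique m))
      (λ a∈ → ∈-forests⁺ (restrict-rooted (proj₁ (member a∈)) v⊆S))
      (λ a∈ b∈ → let Ta , Pa = member a∈ ; Tb , Pb = member b∈ in inj Ta Tb Pa Pb)
      (λ K∈ → let a , Ta , Pa , eq = onto (∈-forests⁻ K∈) in
        a , ∈-filter⁺ P? (∈-allSubsets a) (rooted⇒isForest Ta , Pa) , eq)))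
    where
    member : ∀ {a} → a ∈ˡ filter P? edgeSets → Rooted ⁅ v ⁆ a × P a
    member a∈ = let T , Pa = proj₂ (∈-filter⁻ P? {xs = allSubsets m} a∈) in isForest⇒rooted T , Pa
    v⊆S : ⁅ v ⁆ ⊆ S
    v⊆S = ⁅⁆⊆ v∈S

  -- Strongly connected components and the sorting of trees by ψ

  InComponent : Subset n → Fin n → Fin n → Set
  InComponent W v u = u ∈ W × Reach W u v × Reach W v u

  inComponent? : ∀ W v u → Dec (InComponent W v u)
  inComponent? W v u = u ∈? W ×-dec (reach? W u v ×-dec reach? W v u)

  -- Every vertex passed on the way between two members both reaches `v` and is reached from it, so
  -- the path stays in the component.
  component-stronglyConnected : ∀ W v → StronglyConnected (component W v)
  component-stronglyConnected W v x y x∈ y∈ =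
    let _ , x→v , v→x = ∈⟪⟫⁻ (inComponent? W v) x∈
        _ , y→v , v→y = ∈⟪⟫⁻ (inComponent? W v) y∈
    in stay (x→v ◅◅ v→y) v→x y→v
    where
    stay : ∀ {x y} → Reach W x y → Reach W v x → Reach W y v → Reach (component W v) x y
    stay nil _ _ = nil
    stay ((x∈ , y∈ , s) ◅ π) v→x y→v =
      (∈⟪⟫⁺ (inComponent? W v) (x∈ , (x∈ , y∈ , s) ◅ π ◅◅ y→v , v→x) ,
       ∈⟪⟫⁺ (inComponent? W v) (y∈ , π ◅◅ y→v , v→x ◅◅ (x∈ , y∈ , s) ◅ nil) , s)
      ◅ stay π (v→x ◅◅ (x∈ , y∈ , s) ◅ nil) y→v

  reach-⊆ : ∀ {S W u v} → S ⊆ W → Reach S u v → Reach W u v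
  reach-⊆ S⊆W nil = nil
  reach-⊆ S⊆W ((u∈ , v∈ , s) ◅ π) = (S⊆W u∈ , S⊆W v∈ , s) ◅ reach-⊆ S⊆W π

  ⊆φ⇒⊆ψ : ∀ {S v a} → StronglyConnected S → v ∈ S → S ⊆ φ v a → S ⊆ ψ v a
  ⊆φ⇒⊆ψ {v = v} {a} SC v∈S S⊆ {u} u∈S = ∈⟪⟫⁺ (inComponent? (φ v a) v)
    (S⊆ u∈S , reach-⊆ S⊆ (SC u v u∈S v∈S) , reach-⊆ S⊆ (SC v u v∈S u∈S))

  ⊆ψ⇒⊆φ : ∀ {S v a} → S ⊆ ψ v a → S ⊆ φ v a
  ⊆ψ⇒⊆φ {v = v} {a} S⊆ u∈S = proj₁ (∈⟪⟫⁻ (inComponent? (φ v a) v) (S⊆ u∈S))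

  multiplicity≡⨁ : ∀ W v → multiplicity W v ≡ ⨁ edgeSets (λ a → when (isTree? v a ×-dec ψ v a ≟ˢ W) 1)
  multiplicity≡⨁ W v = length-filter (λ a → isTree? v a ×-dec ψ v a ≟ˢ W) edgeSets

  -- Every value of `ψ` is strongly connected. Sums of multiplicities may therefore run over all
  -- subsets.
  multiplicity≡0 : ∀ {W v} → ¬ StronglyConnected W → multiplicity W v ≡ 0
  multiplicity≡0 {W} {v} ¬SC = trans (multiplicity≡⨁ W v) (trans (⨁-cong edgeSets vanish) (⨁-ε edgeSets))
    where
    vanish : ∀ a → when (isTree? v a ×-dec ψ v a ≟ˢ W) 1 ≡ 0
    vanish a = when-no (isTree? v a ×-dec ψ v a ≟ˢ W) λ { (_ , refl) → ¬SC (component-stronglyConnected (φ v a) v) }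

  -- For a strongly connected `S` containing `v`, lying in `φ v a` and lying in its component of `v`
  -- are equivalent; the trees matched with the forests are then sorted by the value `W` of `ψ`.
  forests-count : ∀ {S v} → StronglyConnected S → v ∈ S →
                  length (forests S) ≡ ⨁ (allSubsets n) (λ W → when (S ⊆? W) (multiplicity W v))
  forests-count {S} {v} SC v∈S = begin
    length (forests S)
      ≡⟨ restrict-count (λ a → isTree? v a ×-dec S ⊆? ψ v a) v∈S
           (λ {a} {b} Ta Tb Sa Sb → φ-injective Ta Tb (⊆ψ⇒⊆φ {a = a} Sa) (⊆ψ⇒⊆φ {a = b} Sb))
           (λ F → let a , Ta , Sa , eq = φ-surjective SC v∈S F in a , Ta , ⊆φ⇒⊆ψ {a = a} SC v∈S Sa , eq) ⟨
    length (filter (λ a → isTree? v a ×-dec S ⊆? ψ v a) edgeSets)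
      ≡⟨ length-filter (λ a → isTree? v a ×-dec S ⊆? ψ v a) edgeSets ⟩
    ⨁ edgeSets (λ a → when (isTree? v a ×-dec S ⊆? ψ v a) 1)
      ≡⟨ ⨁-cong edgeSets (λ a → sym (⨁-only (λ W → ψ v a ≟ˢ W) {f = λ W → when (isTree? v a ×-dec S ⊆? W) 1}
           (allSubsets-unique n) (∈-allSubsets (ψ v a)) refl (λ W → sym))) ⟩
    ⨁ edgeSets (λ a → ⨁ (allSubsets n) (λ W → when (ψ v a ≟ˢ W) (when (isTree? v a ×-dec S ⊆? W) 1)))
      ≡⟨ ⨁-swap edgeSets (allSubsets n) ⟩
    ⨁ (allSubsets n) (λ W → ⨁ edgeSets (λ a → when (ψ v a ≟ˢ W) (when (isTree? v a ×-dec S ⊆? W) 1)))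
      ≡⟨ ⨁-cong (allSubsets n) (λ W → begin
           ⨁ edgeSets (λ a → when (ψ v a ≟ˢ W) (when (isTree? v a ×-dec S ⊆? W) 1))
             ≡⟨ ⨁-cong edgeSets (λ a → trans
                  (sym (when-× (ψ v a ≟ˢ W) (isTree? v a ×-dec S ⊆? W)))
                  (trans (when-cong (ψ v a ≟ˢ W ×-dec (isTree? v a ×-dec S ⊆? W)) (S ⊆? W ×-dec (isTree? v a ×-dec ψ v a ≟ˢ W))
                    (λ (p , q , r) → r , q , p) (λ (p , q , r) → r , q , p) (λ _ _ → refl))
                  (when-× (S ⊆? W) (isTree? v a ×-dec ψ v a ≟ˢ W)))) ⟩
           ⨁ edgeSets (λ a → when (S ⊆? W) (when (isTree? v a ×-dec ψ v a ≟ˢ W) 1))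
             ≡⟨ when-⨁ (S ⊆? W) edgeSets ⟨
           when (S ⊆? W) (⨁ edgeSets (λ a → when (isTree? v a ×-dec ψ v a ≟ˢ W) 1))
             ≡⟨ cong (when (S ⊆? W)) (multiplicity≡⨁ W v) ⟨
           when (S ⊆? W) (multiplicity W v) ∎) ⟩
    ⨁ (allSubsets n) (λ W → when (S ⊆? W) (multiplicity W v)) ∎
    where open ≡-Reasoning

  ⨁-⊇ : ∀ S (f : Subset n → ℕ) → ⨁ (allSubsets n) (λ W → when (S ⊆? W) (f W)) ≡
        f S ℕ.+ ⨁ (allSubsets n) (λ W → when (S ⊂? W) (f W))
  ⨁-⊇ S f = begin
    ⨁ (allSubsets n) (λ W → when (S ⊆? W) (f W))
      ≡⟨ ⨁-cong (allSubsets n) (λ W → split W (W ≟ˢ S)) ⟩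
    ⨁ (allSubsets n) (λ W → when (W ≟ˢ S) (f W) ℕ.+ when (S ⊂? W) (f W))
      ≡⟨ ⨁-∙ (allSubsets n) ⟩
    ⨁ (allSubsets n) (λ W → when (W ≟ˢ S) (f W)) ℕ.+ ⨁ (allSubsets n) (λ W → when (S ⊂? W) (f W))
      ≡⟨ cong (ℕ._+ ⨁ (allSubsets n) (λ W → when (S ⊂? W) (f W)))
           (⨁-only (_≟ˢ S) {f = f} (allSubsets-unique n) (∈-allSubsets S) refl (λ _ → id)) ⟩
    f S ℕ.+ ⨁ (allSubsets n) (λ W → when (S ⊂? W) (f W)) ∎
    where
    open ≡-Reasoning
    split : ∀ W (d : Dec (W ≡ S)) → when (S ⊆? W) (f W) ≡ when d (f W) ℕ.+ when (S ⊂? W) (f W)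
    split W (yes refl) = trans (when-yes (S ⊆? W) ⊆-refl)
      (sym (trans (cong (f W ℕ.+_) (when-no (S ⊂? W) (⊂-irref refl))) (ℕ.+-identityʳ (f W))))
    split W (no W≢S) = when-cong (S ⊆? W) (S ⊂? W) proper proj₁ (λ _ _ → refl)
      where
      proper : S ⊆ W → S ⊂ W
      proper S⊆W with any? (λ u → u ∈? W ×-dec ¬? (u ∈? S))
      ... | yes p = S⊆W , p
      ... | no ¬p = contradiction (⊆-antisym (λ {u} u∈W → case u ∈? S of λ where
        (yes u∈S) → u∈S
        (no u∉S)  → contradiction (u , u∈W , u∉S) ¬p) S⊆W) W≢S

  -- Möbius inversion: both sides are determined by the numbers of forests.
  multiplicity-independent : ∀ {S u v} → StronglyConnected S → u ∈ S → v ∈ S → multiplicity S u ≡ multiplicity S v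
  multiplicity-independent {S} = go (n ℕ.∸ ∣ S ∣) S ℕ.≤-refl
    where
    open ≡-Reasoning
    go : ∀ k S {u v} → n ℕ.∸ ∣ S ∣ ℕ.≤ k → StronglyConnected S → u ∈ S → v ∈ S → multiplicity S u ≡ multiplicity S v
    go k S {u} {v} le SC u∈S v∈S = ℕ.+-cancelʳ-≡ _ _ _ (begin
      multiplicity S u ℕ.+ above u                                     ≡⟨ ⨁-⊇ S (λ W → multiplicity W u) ⟨
      ⨁ (allSubsets n) (λ W → when (S ⊆? W) (multiplicity W u))        ≡⟨ forests-count SC u∈S ⟨
      length (forests S)                                               ≡⟨ forests-count SC v∈S ⟩
      ⨁ (allSubsets n) (λ W → when (S ⊆? W) (multiplicity W v))        ≡⟨ ⨁-⊇ S (λ W → multiplicity W v) ⟩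
      multiplicity S v ℕ.+ above v                                     ≡⟨ cong (multiplicity S v ℕ.+_) (⨁-cong (allSubsets n) same) ⟩
      multiplicity S v ℕ.+ above u                                     ∎)
      where
      above : Fin n → ℕ
      above v = ⨁ (allSubsets n) (λ W → when (S ⊂? W) (multiplicity W v))
      same : ∀ W → when (S ⊂? W) (multiplicity W v) ≡ when (S ⊂? W) (multiplicity W u)
      same W = when-congʳ (S ⊂? W) λ S⊂W → larger k le S⊂W (stronglyConnected? W)
        where
        larger : ∀ k → n ℕ.∸ ∣ S ∣ ℕ.≤ k → S ⊂ W → Dec (StronglyConnected W) → multiplicity W v ≡ multiplicity W u
        larger k le S⊂W (no ¬SC) = trans (multiplicity≡0 ¬SC) (sym (multiplicity≡0 ¬SC))
        -- `k` bounds the codimension of `S`; that of `W` is strictly smaller, so `k` is positive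
        -- and the recursion proceeds.
        larger k le S⊂W (yes SCW) with k | ℕ.<-≤-trans (ℕ.∸-monoʳ-< (p⊂q⇒∣p∣<∣q∣ S⊂W) (∣p∣≤n W)) le
        ... | suc k | s≤s lt = go k W lt SCW (proj₁ S⊂W v∈S) (proj₁ S⊂W u∈S)

  module _ (w : Subset n → Fin n) (w∈ : ∀ W → Nonempty W → w W ∈ W) where

    -- Independence of the base point replaces the vertex `v` of `S` by the vertex chosen in each
    -- `W`, so the right side no longer refers to the walk through its origin.
    forests-count-w : ∀ {S} → Nonempty S → StronglyConnected S →
      length (forests S) ≡ ⨁ (allSubsets n) (λ W → when (S ⊆? W) (when (stronglyConnected? W) (multiplicity W (w W))))
    forests-count-w {S} (v , v∈S) SC = trans (forests-count SC v∈S)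
      (⨁-cong (allSubsets n) λ W → when-congʳ (S ⊆? W) λ S⊆W → agree W S⊆W (stronglyConnected? W))
      where
      agree : ∀ W → S ⊆ W → (d : Dec (StronglyConnected W)) → multiplicity W v ≡ when d (multiplicity W (w W))
      agree W S⊆W (yes SCW) = multiplicity-independent SCW (S⊆W v∈S) (w∈ W (v , S⊆W v∈S))
      agree W S⊆W (no ¬SCW) = multiplicity≡0 ¬SCW

  -- Lazy walks, and their action on spanning trees

  -- The letter (e , false) is a step at which the walk stays at source e.
  Word : Set
  Word = List (Fin m × Bool)

  next : Fin n → Fin m × Bool → Fin n
  next u (e , b) = if b then target e else u

  Walk : Fin n → Word → Fin n → Set
  Walk u []      v = u ≡ v
  Walk u (l ∷ ω) v = source (proj₁ l) ≡ u × Walk (next u l) ω v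

  walk? : ∀ u ω v → Dec (Walk u ω v)
  walk? u []      v = u ≟ v
  walk? u (l ∷ ω) v = source (proj₁ l) ≟ u ×-dec walk? (next u l) ω v

  support : Fin n → Word → Subset n
  support u []      = ⁅ u ⁆
  support u (l ∷ ω) = ⁅ u ⁆ ∪ support (next u l) ω

  -- The vertices whose outgoing edge is deleted at some moment of the action. For a walk they make
  -- up the support, except possibly for its origin.
  entered : Word → Subset n
  entered []                = ⊥
  entered ((e , true) ∷ ω)  = ⁅ target e ⁆ ∪ entered ω
  entered ((e , false) ∷ ω) = entered ω

  act : Word → Subset m → Subset m
  act []                H = H
  act ((e , true) ∷ ω)  H = act ω (move H e)
  act ((e , false) ∷ ω) H = act ω H

  start∈support : ∀ u ω → u ∈ support u ω
  start∈support u []      = x∈⁅x⁆ u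
  start∈support u (_ ∷ ω) = ∪ˡ (x∈⁅x⁆ u)

  support-reach : ∀ {S u} ω {v x} → Walk u ω v → support u ω ⊆ S → x ∈ support u ω → Reach S u x × Reach S x v
  support-reach {u = u} [] refl _ x∈ with x∈⁅y⁆⇒x≡y u x∈
  ... | refl = nil , nil
  support-reach {S} {u} ((e , true) ∷ ω) {v} (refl , walk) ⊆S x∈ =
    [ (λ x∈u → subst (λ x → Reach S u x × Reach S x v) (sym (x∈⁅y⁆⇒x≡y u x∈u)) (nil , step ◅ proj₂ (later start))) ,
      (λ x∈ω → let t→x , x→v = later x∈ω in step ◅ t→x , x→v) ]′ (x∈p∪q⁻ ⁅ u ⁆ (support (target e) ω) x∈)
    where
    start = start∈support (target e) ω
    later : ∀ {x} → x ∈ support (target e) ω → Reach S (target e) x × Reach S x v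
    later = support-reach ω walk (⊆S ∘ q⊆p∪q ⁅ u ⁆ _)
    step : InducedStep S (source e) (target e)
    step = ⊆S (start∈support u ((e , true) ∷ ω)) , ⊆S (∪ʳ start) , e , ∈⊤ , refl , refl
  support-reach {u = u} ((e , false) ∷ ω) (refl , walk) ⊆S x∈ = support-reach ω walk (⊆S ∘ q⊆p∪q ⁅ u ⁆ _)
    ([ ⁅⁆⊆ (start∈support u ω) , id ]′ (x∈p∪q⁻ ⁅ u ⁆ (support u ω) x∈))

  -- From any visited vertex the walk continues to its end `v`, and from its beginning `v` it comes
  -- to any other.
  support-stronglyConnected : ∀ {v} ω → Walk v ω v → StronglyConnected (support v ω)
  support-stronglyConnected ω walk x y x∈ y∈ =
    proj₂ (support-reach ω walk id x∈) ◅◅ proj₁ (support-reach ω walk id y∈)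

  entered⊆support : ∀ u ω → entered ω ⊆ support u ω
  entered⊆support u []                x∈ = contradiction x∈ ∉⊥
  entered⊆support u ((e , true) ∷ ω)  x∈ = ∪ʳ ([
    (λ x∈t → subst (_∈ support (target e) ω) (sym (x∈⁅y⁆⇒x≡y _ x∈t)) (start∈support (target e) ω)) ,
    entered⊆support (target e) ω ]′ (x∈p∪q⁻ ⁅ target e ⁆ (entered ω) x∈))
  entered⊆support u ((e , false) ∷ ω) x∈ = ∪ʳ (entered⊆support u ω x∈)

  support⊆entered : ∀ u ω {x} → x ∈ support u ω → x ≡ u ⊎ x ∈ entered ω
  support⊆entered u [] x∈ = inj₁ (x∈⁅y⁆⇒x≡y u x∈)
  support⊆entered u ((e , b) ∷ ω) x∈ with x∈p∪q⁻ ⁅ u ⁆ (support (next u (e , b)) ω) x∈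
  ... | inj₁ x∈u = inj₁ (x∈⁅y⁆⇒x≡y u x∈u)
  support⊆entered u ((e , true) ∷ ω) x∈ | inj₂ x∈ω with support⊆entered (target e) ω x∈ω
  ... | inj₁ refl = inj₂ (∪ˡ (x∈⁅x⁆ _))
  ... | inj₂ x∈e  = inj₂ (∪ʳ x∈e)
  support⊆entered u ((e , false) ∷ ω) x∈ | inj₂ x∈ω = support⊆entered u ω x∈ω

  -- The edges leaving the entered vertices do not depend on the initial tree.
  ∈-act⁻ : ∀ ω {H f} → f ∈ act ω H → f ∈ act ω ⊥ ⊎ (f ∈ H × source f ∉ entered ω)
  ∈-act⁺ : ∀ ω {H f} → f ∈ act ω ⊥ ⊎ (f ∈ H × source f ∉ entered ω) → f ∈ act ω H
  ∈-act⁻ [] f∈ = inj₂ (f∈ , ∉⊥)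
  ∈-act⁻ ((e , true) ∷ ω) {H} {f} f∈ with ∈-act⁻ ω f∈
  ... | inj₁ f∈τ = inj₁ (∈-act⁺ ω (inj₁ f∈τ))
  ... | inj₂ (f∈move , s∉) with ∈-move⁻ {H} f∈move
  ...   | inj₁ (f∈H , s≢t) = inj₂ (f∈H , ∉∪ (x≢y⇒x∉⁅y⁆ s≢t) s∉)
  ...   | inj₂ refl        = inj₁ (∈-act⁺ ω (inj₂ (new∈move {⊥} e , s∉)))
  ∈-act⁻ ((e , false) ∷ ω) f∈ = ∈-act⁻ ω f∈
  ∈-act⁺ [] (inj₁ f∈⊥)      = contradiction f∈⊥ ∉⊥
  ∈-act⁺ [] (inj₂ (f∈ , _)) = f∈
  ∈-act⁺ ((e , true) ∷ ω) {H} (inj₁ f∈τ) with ∈-act⁻ ω f∈τ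
  ... | inj₁ f∈τ′ = ∈-act⁺ ω (inj₁ f∈τ′)
  ... | inj₂ (f∈move , s∉) with ∈-move⁻ {⊥} f∈move
  ...   | inj₁ (f∈⊥ , _) = contradiction f∈⊥ ∉⊥
  ...   | inj₂ refl      = ∈-act⁺ ω (inj₂ (new∈move {H} e , s∉))
  ∈-act⁺ ((e , true) ∷ ω) {H} (inj₂ (f∈H , s∉)) = ∈-act⁺ ω (inj₂
    (∈-move⁺ f∈H (λ s≡t → s∉ (∪ˡ (∈⁅⁆ s≡t))) , λ s∈ → s∉ (∪ʳ s∈)))
  ∈-act⁺ ((e , false) ∷ ω) p = ∈-act⁺ ω p

  -- `act ω ⊥` collects the edges that the walk itself adds and does not delete later; each leaves a
  -- visited vertex.
  act-⊥-source : ∀ {u} ω {v f} → Walk u ω v → f ∈ act ω ⊥ → source f ∈ support u ω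
  act-⊥-source [] _ f∈ = contradiction f∈ ∉⊥
  act-⊥-source ((e , true) ∷ ω) (refl , walk) f∈ with ∈-act⁻ ω f∈
  ... | inj₁ f∈τ = ∪ʳ (act-⊥-source ω walk f∈τ)
  ... | inj₂ (f∈move , _) with ∈-move⁻ {⊥} f∈move
  ...   | inj₁ (f∈⊥ , _) = contradiction f∈⊥ ∉⊥
  ...   | inj₂ refl      = ∪ˡ (x∈⁅x⁆ _)
  act-⊥-source ((e , false) ∷ ω) (refl , walk) f∈ = ∪ʳ (act-⊥-source ω walk f∈)

  act-tree : ∀ {u} ω {v H} → Walk u ω v → Rooted ⁅ u ⁆ H → Rooted ⁅ v ⁆ (act ω H)
  act-tree [] refl T = T
  act-tree ((e , true) ∷ ω) (refl , walk) T = act-tree ω walk (move-tree (noLoop e) T)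
  act-tree ((e , false) ∷ ω) (refl , walk) T = act-tree ω walk T

  -- An edge of a fixed tree is left behind by the walk or goes out of a vertex never entered; as
  -- the root `v` has no edge, the edges outside the support determine the tree. Conversely the
  -- action of a walk is idempotent, so applying it to any tree that restricts to `K` gives a fixed
  -- one, and the edges outside the support are preserved.
  fixed-count : ∀ {v} ω → Walk v ω v →
    length (filter (λ a → isTree? v a ×-dec act ω a ≟ˢ a) edgeSets) ≡ length (forests (support v ω))
  fixed-count {v} ω walk = restrict-count (λ a → isTree? v a ×-dec act ω a ≟ˢ a) v∈S
    (λ Ta Tb fa fb eq → ⊆-antisym (incl Ta fa fb eq) (incl Tb fb fa (sym eq))) onto
    where
    S = support v ω
    v∈S = start∈support v ω

    incl : ∀ {a b} → Rooted ⁅ v ⁆ a → act ω a ≡ a → act ω b ≡ b → restrict a S ≡ restrict b S → a ⊆ b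
    incl {a} {b} Ta fa fb eq {e} e∈a with ∈-act⁻ ω (subst (e ∈_) (sym fa) e∈a)
    ... | inj₁ e∈τ        = subst (e ∈_) fb (∈-act⁺ ω (inj₁ e∈τ))
    ... | inj₂ (_ , s∉) = proj₁ (∈-restrict⁻ {b} {S} (subst (e ∈_) eq (∈-restrict⁺ e∈a λ s∈S →
      [ Rooted.roots Ta (x∈⁅x⁆ v) e∈a , s∉ ]′ (support⊆entered v ω s∈S))))

    onto : ∀ {K} → Rooted S K → ∃ λ a → Rooted ⁅ v ⁆ a × act ω a ≡ a × restrict a S ≡ K
    onto {K} F with φ-surjective (support-stronglyConnected ω walk) v∈S F
    ... | a , T , _ , refl = act ω a , act-tree ω walk T ,
      ⊆-antisym
        (λ e∈ → [ (λ e∈τ → ∈-act⁺ ω (inj₁ e∈τ)) , proj₁ ]′ (∈-act⁻ ω e∈))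
        (λ e∈ → ∈-act⁺ ω ([ inj₁ , (λ (_ , s∉) → inj₂ (e∈ , s∉)) ]′ (∈-act⁻ ω e∈))) ,
      ⊆-antisym
        (λ e∈ → let e∈act , s∉S = ∈-restrict⁻ {act ω a} e∈ in
          ∈-restrict⁺ ([ (λ e∈τ → contradiction (act-⊥-source ω walk e∈τ) s∉S) , proj₁ ]′ (∈-act⁻ ω e∈act)) s∉S)
        (λ e∈ → let e∈a , s∉S = ∈-restrict⁻ {a} e∈ in
          ∈-restrict⁺ (∈-act⁺ ω (inj₂ (e∈a , s∉S ∘ entered⊆support v ω))) s∉S)

-- Cardinalities as sums

module _ {c ℓ} (S : CommutativeSemiring c ℓ) where
  open CommutativeSemiring S hiding (zero; refl; sym; trans; reflexive)
  private module ≈ = CommutativeSemiring S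
  open BigSum S
  open import Algebra.Properties.Semiring.Mult semiring using () renaming (_×_ to _·_)

  ⨁-∈? : ∀ {n} (p : Subset n) {a} → ⨁ (allFin n) (λ i → when (i ∈? p) a) ≈ ∣ p ∣ · a
  ⨁-∈? Vec.[] = ≈.refl
  ⨁-∈? {suc n} (s Vec.∷ p) {a} = ≈.trans (≈.reflexive (⨁-allFin-suc n)) (head s)
    where
    tail : ∀ s → ⨁ (allFin n) (λ i → when (suc i ∈? (s Vec.∷ p)) a) ≈ ∣ p ∣ · a
    tail s = ≈.trans (⨁-cong (allFin n) λ i → when-cong (suc i ∈? (s Vec.∷ p)) (i ∈? p) drop-there Vec.there (λ _ _ → ≈.refl))
                     (⨁-∈? p)
    head : ∀ s → when (zero ∈? (s Vec.∷ p)) a + ⨁ (allFin n) (λ i → when (suc i ∈? (s Vec.∷ p)) a) ≈ ∣ s Vec.∷ p ∣ · a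
    head inside  = +-congˡ (tail inside)
    head outside = ≈.trans (+-identityˡ _) (tail outside)

module _ {n m} (G : Digraph n m) where
  open Forests G
  open BigSum ℕ.+-*-commutativeSemiring

  private
    ∣∣≡⨁ : ∀ {k} (p : Subset k) → ∣ p ∣ ≡ ⨁ (allFin k) (λ i → when (i ∈? p) 1)
    ∣∣≡⨁ p = sym (trans (⨁-∈? ℕ.+-*-commutativeSemiring p) (k·1≡k ∣ p ∣))

  ∣∪⁅⁆∣ : ∀ {k} {p : Subset k} {i} → i ∉ p → ∣ p ∪ ⁅ i ⁆ ∣ ≡ suc ∣ p ∣
  ∣∪⁅⁆∣ {k} {p} {i} i∉p = begin
    ∣ p ∪ ⁅ i ⁆ ∣                                                 ≡⟨ ∣∣≡⨁ (p ∪ ⁅ i ⁆) ⟩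
    ⨁ (allFin k) (λ j → when (j ∈? p ∪ ⁅ i ⁆) 1)                  ≡⟨ ⨁-cong (allFin k) (λ j → split j (j ≟ i)) ⟩
    ⨁ (allFin k) (λ j → when (j ≟ i) 1 ℕ.+ when (j ∈? p) 1)       ≡⟨ ⨁-∙ (allFin k) ⟩
    ⨁ (allFin k) (λ j → when (j ≟ i) 1) ℕ.+ ⨁ (allFin k) (λ j → when (j ∈? p) 1)
      ≡⟨ cong₂ ℕ._+_ (⨁-only (_≟ i) (Unique.allFin⁺ k) (∈-allFin i) refl (λ _ → id)) (sym (∣∣≡⨁ p)) ⟩
    suc ∣ p ∣ ∎
    where
    open ≡-Reasoning
    split : ∀ j (d : Dec (j ≡ i)) → when (j ∈? p ∪ ⁅ i ⁆) 1 ≡ when d 1 ℕ.+ when (j ∈? p) 1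
    split j (yes refl) = trans (when-yes (j ∈? p ∪ ⁅ j ⁆) (∪ʳ (x∈⁅x⁆ j)))
                               (cong suc (sym (when-no (j ∈? p) i∉p)))
    split j (no j≢i) = when-cong (j ∈? p ∪ ⁅ i ⁆) (j ∈? p)
      (λ j∈ → [ id , (λ j∈i → contradiction (x∈⁅y⁆⇒x≡y i j∈i) j≢i) ]′ (x∈p∪q⁻ p ⁅ i ⁆ j∈))
      ∪ˡ (λ _ _ → refl)

  rootsIn : Subset n → Subset m → Subset n
  rootsIn W H = ⟪ (λ v → v ∈? W ×-dec root? H v) ⟫

  ∈-rootsIn⁺ : ∀ {W H v} → v ∈ W → Root H v → v ∈ rootsIn W H
  ∈-rootsIn⁺ {W} {H} v∈ r = ∈⟪⟫⁺ (λ v → v ∈? W ×-dec root? H v) (v∈ , r)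

  ∈-rootsIn⁻ : ∀ {W H v} → v ∈ rootsIn W H → v ∈ W × Root H v
  ∈-rootsIn⁻ {W} {H} = ∈⟪⟫⁻ (λ v → v ∈? W ×-dec root? H v)

  -- Counted by source: each vertex of `W` is either a root or the source of exactly one edge.
  ∣edges∣+∣roots∣ : ∀ {W H} → (∀ {e} → e ∈ H → source e ∈ W) → Functional H → ∣ H ∣ ℕ.+ ∣ rootsIn W H ∣ ≡ ∣ W ∣
  ∣edges∣+∣roots∣ {W} {H} sources functional = begin
    ∣ H ∣ ℕ.+ ∣ rootsIn W H ∣
      ≡⟨ cong₂ ℕ._+_ (∣∣≡⨁ H) (∣∣≡⨁ (rootsIn W H)) ⟩
    ⨁ (allFin m) (λ e → when (e ∈? H) 1) ℕ.+ R
      ≡⟨ cong (ℕ._+ R) (⨁-cong (allFin m) λ e → sym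
           (⨁-only (source e ≟_) {f = λ _ → when (e ∈? H) 1} (Unique.allFin⁺ n) (∈-allFin (source e)) refl (λ _ → sym))) ⟩
    ⨁ (allFin m) (λ e → ⨁ (allFin n) (λ v → when (source e ≟ v) (when (e ∈? H) 1))) ℕ.+ R
      ≡⟨ cong (ℕ._+ R) (⨁-swap (allFin m) (allFin n)) ⟩
    ⨁ (allFin n) (λ v → ⨁ (allFin m) (λ e → when (source e ≟ v) (when (e ∈? H) 1))) ℕ.+ R
      ≡⟨ ⨁-∙ (allFin n) ⟨
    ⨁ (allFin n) (λ v → ⨁ (allFin m) (λ e → when (source e ≟ v) (when (e ∈? H) 1)) ℕ.+ when (v ∈? rootsIn W H) 1)
      ≡⟨ ⨁-cong (allFin n) (λ v → at v (root? H v)) ⟩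
    ⨁ (allFin n) (λ v → when (v ∈? W) 1)
      ≡⟨ ∣∣≡⨁ W ⟨
    ∣ W ∣ ∎
    where
    open ≡-Reasoning
    R = ⨁ (allFin n) (λ v → when (v ∈? rootsIn W H) 1)
    at : ∀ v → Dec (Root H v) → ⨁ (allFin m) (λ e → when (source e ≟ v) (when (e ∈? H) 1)) ℕ.+ when (v ∈? rootsIn W H) 1
                              ≡ when (v ∈? W) 1
    at v (yes r) = cong₂ ℕ._+_
      (trans (⨁-cong (allFin m) λ e → trans (when-congʳ (source e ≟ v) λ s≡v → when-no (e ∈? H) (λ e∈H → r e∈H s≡v))
                                             (when-ε (source e ≟ v)))
             (⨁-ε (allFin m)))
      (when-cong (v ∈? rootsIn W H) (v ∈? W) (proj₁ ∘ ∈-rootsIn⁻ {W} {H}) (λ v∈W → ∈-rootsIn⁺ v∈W r) (λ _ _ → refl))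
    at v (no ¬r) with nonroot ¬r
    ... | e , e∈H , refl = trans (cong₂ ℕ._+_
      (trans (⨁-cong (allFin m) λ f → sym (when-× (source f ≟ v) (f ∈? H)))
             (⨁-only (λ f → source f ≟ v ×-dec f ∈? H) {f = λ _ → 1} (Unique.allFin⁺ m) (∈-allFin e) (refl , e∈H)
               (λ f (s≡ , f∈H) → functional f∈H e∈H s≡)))
      (when-no (v ∈? rootsIn W H) (λ v∈ → ¬r (proj₂ (∈-rootsIn⁻ {W} {H} v∈)))))
      (sym (when-yes (v ∈? W) (sources e∈H)))

-- Partial forests and the matrix forest theorem

module PartialForests {n m} (G : Digraph n m) (W : Subset n) where
  open Forests G

  record Partial (H : Subset m) : Set where
    constructor partial
    field
      sources    : ∀ {e} → e ∈ H → source e ∈ W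
      functional : Functional H
      acyclic    : Acyclic H

  partial? : ∀ H → Dec (Partial H)
  partial? H = map′ (λ (s , f , a) → partial (λ {e} → s e) (λ {e} {g} → f {e} {g}) a) (λ (partial s f a) → (λ e → s {e}) , (λ {e} {g} → f {e} {g}) , a)
    (all? (λ e → e ∈? H →-dec source e ∈? W) ×-dec (functional? H ×-dec
     all? (λ e → e ∈? H →-dec ¬? (path? H (target e) (source e)))))

  ⊆-partial : ∀ {H K} → H ⊆ K → Partial K → Partial H
  ⊆-partial H⊆K (partial s f a) = partial (s ∘ H⊆K) (λ e∈ f∈ → f (H⊆K e∈) (H⊆K f∈))
    (λ e e∈ π → a e (H⊆K e∈) (path-⊆ H⊆K π))

  Leads : Subset m → Fin n → Fin n → Set
  Leads H u j = Path H u j × Root H j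

  leads? : ∀ H u j → Dec (Leads H u j)
  leads? H u j = path? H u j ×-dec root? H j

  module Insert {H i e} (F : Partial H) (i∈W : i ∈ W) (rootᵢ : Root H i) (s≡i : source e ≡ i) (no-cycle : ¬ Path H (target e) i) where
    private
      H′ = H ∪ ⁅ e ⁆
      H⊆ : H ⊆ H′
      H⊆ = p⊆p∪q ⁅ e ⁆
      e∈ : e ∈ H′
      e∈ = ∪ʳ (x∈⁅x⁆ e)

    e∉H : e ∉ H
    e∉H e∈H = rootᵢ e∈H s≡i

    nonrootᵢ : ¬ Root H′ i
    nonrootᵢ r = r e∈ s≡i

    root⁺ : ∀ {j} → Root H j → j ≢ i → Root H′ j
    root⁺ r j≢i f∈ s≡j with x∈p∪q⁻ H ⁅ e ⁆ f∈
    ... | inj₁ f∈H = r f∈H s≡j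
    ... | inj₂ f∈e with x∈⁅y⁆⇒x≡y e f∈e
    ...   | refl = j≢i (trans (sym s≡j) s≡i)

    functional′ : Functional H′
    functional′ f∈ g∈ s≡ with x∈p∪q⁻ H ⁅ e ⁆ f∈ | x∈p∪q⁻ H ⁅ e ⁆ g∈
    ... | inj₁ f∈H | inj₁ g∈H = Partial.functional F f∈H g∈H s≡
    ... | inj₁ f∈H | inj₂ g∈e = contradiction (trans s≡ (trans (cong source (x∈⁅y⁆⇒x≡y e g∈e)) s≡i)) (rootᵢ f∈H)
    ... | inj₂ f∈e | inj₁ g∈H = contradiction (trans (sym s≡) (trans (cong source (x∈⁅y⁆⇒x≡y e f∈e)) s≡i)) (rootᵢ g∈H)
    ... | inj₂ f∈e | inj₂ g∈e = trans (x∈⁅y⁆⇒x≡y e f∈e) (sym (x∈⁅y⁆⇒x≡y e g∈e))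

    insert-partial : Partial H′
    insert-partial = partial
      (λ f∈ → [ Partial.sources F , (λ f∈e → subst (_∈ W) (sym (trans (cong source (x∈⁅y⁆⇒x≡y e f∈e)) s≡i)) i∈W) ]′ (x∈p∪q⁻ H ⁅ e ⁆ f∈))
      functional′ (path-to-root⇒acyclic functional′ toRoot)
      where
      toRoot : ∀ u → ∃ λ r → Root H′ r × Path H′ u r
      toRoot u with acyclic⇒path-to-root (Partial.acyclic F) u
      ... | r , root , π with r ≟ i
      ...   | no r≢i = r , root⁺ root r≢i , path-⊆ H⊆ π
      ...   | yes refl with acyclic⇒path-to-root (Partial.acyclic F) (target e)
      ...     | r′ , root′ , π′ = r′ , root⁺ root′ (λ { refl → no-cycle π′ }) ,
                path-⊆ H⊆ π ◅◅ (e , e∈ , s≡i , refl) ◅ path-⊆ H⊆ π′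

    -- Inserting `e` hangs the tree of `i` onto the tree of `target e`. Since nothing leads from
    -- `target e` back to `i`, a path uses `e` at most once: either the root is unchanged, or it was
    -- `i` and is now that of `target e`.
    leads⁻ : ∀ {u j} → Leads H′ u j → Leads H u j × j ≢ i ⊎ Path H u i × Leads H (target e) j
    leads⁻ {j = j} (π , r) = go π
      where
      r′ : Root H j
      r′ = r ∘ H⊆
      go : ∀ {u} → Path H′ u j → Leads H u j × j ≢ i ⊎ Path H u i × Leads H (target e) j
      go nil = inj₁ ((nil , r′) , λ { refl → nonrootᵢ r })
      go ((f , f∈ , refl , refl) ◅ π) with x∈p∪q⁻ H ⁅ e ⁆ f∈ | go π
      ... | inj₁ f∈H | inj₁ ((ρ , _) , j≢i) = inj₁ ((edge f∈H ◅◅ ρ , r′) , j≢i)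
      ... | inj₁ f∈H | inj₂ (ρ , l)         = inj₂ (edge f∈H ◅◅ ρ , l)
      ... | inj₂ f∈e | p with x∈⁅y⁆⇒x≡y e f∈e
      go ((f , f∈ , refl , refl) ◅ π) | inj₂ f∈e | inj₁ (l , _) | refl = inj₂ (subst (λ v → Path H v i) (sym s≡i) nil , l)
      go ((f , f∈ , refl , refl) ◅ π) | inj₂ f∈e | inj₂ (ρ , _) | refl = contradiction ρ no-cycle

    leads⁺ : ∀ {u j} → Leads H u j × j ≢ i ⊎ Path H u i × Leads H (target e) j → Leads H′ u j
    leads⁺ (inj₁ ((π , r) , j≢i)) = path-⊆ H⊆ π , root⁺ r j≢i
    leads⁺ (inj₂ (π , ρ , r))     = path-⊆ H⊆ π ◅◅ (e , e∈ , s≡i , refl) ◅ path-⊆ H⊆ ρ , root⁺ r λ { refl → no-cycle ρ }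

  out : Fin n → List (Fin m)
  out i = filter (λ e → source e ≟ i) (allFin m)

  members : List (Fin n)
  members = filter (_∈? W) (allFin n)

  Below : Fin n → Subset m → Set
  Below i H = Partial H × Root H i

  below? : ∀ i H → Dec (Below i H)
  below? i H = partial? H ×-dec root? H i

  -- The inverse deletes the single edge out of `i`; acyclicity says that the target of this edge
  -- did not lead to `i`.
  insertions-↭ : ∀ {i} → i ∈ W →
    map (λ (H , e) → H ∪ ⁅ e ⁆)
      (filter (λ (H , e) → below? i H ×-dec (source e ≟ i ×-dec ¬? (path? H (target e) i))) (cartesianProduct edgeSets (allFin m)))
    ↭ filter (λ H → partial? H ×-dec ¬? (root? H i)) edgeSets
  insertions-↭ {i} i∈W = bijection-↭ (Unique.filter⁺ P? (Unique.cartesianProduct⁺ (allSubsets-unique m) (Unique.allFin⁺ m)))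
    (Unique.filter⁺ Q? (allSubsets-unique m)) into inj onto
    where
    P? = λ ((H , e) : Subset m × Fin m) → below? i H ×-dec (source e ≟ i ×-dec ¬? (path? H (target e) i))
    Q? = λ H → partial? H ×-dec ¬? (root? H i)
    pairs = cartesianProduct edgeSets (allFin m)

    into : ∀ {p} → p ∈ˡ filter P? pairs → proj₁ p ∪ ⁅ proj₂ p ⁆ ∈ˡ filter Q? edgeSets
    into p∈ with ∈-filter⁻ P? {xs = pairs} p∈
    ... | _ , (F , r) , s≡i , nc = ∈-filter⁺ Q? (∈-allSubsets _) (insert-partial , nonrootᵢ)
      where open Insert F i∈W r s≡i nc

    incl : ∀ {H K e} → Root H i → source e ≡ i → H ∪ ⁅ e ⁆ ≡ K ∪ ⁅ e ⁆ → H ⊆ K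
    incl {H} {K} {e} r s≡i eq {f} f∈ with x∈p∪q⁻ K ⁅ e ⁆ (subst (f ∈_) eq (∪ˡ f∈))
    ... | inj₁ f∈K = f∈K
    ... | inj₂ f∈e = contradiction (trans (cong source (x∈⁅y⁆⇒x≡y e f∈e)) s≡i) (r f∈)

    inj : ∀ {p q} → p ∈ˡ filter P? pairs → q ∈ˡ filter P? pairs → proj₁ p ∪ ⁅ proj₂ p ⁆ ≡ proj₁ q ∪ ⁅ proj₂ q ⁆ → p ≡ q
    inj {H , e} {K , f} p∈ q∈ eq with ∈-filter⁻ P? {xs = pairs} p∈ | ∈-filter⁻ P? {xs = pairs} q∈
    ... | _ , (_ , r) , s≡i , _ | _ , (_ , r′) , s≡i′ , _
      with x∈p∪q⁻ K ⁅ f ⁆ (subst (e ∈_) eq (∪ʳ (x∈⁅x⁆ e)))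
    ...   | inj₁ e∈K = contradiction s≡i (r′ e∈K)
    ...   | inj₂ e∈f with x∈⁅y⁆⇒x≡y f e∈f
    ...     | refl = cong (_, e) (⊆-antisym (incl r s≡i eq) (incl r′ s≡i′ (sym eq)))

    onto : ∀ {K} → K ∈ˡ filter Q? edgeSets → ∃ λ p → p ∈ˡ filter P? pairs × proj₁ p ∪ ⁅ proj₂ p ⁆ ≡ K
    onto {K} K∈ with ∈-filter⁻ Q? {xs = allSubsets m} K∈
    ... | _ , F , ¬r with nonroot ¬r
    ...   | e , e∈K , refl = (H , e) , ∈-filter⁺ P? (∈-cartesianProduct⁺ (∈-allSubsets H) (∈-allFin e))
      ((⊆-partial H⊆K F , λ f∈ s≡ → proj₂ (∈-restrict⁻ {K} f∈) (∈⁅⁆ s≡))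
      , refl , λ π → Partial.acyclic F e e∈K (path-⊆ H⊆K π)) ,
      ⊆-antisym (λ f∈ → [ H⊆K , ⁅⁆⊆ e∈K ]′ (x∈p∪q⁻ H ⁅ e ⁆ f∈)) K⊆
      where
      H = restrict K ⁅ i ⁆
      H⊆K : H ⊆ K
      H⊆K f∈ = proj₁ (∈-restrict⁻ {K} {⁅ i ⁆} f∈)
      K⊆ : K ⊆ H ∪ ⁅ e ⁆
      K⊆ {f} f∈ with source f ≟ i
      ... | no s≢  = ∪ˡ (∈-restrict⁺ f∈ (x≢y⇒x∉⁅y⁆ s≢))
      ... | yes s≡ = ∪ʳ (subst (_∈ ⁅ e ⁆) (Partial.functional F e∈K f∈ (sym s≡)) (x∈⁅x⁆ e))

module MatrixForest {c ℓ} (R : CommutativeRing c ℓ) {n m} (G : Digraph n m) (W : Subset n)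
                    (x : Fin m → CommutativeRing.Carrier R) where
  open CommutativeRing R hiding (zero; refl; sym; trans; reflexive)
  private
    module ≈ = CommutativeRing R
    module Π = BigOp *-commutativeMonoid
  open BigSum commutativeSemiring
  open Forests G
  open PartialForests G W
  open PowerSeries R using (Series)
  open Weighted R using (weight)
  open Solver commutativeSemiring using (solve; _:=_; _:+_; _:*_; con)
  open ≈-Reasoning setoid

  𝟙 : ∀ {p} {P : Set p} → Dec P → Carrier
  𝟙 P? = when P? 1#

  when≈𝟙* : ∀ {p} {P : Set p} (P? : Dec P) {y} → when P? y ≈ 𝟙 P? * y
  when≈𝟙* (yes _) = ≈.sym (*-identityˡ _)
  when≈𝟙* (no _)  = ≈.sym (zeroˡ _)

  𝟙-⊎ : ∀ {T L A B : Set} (T? : Dec T) (L? : Dec L) (A? : Dec A) (B? : Dec B) →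
         (T → L ⊎ A × B) → (L → T) → (A × B → T) → (L → ¬ A) → 𝟙 T? ≈ 𝟙 L? + 𝟙 A? * 𝟙 B?
  𝟙-⊎ T? (yes l) (yes a) B? _ _ _ disjoint = contradiction a (disjoint l)
  𝟙-⊎ T? (yes l) (no _)  B? _ L⇒T _ _ = ≈.trans (≈.reflexive (when-yes T? (L⇒T l)))
    (≈.sym (≈.trans (+-congˡ (zeroˡ _)) (+-identityʳ 1#)))
  𝟙-⊎ T? (no ¬l) (yes a) B? T⇒ _ AB⇒T _ = ≈.trans
    (when-cong T? B? (λ t → [ (λ l → contradiction l ¬l) , proj₂ ]′ (T⇒ t)) (λ b → AB⇒T (a , b)) (λ _ _ → ≈.refl))
    (≈.sym (≈.trans (+-identityˡ _) (*-identityˡ _)))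
  𝟙-⊎ T? (no ¬l) (no ¬a) B? T⇒ _ _ _ = ≈.trans (≈.reflexive (when-no T? λ t → [ ¬l , ¬a ∘ proj₁ ]′ (T⇒ t)))
    (≈.sym (≈.trans (+-identityˡ _) (zeroˡ _)))

  weight-insert : ∀ {H e} → e ∉ H → weight x (H ∪ ⁅ e ⁆) ≈ x e * weight x H
  weight-insert {H} {e} e∉H = begin
    Π.⨁ (filter (_∈? H ∪ ⁅ e ⁆) (allFin m)) x              ≈⟨ Π.⨁-filter (_∈? H ∪ ⁅ e ⁆) (allFin m) ⟩
    Π.⨁ (allFin m) (λ f → Π.when (f ∈? H ∪ ⁅ e ⁆) (x f))    ≈⟨ Π.⨁-cong (allFin m) (λ f → split f (f ≟ e)) ⟩
    Π.⨁ (allFin m) (λ f → Π.when (f ≟ e) (x f) * Π.when (f ∈? H) (x f)) ≈⟨ Π.⨁-∙ (allFin m) ⟩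
    Π.⨁ (allFin m) (λ f → Π.when (f ≟ e) (x f)) * Π.⨁ (allFin m) (λ f → Π.when (f ∈? H) (x f))
      ≈⟨ *-cong (Π.⨁-only (_≟ e) (Unique.allFin⁺ m) (∈-allFin e) refl (λ _ → id)) (≈.sym (Π.⨁-filter (_∈? H) (allFin m))) ⟩
    x e * weight x H ∎
    where
    split : ∀ f (d : Dec (f ≡ e)) → Π.when (f ∈? H ∪ ⁅ e ⁆) (x f) ≈ Π.when d (x f) * Π.when (f ∈? H) (x f)
    split f (yes refl) = ≈.trans (≈.reflexive (Π.when-yes (f ∈? H ∪ ⁅ f ⁆) (∪ʳ (x∈⁅x⁆ f))))
      (≈.sym (≈.trans (*-congˡ (≈.reflexive (Π.when-no (f ∈? H) e∉H))) (*-identityʳ _)))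
    split f (no f≢e) = ≈.trans (Π.when-cong (f ∈? H ∪ ⁅ e ⁆) (f ∈? H)
      (λ f∈ → [ id , (λ f∈e → contradiction (x∈⁅y⁆⇒x≡y e f∈e) f≢e) ]′ (x∈p∪q⁻ H ⁅ e ⁆ f∈))
      ∪ˡ (λ _ _ → ≈.refl)) (≈.sym (*-identityˡ _))

  𝔽 : (Subset m → Carrier) → Carrier
  𝔽 Q = ⨁ edgeSets (λ H → when (partial? H) (Q H))

  𝔽-cong : ∀ {Q Q′} → (∀ {H} → Partial H → Q H ≈ Q′ H) → 𝔽 Q ≈ 𝔽 Q′
  𝔽-cong Q≈Q′ = ⨁-cong edgeSets λ H → when-congʳ (partial? H) Q≈Q′

  -- r k H is q k of H enlarged by one edge, without the weight of that edge.
  q r : ℕ → Subset m → Carrier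
  q k H = when (∣ H ∣ ℕ.≟ k) (weight x H)
  r k H = when (suc ∣ H ∣ ℕ.≟ k) (weight x H)

  forestSeries : Series
  forestSeries k = 𝔽 (q k)

  -- For `u` and `j` in `W`, the (u , j) entry of the adjugate of 1 - tB, in its description by
  -- forests where `j` is the root of the tree of `u`.
  leadsTo : Fin n → Fin n → Series
  leadsTo u j k = 𝔽 (λ H → when (leads? H u j) (q k H))

  r-suc : ∀ k H → r (suc k) H ≈ q k H
  r-suc k H = when-cong (suc ∣ H ∣ ℕ.≟ suc k) (∣ H ∣ ℕ.≟ k) ℕ.suc-injective (cong suc) (λ _ _ → ≈.refl)

  -- Row `i` of the matrix forest theorem. Both sides are rewritten as sums over the forests in
  -- which `i` is a root, where they agree summand by summand.
  module At {i : Fin n} (i∈W : i ∈ W) where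

    𝔹 : (Subset m → Carrier) → Carrier
    𝔹 Q = ⨁ edgeSets (λ H → when (below? i H) (Q H))

    𝔹-cong : ∀ {Q Q′} → (∀ {H} → Partial H → Root H i → Q H ≈ Q′ H) → 𝔹 Q ≈ 𝔹 Q′
    𝔹-cong Q≈Q′ = ⨁-cong edgeSets λ H → when-congʳ (below? i H) λ (F , root) → Q≈Q′ F root

    𝔹-+ : ∀ {Q Q′} → 𝔹 (λ H → Q H + Q′ H) ≈ 𝔹 Q + 𝔹 Q′
    𝔹-+ = ≈.trans (⨁-cong edgeSets λ H → when-∙ (below? i H)) (⨁-∙ edgeSets)

    ⨁-*-𝔹 : ∀ (es : List (Fin m)) {Q : Fin m → Subset m → Carrier} →
             ⨁ es (λ e → x e * 𝔹 (Q e)) ≈ 𝔹 (λ H → ⨁ es (λ e → x e * Q e H))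
    ⨁-*-𝔹 es {Q} = begin
      ⨁ es (λ e → x e * 𝔹 (Q e))
        ≈⟨ ⨁-cong es (λ e → ≈.trans (*-⨁ (x e) edgeSets) (⨁-cong edgeSets λ H → *-when (x e) (below? i H))) ⟩
      ⨁ es (λ e → ⨁ edgeSets (λ H → when (below? i H) (x e * Q e H)))
        ≈⟨ ⨁-swap es edgeSets ⟩
      ⨁ edgeSets (λ H → ⨁ es (λ e → when (below? i H) (x e * Q e H)))
        ≈⟨ ⨁-cong edgeSets (λ H → when-⨁ (below? i H) es) ⟨
      𝔹 (λ H → ⨁ es (λ e → x e * Q e H)) ∎

    free? : ∀ H e → Dec (¬ Path H (target e) i)
    free? H e = ¬? (path? H (target e) i)

    -- Each H with root i is grouped with the sets H ∪ ⁅ e ⁆ for e out of i.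
    split : ∀ Q → 𝔽 Q ≈ 𝔹 (λ H → Q H + ⨁ (out i) (λ e → when (free? H e) (Q (H ∪ ⁅ e ⁆))))
    split Q = begin
      𝔽 Q
        ≈⟨ ⨁-cong edgeSets (λ H → cases H (partial? H) (root? H i)) ⟩
      ⨁ edgeSets (λ H → when (below? i H) (Q H) + when (nonroot? H) (Q H))
        ≈⟨ ⨁-∙ edgeSets ⟩
      𝔹 Q + ⨁ edgeSets (λ H → when (nonroot? H) (Q H))
        ≈⟨ +-congˡ inserted ⟩
      𝔹 Q + 𝔹 (λ H → ⨁ (out i) (λ e → when (free? H e) (Q (H ∪ ⁅ e ⁆))))
        ≈⟨ 𝔹-+ ⟨
      𝔹 (λ H → Q H + ⨁ (out i) (λ e → when (free? H e) (Q (H ∪ ⁅ e ⁆)))) ∎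
      where
      nonroot? = λ H → partial? H ×-dec ¬? (root? H i)
      insert?  = λ ((H , e) : Subset m × Fin m) → below? i H ×-dec (source e ≟ i ×-dec ¬? (path? H (target e) i))
      pairs    = cartesianProduct edgeSets (allFin m)

      cases : ∀ H (d : Dec (Partial H)) (d′ : Dec (Root H i)) →
              when d (Q H) ≈ when (d ×-dec d′) (Q H) + when (d ×-dec ¬? d′) (Q H)
      cases H (yes _) (yes _) = ≈.sym (+-identityʳ _)
      cases H (yes _) (no _)  = ≈.sym (+-identityˡ _)
      cases H (no _)  _       = ≈.sym (+-identityˡ _)

      inserted : ⨁ edgeSets (λ H → when (nonroot? H) (Q H)) ≈
                 𝔹 (λ H → ⨁ (out i) (λ e → when (free? H e) (Q (H ∪ ⁅ e ⁆))))
      inserted = begin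
        ⨁ edgeSets (λ H → when (nonroot? H) (Q H))
          ≈⟨ ⨁-filter nonroot? edgeSets ⟨
        ⨁ (filter nonroot? edgeSets) Q
          ≈⟨ ⨁-↭ (insertions-↭ i∈W) ⟨
        ⨁ (map (λ (H , e) → H ∪ ⁅ e ⁆) (filter insert? pairs)) Q
          ≡⟨ ⨁-map (λ (H , e) → H ∪ ⁅ e ⁆) (filter insert? pairs) ⟩
        ⨁ (filter insert? pairs) (λ (H , e) → Q (H ∪ ⁅ e ⁆))
          ≈⟨ ⨁-filter insert? pairs ⟩
        ⨁ pairs (λ (H , e) → when (insert? (H , e)) (Q (H ∪ ⁅ e ⁆)))
          ≈⟨ ⨁-cartesianProduct edgeSets (allFin m) ⟩
        ⨁ edgeSets (λ H → ⨁ (allFin m) (λ e → when (insert? (H , e)) (Q (H ∪ ⁅ e ⁆))))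
          ≈⟨ ⨁-cong edgeSets (λ H → begin
               ⨁ (allFin m) (λ e → when (insert? (H , e)) (Q (H ∪ ⁅ e ⁆)))
                 ≈⟨ ⨁-cong (allFin m) (λ e → ≈.reflexive (trans (when-× (below? i H) (source e ≟ i ×-dec ¬? (path? H (target e) i)))
                      (cong (when (below? i H)) (when-× (source e ≟ i) (free? H e))))) ⟩
               ⨁ (allFin m) (λ e → when (below? i H) (when (source e ≟ i) (when (free? H e) (Q (H ∪ ⁅ e ⁆)))))
                 ≈⟨ when-⨁ (below? i H) (allFin m) ⟨
               when (below? i H) (⨁ (allFin m) (λ e → when (source e ≟ i) (when (free? H e) (Q (H ∪ ⁅ e ⁆)))))
                 ≈⟨ when-congʳ (below? i H) (λ _ → ⨁-filter (λ e → source e ≟ i) (allFin m)) ⟨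
               when (below? i H) (⨁ (out i) (λ e → when (free? H e) (Q (H ∪ ⁅ e ⁆)))) ∎) ⟩
        𝔹 (λ H → ⨁ (out i) (λ e → when (free? H e) (Q (H ∪ ⁅ e ⁆)))) ∎

    ∈-out : ∀ {e} → e ∈ˡ out i → source e ≡ i
    ∈-out e∈ = proj₂ (∈-filter⁻ (λ e → source e ≟ i) {xs = allFin m} e∈)

    q-insert : ∀ {H e k} → e ∉ H → q k (H ∪ ⁅ e ⁆) ≈ x e * r k H
    q-insert {H} {e} {k} e∉H = begin
      when (∣ H ∪ ⁅ e ⁆ ∣ ℕ.≟ k) (weight x (H ∪ ⁅ e ⁆)) ≈⟨ when-cong (∣ H ∪ ⁅ e ⁆ ∣ ℕ.≟ k) (suc ∣ H ∣ ℕ.≟ k)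
        (trans (sym (∣∪⁅⁆∣ G e∉H))) (trans (∣∪⁅⁆∣ G e∉H)) (λ _ _ → weight-insert e∉H) ⟩
      when (suc ∣ H ∣ ℕ.≟ k) (x e * weight x H)         ≈⟨ *-when (x e) (suc ∣ H ∣ ℕ.≟ k) ⟨
      x e * r k H                                       ∎

    -- Whether `u` belongs to the tree of the root `i`. At the target of an edge out of `i`, `α`
    -- means that the edge would close a cycle and `ᾱ` that it may be inserted.
    α ᾱ : Subset m → Fin n → Carrier
    α H u = 𝟙 (path? H u i)
    ᾱ H u = 𝟙 (¬? (path? H u i))

    α+ᾱ : ∀ H u → α H u + ᾱ H u ≈ 1#
    α+ᾱ H u with path? H u i
    ... | yes _ = +-identityʳ 1#
    ... | no _  = +-identityˡ 1#

    X : Carrier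
    X = ⨁ (out i) x

    -- The total weight of the edges out of `i` that would close a cycle with `H`, and of those that
    -- may be inserted.
    A Ā : Subset m → Carrier
    A H = ⨁ (out i) (λ e → x e * α H (target e))
    Ā H = ⨁ (out i) (λ e → x e * ᾱ H (target e))

    X≈A+Ā : ∀ H → X ≈ A H + Ā H
    X≈A+Ā H = begin
      X ≈⟨ ⨁-cong (out i) (λ e → ≈.trans (≈.sym (*-identityʳ _)) (≈.trans (*-congˡ (≈.sym (α+ᾱ H (target e)))) (distribˡ _ _ _))) ⟩
      ⨁ (out i) (λ e → x e * α H (target e) + x e * ᾱ H (target e)) ≈⟨ ⨁-∙ (out i) ⟩
      A H + Ā H ∎

    ⨁-* : ∀ {f : Fin m → Carrier} a → ⨁ (out i) (λ e → f e * a) ≈ ⨁ (out i) f * a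
    ⨁-* {f} a = ≈.trans (⨁-cong (out i) λ e → *-comm _ _) (≈.trans (≈.sym (*-⨁ a (out i))) (*-comm _ _))

    leadsToᵢ : ∀ u k → leadsTo u i k ≈ 𝔹 (λ H → α H u * q k H)
    leadsToᵢ u k = ≈.trans (split _) (𝔹-cong λ {H} F root → begin
      when (leads? H u i) (q k H) + ⨁ (out i) (λ e → when (free? H e) (when (leads? (H ∪ ⁅ e ⁆) u i) (q k (H ∪ ⁅ e ⁆))))
        ≈⟨ +-cong (≈.trans (when-cong (leads? H u i) (path? H u i) proj₁ (_, root) (λ _ _ → ≈.refl)) (when≈𝟙* (path? H u i)))
             (≈.trans (⨁-cong-∈ (out i) λ e e∈ → ≈.trans (when-congʳ (free? H e) λ nc →
               ≈.reflexive (when-no (leads? (H ∪ ⁅ e ⁆) u i) λ (_ , r) → Insert.nonrootᵢ F i∈W root (∈-out e∈) nc r))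
               (when-ε (free? H e))) (⨁-ε (out i))) ⟩
      α H u * q k H + 0# ≈⟨ +-identityʳ _ ⟩
      α H u * q k H ∎)

    forestSeriesᵢ : ∀ k → forestSeries (suc k) ≈ 𝔹 (λ H → q (suc k) H + Ā H * q k H)
    forestSeriesᵢ k = ≈.trans (split _) (𝔹-cong λ {H} F root → +-congˡ (begin
      ⨁ (out i) (λ e → when (free? H e) (q (suc k) (H ∪ ⁅ e ⁆)))
        ≈⟨ ⨁-cong-∈ (out i) (λ e e∈ → begin
             when (free? H e) (q (suc k) (H ∪ ⁅ e ⁆))
               ≈⟨ when-congʳ (free? H e) (λ nc → ≈.trans (q-insert (Insert.e∉H F i∈W root (∈-out e∈) nc)) (*-congˡ (r-suc k H))) ⟩
             when (free? H e) (x e * q k H)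
               ≈⟨ when≈𝟙* (free? H e) ⟩
             ᾱ H (target e) * (x e * q k H)
               ≈⟨ solve 3 (λ a b c → a :* (b :* c) := b :* a :* c) ≈.refl _ _ _ ⟩
             x e * ᾱ H (target e) * q k H ∎) ⟩
      ⨁ (out i) (λ e → x e * ᾱ H (target e) * q k H)
        ≈⟨ ⨁-* (q k H) ⟩
      Ā H * q k H ∎))

    -- The weight of all edges out of `i` splits as `A H + Ā H`. The part `Ā H` completes the
    -- forests with root `i` to all forests with one more edge; the part `A H` consists of the edges
    -- whose targets lead to `i`.
    recurrence-≡ : ∀ k → leadsTo i i (suc k) + ⨁ (out i) (λ e → x e * leadsTo i i k) ≈
                         forestSeries (suc k) + ⨁ (out i) (λ e → x e * leadsTo (target e) i k)
    recurrence-≡ k = begin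
      leadsTo i i (suc k) + ⨁ (out i) (λ e → x e * leadsTo i i k)
        ≈⟨ +-cong (diagonal (suc k)) (⨁-cong (out i) λ e → *-congˡ (diagonal k)) ⟩
      𝔹 (q (suc k)) + ⨁ (out i) (λ e → x e * 𝔹 (q k))
        ≈⟨ +-congˡ (⨁-*-𝔹 (out i)) ⟩
      𝔹 (q (suc k)) + 𝔹 (λ H → ⨁ (out i) (λ e → x e * q k H))
        ≈⟨ 𝔹-+ ⟨
      𝔹 (λ H → q (suc k) H + ⨁ (out i) (λ e → x e * q k H))
        ≈⟨ 𝔹-cong (λ {H} _ _ → begin
             q (suc k) H + ⨁ (out i) (λ e → x e * q k H)
               ≈⟨ +-congˡ (≈.trans (⨁-* (q k H)) (*-congʳ (X≈A+Ā H))) ⟩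
             q (suc k) H + (A H + Ā H) * q k H
               ≈⟨ solve 4 (λ s a b c → s :+ (a :+ b) :* c := (s :+ b :* c) :+ a :* c) ≈.refl _ _ _ _ ⟩
             (q (suc k) H + Ā H * q k H) + A H * q k H
               ≈⟨ +-congˡ (≈.trans (≈.sym (⨁-* (q k H))) (⨁-cong (out i) λ e → *-assoc _ _ _)) ⟩
             (q (suc k) H + Ā H * q k H) + ⨁ (out i) (λ e → x e * (α H (target e) * q k H)) ∎) ⟩
      𝔹 (λ H → (q (suc k) H + Ā H * q k H) + ⨁ (out i) (λ e → x e * (α H (target e) * q k H)))
        ≈⟨ 𝔹-+ ⟩
      𝔹 (λ H → q (suc k) H + Ā H * q k H) + 𝔹 (λ H → ⨁ (out i) (λ e → x e * (α H (target e) * q k H)))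
        ≈⟨ +-cong (forestSeriesᵢ k) (≈.trans (⨁-cong (out i) λ e → *-congˡ (leadsToᵢ (target e) k)) (⨁-*-𝔹 (out i))) ⟨
      forestSeries (suc k) + ⨁ (out i) (λ e → x e * leadsTo (target e) i k) ∎
      where
      diagonal : ∀ k → leadsTo i i k ≈ 𝔹 (q k)
      diagonal k = ≈.trans (leadsToᵢ i k) (𝔹-cong λ {H} _ _ →
        ≈.trans (*-congʳ (≈.reflexive (when-yes (path? H i i) nil))) (*-identityˡ _))

    module _ {j : Fin n} (i≢j : i ≢ j) where

      β : Subset m → Fin n → Carrier
      β H u = 𝟙 (leads? H u j)

      C : Subset m → Carrier
      C H = ⨁ (out i) (λ e → x e * β H (target e))

      -- Two ways for an insertion to leave `u` leading to `j`: it did so already and any admissible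
      -- edge is inserted, or it led to `i` and the edge goes into the tree of `j`.
      leadsToⱼ : ∀ u k → leadsTo u j k ≈ 𝔹 (λ H → β H u * q k H + (β H u * Ā H + α H u * C H) * r k H)
      leadsToⱼ u k = ≈.trans (split _) (𝔹-cong λ {H} F root → +-cong (when≈𝟙* (leads? H u j)) (begin
        ⨁ (out i) (λ e → when (free? H e) (when (leads? (H ∪ ⁅ e ⁆) u j) (q k (H ∪ ⁅ e ⁆))))
          ≈⟨ ⨁-cong-∈ (out i) (λ e e∈ → insertion F root (∈-out e∈)) ⟩
        ⨁ (out i) (λ e → (β H u * (x e * ᾱ H (target e)) + α H u * (x e * β H (target e))) * r k H)
          ≈⟨ ⨁-* (r k H) ⟩
        ⨁ (out i) (λ e → β H u * (x e * ᾱ H (target e)) + α H u * (x e * β H (target e))) * r k H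
          ≈⟨ *-congʳ (≈.trans (⨁-∙ (out i)) (+-cong (≈.sym (*-⨁ (β H u) (out i))) (≈.sym (*-⨁ (α H u) (out i))))) ⟩
        (β H u * Ā H + α H u * C H) * r k H ∎))
        where
        insertion : ∀ {H e} → Partial H → Root H i → source e ≡ i →
          when (free? H e) (when (leads? (H ∪ ⁅ e ⁆) u j) (q k (H ∪ ⁅ e ⁆))) ≈
          (β H u * (x e * ᾱ H (target e)) + α H u * (x e * β H (target e))) * r k H
        insertion {H} {e} F root s≡i with path? H (target e) i
        -- A target that leads to `i` cannot lead to `j` as well, so both terms on the right vanish
        -- along with the inadmissible insertion.
        ... | yes π = ≈.sym (begin
          (β H u * (x e * 0#) + α H u * (x e * 𝟙 (leads? H (target e) j))) * r k H
            ≈⟨ *-congʳ (+-congˡ (*-congˡ (*-congˡ (≈.reflexive (when-no (leads? H (target e) j) other))))) ⟩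
          (β H u * (x e * 0#) + α H u * (x e * 0#)) * r k H
            ≈⟨ solve 4 (λ b x a r → (b :* (x :* con 0) :+ a :* (x :* con 0)) :* r := con 0) ≈.refl _ _ _ _ ⟩
          0# ∎)
          where
          other : ¬ Leads H (target e) j
          other (ρ , rootⱼ) = i≢j (root-unique (Partial.functional F) π root ρ rootⱼ)
        ... | no nc = begin
          when (leads? (H ∪ ⁅ e ⁆) u j) (q k (H ∪ ⁅ e ⁆))
            ≈⟨ when≈𝟙* (leads? (H ∪ ⁅ e ⁆) u j) ⟩
          𝟙 (leads? (H ∪ ⁅ e ⁆) u j) * q k (H ∪ ⁅ e ⁆)
            ≈⟨ *-cong indicator (q-insert e∉H) ⟩
          (β H u + α H u * β H (target e)) * (x e * r k H)
            ≈⟨ solve 5 (λ b a c x r → (b :+ a :* c) :* (x :* r) := (b :* (x :* con 1) :+ a :* (x :* c)) :* r) ≈.refl _ _ _ _ _ ⟩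
          (β H u * (x e * 1#) + α H u * (x e * β H (target e))) * r k H ∎
          where
          open Insert F i∈W root s≡i nc
          indicator : 𝟙 (leads? (H ∪ ⁅ e ⁆) u j) ≈ β H u + α H u * β H (target e)
          indicator = 𝟙-⊎ (leads? (H ∪ ⁅ e ⁆) u j) (leads? H u j) (path? H u i) (leads? H (target e) j)
            (λ l → [ inj₁ ∘ proj₁ , inj₂ ]′ (leads⁻ l)) (λ l → leads⁺ (inj₁ (l , i≢j ∘ sym))) (leads⁺ ∘ inj₂)
            (λ (ρ , rootⱼ) π → i≢j (root-unique (Partial.functional F) π root ρ rootⱼ))

      leadsToᵢⱼ : ∀ k → leadsTo i j k ≈ 𝔹 (λ H → C H * r k H)
      leadsToᵢⱼ k = ≈.trans (leadsToⱼ i k) (𝔹-cong λ {H} _ root → begin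
        β H i * q k H + (β H i * Ā H + α H i * C H) * r k H
          ≈⟨ +-cong (*-congʳ (β≈0 root)) (*-congʳ (+-cong (*-congʳ (β≈0 root)) (*-congʳ (≈.reflexive (when-yes (path? H i i) nil))))) ⟩
        0# * q k H + (0# * Ā H + 1# * C H) * r k H
          ≈⟨ +-cong (zeroˡ _) (*-congʳ (+-cong (zeroˡ _) (*-identityˡ _))) ⟩
        0# + (0# + C H) * r k H
          ≈⟨ ≈.trans (+-identityˡ _) (*-congʳ (+-identityˡ _)) ⟩
        C H * r k H ∎)
        where
        β≈0 : ∀ {H} → Root H i → β H i ≈ 0#
        β≈0 {H} root = ≈.reflexive (when-no (leads? H i j) λ (π , _) → i≢j (root-path root π))

      -- Forest by forest, it is the expansion of `(A H + Ā H) * C H`, where `C H` is the weight of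
      -- the edges out of `i` into the tree of `j`: either edge of a pair may be regarded as the one
      -- of the matrix and the other as inserted.
      recurrence-≢ : ∀ k → leadsTo i j (suc k) + ⨁ (out i) (λ e → x e * leadsTo i j k) ≈
                           ⨁ (out i) (λ e → x e * leadsTo (target e) j k)
      recurrence-≢ k = begin
        leadsTo i j (suc k) + ⨁ (out i) (λ e → x e * leadsTo i j k)
          ≈⟨ +-cong (leadsToᵢⱼ (suc k)) (≈.trans (⨁-cong (out i) λ e → *-congˡ (leadsToᵢⱼ k)) (⨁-*-𝔹 (out i))) ⟩
        𝔹 (λ H → C H * r (suc k) H) + 𝔹 (λ H → ⨁ (out i) (λ e → x e * (C H * r k H)))
          ≈⟨ 𝔹-+ ⟨
        𝔹 (λ H → C H * r (suc k) H + ⨁ (out i) (λ e → x e * (C H * r k H)))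
          ≈⟨ 𝔹-cong (λ {H} _ _ → begin
               C H * r (suc k) H + ⨁ (out i) (λ e → x e * (C H * r k H))
                 ≈⟨ +-cong (*-congˡ (r-suc k H)) (≈.trans (⨁-* (C H * r k H)) (*-congʳ (X≈A+Ā H))) ⟩
               C H * q k H + (A H + Ā H) * (C H * r k H)
                 ≈⟨ solve 5 (λ c q a b r → c :* q :+ (a :+ b) :* (c :* r) := c :* q :+ (c :* (b :* r) :+ a :* (c :* r))) ≈.refl _ _ _ _ _ ⟩
               C H * q k H + (C H * (Ā H * r k H) + A H * (C H * r k H))
                 ≈⟨ +-cong (⨁-* (q k H)) (+-cong (⨁-* (Ā H * r k H)) (⨁-* (C H * r k H))) ⟨
               ⨁ (out i) (λ e → x e * β H (target e) * q k H) +
                 (⨁ (out i) (λ e → x e * β H (target e) * (Ā H * r k H)) + ⨁ (out i) (λ e → x e * α H (target e) * (C H * r k H)))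
                 ≈⟨ ≈.trans (⨁-∙ (out i)) (+-congˡ (⨁-∙ (out i))) ⟨
               ⨁ (out i) (λ e → x e * β H (target e) * q k H + (x e * β H (target e) * (Ā H * r k H) + x e * α H (target e) * (C H * r k H)))
                 ≈⟨ ⨁-cong (out i) (λ e → solve 7 (λ x b q c r a d → x :* b :* q :+ (x :* b :* (c :* r) :+ x :* a :* (d :* r))
                      := x :* (b :* q :+ (b :* c :+ a :* d) :* r)) ≈.refl _ _ _ _ _ _ _) ⟩
               ⨁ (out i) (λ e → x e * (β H (target e) * q k H + (β H (target e) * Ā H + α H (target e) * C H) * r k H)) ∎) ⟩
        𝔹 (λ H → ⨁ (out i) (λ e → x e * (β H (target e) * q k H + (β H (target e) * Ā H + α H (target e) * C H) * r k H)))
          ≈⟨ ≈.trans (⨁-cong (out i) λ e → *-congˡ (leadsToⱼ (target e) k)) (⨁-*-𝔹 (out i)) ⟨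
        ⨁ (out i) (λ e → x e * leadsTo (target e) j k) ∎

-- Newton's identities for the forest series

module ForestSeries {c ℓ} (R : CommutativeRing c ℓ) {n m} (G : Digraph n m) (W : Subset n)
                    (x : Fin m → CommutativeRing.Carrier R) where
  open CommutativeRing R hiding (zero; refl; sym; trans; reflexive)
  private
    module ≈ = CommutativeRing R
    module Π = BigOp *-commutativeMonoid
  open BigSum commutativeSemiring
  open Forests G
  open PartialForests G W
  open MatrixForest R G W x
  open PowerSeries R using (Series; _≋_; _⊕_; θ; Newton; _⊛_; scalar; Top; _,_; ⊛-cong; ⊛-zeroˡ; ⊛-comm; ⊛-suc′; scalar-⊛; ⊛-distribˡ; *-⊛-assoc)
  open Weighted R using (weight; Ψ)
  open import Algebra.Properties.Semiring.Mult semiring using (×-congˡ; ×-congʳ; ×-homo-+; ×-assoc-*) renaming (_×_ to _·_)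
  open import Algebra.Properties.Group +-group using () renaming (∙-cancelʳ to +-cancelʳ)
  open ≈-Reasoning setoid

  ⊛-⨁ : ∀ f {A : Set} (xs : List A) (a : A → Carrier) (u : A → Series) →
         f ⊛ (λ l → ⨁ xs (λ e → a e * u e l)) ≋ λ k → ⨁ xs (λ e → a e * (f ⊛ u e) k)
  ⊛-⨁ f []       a u k = ≈.trans (⊛-comm f _ k) (⊛-zeroˡ (λ _ → ≈.refl) f k)
  ⊛-⨁ f (e ∷ xs) a u k = ≈.trans (⊛-distribˡ f _ _ k) (+-cong
    (≈.trans (⊛-comm f _ k) (≈.trans (*-⊛-assoc (a e) (u e) f k) (*-congˡ (⊛-comm (u e) f k))))
    (⊛-⨁ f xs a u k))

  -- The matrix forest theorem (1 − tB) N = f, where N is leadsTo.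
  recurrence : ∀ {i} → i ∈ W → ∀ j k → leadsTo i j (suc k) + ⨁ (out i) (λ e → x e * leadsTo i j k) ≈
               when (i ≟ j) (forestSeries (suc k)) + ⨁ (out i) (λ e → x e * leadsTo (target e) j k)
  recurrence {i} i∈W j k = cases (i ≟ j)
    where
    cases : (d : Dec (i ≡ j)) → leadsTo i j (suc k) + ⨁ (out i) (λ e → x e * leadsTo i j k) ≈
            when d (forestSeries (suc k)) + ⨁ (out i) (λ e → x e * leadsTo (target e) j k)
    cases (yes refl) = At.recurrence-≡ i∈W k
    cases (no i≢j)   = ≈.trans (At.recurrence-≢ i∈W i≢j k) (≈.sym (+-identityˡ _))

  leadsTo-0 : ∀ i j → leadsTo i j 0 ≈ when (i ≟ j) (forestSeries 0)
  leadsTo-0 i j = ≈.trans (𝔽-cong λ {H} _ → at H) (≈.sym (≈.trans (when-⨁ (i ≟ j) edgeSets)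
    (⨁-cong edgeSets λ H → when-comm (i ≟ j) (partial? H))))
    where
    at : ∀ H → when (leads? H i j) (q 0 H) ≈ when (i ≟ j) (q 0 H)
    at H = ≈.trans (when-comm (leads? H i j) (∣ H ∣ ℕ.≟ 0)) (≈.trans
      (when-congʳ (∣ H ∣ ℕ.≟ 0) λ empty → when-cong (leads? H i j) (i ≟ j)
        (λ { (nil , _) → refl ; ((_ , e∈ , _) ◅ _ , _) → contradiction e∈ (∣p∣≡0⇒∉ empty) })
        (λ { refl → nil , λ e∈ → contradiction e∈ (∣p∣≡0⇒∉ empty) }) (λ _ _ → ≈.refl))
      (when-comm (∣ H ∣ ℕ.≟ 0) (i ≟ j)))

  leadsTo-outside : ∀ {i j} → i ∉ W → j ∈ W → ∀ k → leadsTo i j k ≈ 0#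
  leadsTo-outside {i} {j} i∉W j∈W k = ≈.trans (𝔽-cong {Q′ = λ _ → 0#} λ {H} F → ≈.reflexive (when-no (leads? H i j)
    λ { (nil , _) → i∉W j∈W ; ((e , e∈ , refl , _) ◅ _ , _) → i∉W (Partial.sources F e∈) }))
    (≈.trans (⨁-cong edgeSets λ H → when-ε (partial? H)) (⨁-ε edgeSets))

  forestSeries-0 : forestSeries 0 ≈ 1#
  forestSeries-0 = begin
    forestSeries 0
      ≈⟨ ⨁-cong edgeSets (λ H → ≈.trans (≈.reflexive (sym (when-× (partial? H) (∣ H ∣ ℕ.≟ 0))))
           (when-cong (partial? H ×-dec ∣ H ∣ ℕ.≟ 0) (H ≟ˢ ⊥) (λ (_ , eq) → Empty-unique λ (_ , e∈) → ∣p∣≡0⇒∉ eq e∈)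
             (λ { refl → partial (λ e∈ → contradiction e∈ ∉⊥) (λ e∈ → contradiction e∈ ∉⊥) (λ e e∈ → contradiction e∈ ∉⊥) , ∣⊥∣≡0 m })
             (λ _ _ → ≈.refl))) ⟩
    ⨁ edgeSets (λ H → when (H ≟ˢ ⊥) (weight x H))
      ≈⟨ ⨁-only (_≟ˢ ⊥) (allSubsets-unique m) (∈-allSubsets ⊥) refl (λ _ → id) ⟩
    weight x ⊥
      ≈⟨ ≈.trans (Π.⨁-filter (_∈? ⊥) (allFin m)) (Π.⨁-cong (allFin m) λ e → ≈.reflexive (Π.when-no (e ∈? ⊥) ∉⊥)) ⟩
    Π.⨁ (allFin m) (λ _ → 1#)
      ≈⟨ Π.⨁-ε (allFin m) ⟩
    1# ∎

  -- walks k i j is the (i , j) entry of Bᵏ, where B = X − D is minus the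
  -- Laplacian restricted to W.
  walks : ℕ → Fin n → Fin n → Carrier
  walks zero    i j = when (i ≟ j) 1#
  walks (suc k) i j = when (i ∈? W) (⨁ (out i) (λ e → x e * (walks k (target e) j - walks k i j)))

  walks-outside : ∀ {i j} → i ∉ W → j ∈ W → ∀ k → walks k i j ≈ 0#
  walks-outside {i} {j} i∉W j∈W zero    = ≈.reflexive (when-no (i ≟ j) λ { refl → i∉W j∈W })
  walks-outside {i} {j} i∉W j∈W (suc k) = ≈.reflexive (when-no (i ∈? W) i∉W)

  -- The matrix forest theorem solved for N = f (1 - tB)⁻¹, the inverse being the series of the
  -- powers of B. Both sides satisfy one recurrence in `k`; the terms of the diagonal of B are added
  -- to both and cancelled at the end.
  leadsTo≈ : ∀ {j} → j ∈ W → ∀ k i → leadsTo i j k ≈ (forestSeries ⊛ (λ l → walks l i j)) k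
  leadsTo≈ {j} j∈W k i with i ∈? W
  ... | no i∉W = ≈.trans (leadsTo-outside i∉W j∈W k) (≈.sym (≈.trans (⊛-comm forestSeries _ k)
                   (⊛-zeroˡ (walks-outside i∉W j∈W) forestSeries k)))
  leadsTo≈ {j} j∈W zero i | yes i∈W = ≈.trans (leadsTo-0 i j) (≈.trans (when≈𝟙* (i ≟ j)) (*-comm _ _))
  leadsTo≈ {j} j∈W (suc k) i | yes i∈W = +-cancelʳ (⨁ (out i) (λ e → x e * leadsTo i j k)) _ _ (begin
    leadsTo i j (suc k) + ⨁ (out i) (λ e → x e * leadsTo i j k)
      ≈⟨ recurrence i∈W j k ⟩
    when (i ≟ j) (f (suc k)) + ⨁ (out i) (λ e → x e * leadsTo (target e) j k)
      ≈⟨ +-cong (≈.trans (when≈𝟙* (i ≟ j)) (*-comm _ _)) (⨁-cong (out i) λ e → *-congˡ (leadsTo≈ j∈W k (target e))) ⟩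
    f (suc k) * w i 0 + ⨁ (out i) (λ e → x e * (f ⊛ w (target e)) k)
      ≈⟨ +-congˡ (⊛-⨁ f (out i) x (λ e → w (target e)) k) ⟨
    f (suc k) * w i 0 + (f ⊛ (λ l → ⨁ (out i) (λ e → x e * w (target e) l))) k
      ≈⟨ +-congˡ (⊛-cong {f} (λ _ → ≈.refl) step k) ⟨
    f (suc k) * w i 0 + (f ⊛ (w i ∘ suc ⊕ (λ l → ⨁ (out i) (λ e → x e * w i l)))) k
      ≈⟨ +-congˡ (⊛-distribˡ f _ _ k) ⟩
    f (suc k) * w i 0 + ((f ⊛ w i ∘ suc) k + (f ⊛ (λ l → ⨁ (out i) (λ e → x e * w i l))) k)
      ≈⟨ +-assoc _ _ _ ⟨
    f (suc k) * w i 0 + (f ⊛ w i ∘ suc) k + (f ⊛ (λ l → ⨁ (out i) (λ e → x e * w i l))) k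
      ≈⟨ +-cong (≈.sym (⊛-suc′ f (w i) k)) (≈.trans (⊛-⨁ f (out i) x (λ _ → w i) k)
           (⨁-cong (out i) λ e → *-congˡ (≈.sym (leadsTo≈ j∈W k i)))) ⟩
    (f ⊛ w i) (suc k) + ⨁ (out i) (λ e → x e * leadsTo i j k) ∎)
    where
    f = forestSeries
    w : Fin n → Series
    w i l = walks l i j
    -- The definition of `walks` with its negative terms moved to the left, the shape in which
    -- `recurrence` is stated.
    step : w i ∘ suc ⊕ (λ l → ⨁ (out i) (λ e → x e * w i l)) ≋ λ l → ⨁ (out i) (λ e → x e * w (target e) l)
    step l = begin
      w i (suc l) + ⨁ (out i) (λ e → x e * w i l)
        ≈⟨ +-congʳ (≈.reflexive (when-yes (i ∈? W) i∈W)) ⟩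
      ⨁ (out i) (λ e → x e * (w (target e) l - w i l)) + ⨁ (out i) (λ e → x e * w i l)
        ≈⟨ ⨁-∙ (out i) ⟨
      ⨁ (out i) (λ e → x e * (w (target e) l - w i l) + x e * w i l)
        ≈⟨ ⨁-cong (out i) (λ e → ≈.trans (≈.sym (distribˡ _ _ _)) (*-congˡ (≈.trans (+-assoc _ _ _)
             (≈.trans (+-congˡ (-‿inverseˡ _)) (+-identityʳ _))))) ⟩
      ⨁ (out i) (λ e → x e * w (target e) l) ∎

  trace : Series
  trace k = ⨁ members (λ j → walks k j j)

  partial-size : ∀ {H} → Partial H → ∣ H ∣ ℕ.+ ∣ rootsIn G W H ∣ ≡ ∣ W ∣
  partial-size F = ∣edges∣+∣roots∣ G (Partial.sources F) (Partial.functional F)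

  trace-0 : trace 0 ≈ ∣ W ∣ · 1#
  trace-0 = begin
    trace 0                                       ≈⟨ ⨁-cong members (λ j → ≈.reflexive (when-yes (j ≟ j) refl)) ⟩
    ⨁ members (λ _ → 1#)                          ≈⟨ ⨁-filter (_∈? W) (allFin n) ⟩
    ⨁ (allFin n) (λ j → when (j ∈? W) 1#)         ≈⟨ ⨁-∈? commutativeSemiring W ⟩
    ∣ W ∣ · 1#                                    ∎

  ·≈* : ∀ k a → k · a ≈ (k · 1#) * a
  ·≈* k a = ≈.trans (×-congʳ k (≈.sym (*-identityˡ a))) (≈.sym (×-assoc-* k 1# a))

  *-𝔽 : ∀ a {Q} → a * 𝔽 Q ≈ 𝔽 (λ H → a * Q H)
  *-𝔽 a = ≈.trans (*-⨁ a edgeSets) (⨁-cong edgeSets λ H → *-when a (partial? H))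

  -- The trace of N is f times the series of the traces of Bᵏ. It counts each forest once for every
  -- root in `W`, and a forest with k edges has |W| - k of them: this is |W| f - θ f, and |W| is the
  -- trace of B⁰.
  newton : Newton forestSeries trace
  newton k = begin
    θ f k + (f ⊛ trace) k
      ≈⟨ +-cong (≈.trans (·≈* k (f k)) (*-𝔽 (k · 1#))) rootCount ⟩
    𝔽 (λ H → (k · 1#) * q k H) + 𝔽 (λ H → ∣ rootsIn G W H ∣ · q k H)
      ≈⟨ ≈.trans (⨁-cong edgeSets λ H → when-∙ (partial? H)) (⨁-∙ edgeSets) ⟨
    𝔽 (λ H → (k · 1#) * q k H + ∣ rootsIn G W H ∣ · q k H)
      ≈⟨ 𝔽-cong (λ {H} F → size F) ⟩
    𝔽 (λ H → trace 0 * q k H)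
      ≈⟨ *-𝔽 (trace 0) ⟨
    trace 0 * f k
      ≈⟨ scalar-⊛ (trace 0) f k ⟨
    (scalar (trace 0) ⊛ f) k ∎
    where
    f = forestSeries

    rootCount : (f ⊛ trace) k ≈ 𝔽 (λ H → ∣ rootsIn G W H ∣ · q k H)
    rootCount = begin
      (f ⊛ trace) k
        ≈⟨ ⊛-cong {f} (λ _ → ≈.refl) (λ l → ⨁-cong members λ j → ≈.sym (*-identityˡ _)) k ⟩
      (f ⊛ (λ l → ⨁ members (λ j → 1# * walks l j j))) k
        ≈⟨ ⊛-⨁ f members (λ _ → 1#) (λ j l → walks l j j) k ⟩
      ⨁ members (λ j → 1# * (f ⊛ (λ l → walks l j j)) k)
        ≈⟨ ⨁-cong-∈ members (λ j j∈ → ≈.trans (*-identityˡ _) (≈.sym (leadsTo≈ (proj₂ (∈-filter⁻ (_∈? W) {xs = allFin n} j∈)) k j))) ⟩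
      ⨁ members (λ j → leadsTo j j k)
        ≈⟨ ⨁-swap members edgeSets ⟩
      ⨁ edgeSets (λ H → ⨁ members (λ j → when (partial? H) (when (leads? H j j) (q k H))))
        ≈⟨ ⨁-cong edgeSets (λ H → when-⨁ (partial? H) members) ⟨
      𝔽 (λ H → ⨁ members (λ j → when (leads? H j j) (q k H)))
        ≈⟨ 𝔽-cong (λ {H} _ → begin
             ⨁ members (λ j → when (leads? H j j) (q k H))
               ≈⟨ ⨁-filter (_∈? W) (allFin n) ⟩
             ⨁ (allFin n) (λ j → when (j ∈? W) (when (leads? H j j) (q k H)))
               ≈⟨ ⨁-cong (allFin n) (λ j → ≈.trans (≈.reflexive (sym (when-× (j ∈? W) (leads? H j j))))
                    (when-cong (j ∈? W ×-dec leads? H j j) (j ∈? rootsIn G W H) (λ (j∈ , _ , r) → ∈-rootsIn⁺ G j∈ r)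
                      (λ j∈ → let j∈W , r = ∈-rootsIn⁻ G {W} {H} j∈ in j∈W , nil , r) (λ _ _ → ≈.refl))) ⟩
             ⨁ (allFin n) (λ j → when (j ∈? rootsIn G W H) (q k H))
               ≈⟨ ⨁-∈? commutativeSemiring (rootsIn G W H) ⟩
             ∣ rootsIn G W H ∣ · q k H ∎) ⟩
      𝔽 (λ H → ∣ rootsIn G W H ∣ · q k H) ∎

    size : ∀ {H} → Partial H → (k · 1#) * q k H + ∣ rootsIn G W H ∣ · q k H ≈ trace 0 * q k H
    size {H} F = at (∣ H ∣ ℕ.≟ k)
      where
      ρ = ∣ rootsIn G W H ∣
      at : (d : Dec (∣ H ∣ ≡ k)) → (k · 1#) * when d (weight x H) + ρ · when d (weight x H) ≈ trace 0 * when d (weight x H)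
      at (no _)     = ≈.trans (+-cong (zeroʳ _) (≈.trans (·≈* ρ 0#) (zeroʳ _))) (≈.trans (+-identityˡ 0#) (≈.sym (zeroʳ _)))
      at (yes refl) = begin
        (∣ H ∣ · 1#) * weight x H + ρ · weight x H          ≈⟨ +-congˡ (·≈* ρ (weight x H)) ⟩
        (∣ H ∣ · 1#) * weight x H + (ρ · 1#) * weight x H   ≈⟨ distribʳ _ _ _ ⟨
        (∣ H ∣ · 1# + ρ · 1#) * weight x H                  ≈⟨ *-congʳ (×-homo-+ 1# ∣ H ∣ ρ) ⟨
        ((∣ H ∣ ℕ.+ ρ) · 1#) * weight x H                   ≈⟨ *-congʳ (≈.trans (×-congˡ (partial-size F)) (≈.sym trace-0)) ⟩
        trace 0 * weight x H                                ∎

  forestSeries-vanish : ∀ {d k} → (∀ {H} → Partial H → ∣ H ∣ ℕ.≤ d) → d ℕ.< k → forestSeries k ≈ 0#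
  forestSeries-vanish {d} {k} bound d<k = ≈.trans
    (𝔽-cong {Q′ = λ _ → 0#} λ {H} F → ≈.reflexive (when-no (∣ H ∣ ℕ.≟ k) λ { refl → ℕ.<⇒≱ d<k (bound F) }))
    (≈.trans (⨁-cong edgeSets λ H → when-ε (partial? H)) (⨁-ε edgeSets))

  forestSeries-top : ∀ {d p} {P : Pred (Subset m) p} (P? : Decidable P) →
    (∀ {H} → Partial H → ∣ H ∣ ≡ d → P H) → (∀ {H} → P H → Partial H × ∣ H ∣ ≡ d) →
    forestSeries d ≈ ⨁ (filter P? edgeSets) (weight x)
  forestSeries-top {d} P? to from = ≈.trans
    (⨁-cong edgeSets λ H → ≈.trans (≈.reflexive (sym (when-× (partial? H) (∣ H ∣ ℕ.≟ d))))
      (when-cong (partial? H ×-dec ∣ H ∣ ℕ.≟ d) (P? H) (λ (F , eq) → to F eq) from (λ _ _ → ≈.refl)))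
    (≈.sym (⨁-filter P? edgeSets))

  -- By `partial-size`, having |W| edges means having no root in `W`, so every path ends in the
  -- complement.
  top-Ψ : Top forestSeries ∣ W ∣ (Ψ G x (∁ W))
  top-Ψ = forestSeries-vanish (λ F → ℕ.≤-trans (ℕ.m≤m+n _ _) (ℕ.≤-reflexive (partial-size F))) ,
          forestSeries-top (isForest? (∁ W)) (λ F eq → rooted⇒isForest (to F eq)) from
    where
    to : ∀ {H} → Partial H → ∣ H ∣ ≡ ∣ W ∣ → Rooted (∁ W) H
    to {H} F eq = record
      { roots = λ v∈ e∈ s≡v → x∈∁p⇒x∉p v∈ (subst (_∈ W) s≡v (Partial.sources F e∈))
      ; functional = Partial.functional F
      ; reaches = λ v → let r , root , π = acyclic⇒path-to-root (Partial.acyclic F) v in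
          r , x∉p⇒x∈∁p (λ r∈W → ∣p∣≡0⇒∉ noRoots (∈-rootsIn⁺ G r∈W root)) , π }
      where
      noRoots : ∣ rootsIn G W H ∣ ≡ 0
      noRoots = ℕ.+-cancelˡ-≡ ∣ H ∣ _ _ (trans (partial-size F) (trans (sym eq) (sym (ℕ.+-identityʳ ∣ H ∣))))

    from : ∀ {H} → IsForest (∁ W) H → Partial H × ∣ H ∣ ≡ ∣ W ∣
    from {H} isForest = F , trans (sym (ℕ.+-identityʳ ∣ H ∣)) (trans (cong (∣ H ∣ ℕ.+_) (sym noRoots)) (partial-size F))
      where
      rooted = isForest⇒rooted isForest
      F : Partial H
      F = partial (λ {e} e∈ → x∉∁p⇒x∈p λ s∈ → Rooted.roots rooted s∈ e∈ refl) (Rooted.functional rooted) (proj₂ (proj₂ isForest))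
      noRoots : ∣ rootsIn G W H ∣ ≡ 0
      noRoots = ∉⇒∣p∣≡0 λ v∈ → let v∈W , root = ∈-rootsIn⁻ G {W} {H} v∈ in x∈∁p⇒x∉p (rooted-root rooted root) v∈W

module _ {c ℓ} (R : CommutativeRing c ℓ) {k n m} (k≡1+n : k ≡ suc n) (G : Digraph k m) (x : Fin m → CommutativeRing.Carrier R) where
  open Forests G
  open PartialForests G ⊤
  open ForestSeries R G ⊤ x
  open MatrixForest R G ⊤ x using (forestSeries)

  -- Some root always exists, so one edge fewer than vertices is the maximum, and attaining it means
  -- a single root. The equation `k≡1+n` is a hypothesis because the order of the tree graph is a
  -- successor only propositionally.
  top-treeSum : PowerSeries.Top R forestSeries n (Weighted.treeSum R G x)
  top-treeSum = PowerSeries._,_ (forestSeries-vanish bound) (forestSeries-top isSpanningTree? to from)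
    where
    size : ∀ {H} → Partial H → ∣ H ∣ ℕ.+ ∣ rootsIn G ⊤ H ∣ ≡ suc n
    size F = trans (partial-size F) (trans (∣⊤∣≡n k) k≡1+n)

    bound : ∀ {H} → Partial H → ∣ H ∣ ℕ.≤ n
    bound {H} F with acyclic⇒path-to-root (Partial.acyclic F) (subst Fin (sym k≡1+n) zero)
    ... | r , root , _ = ℕ.s≤s⁻¹ (ℕ.≤-trans (ℕ.≤-reflexive (ℕ.+-comm 1 ∣ H ∣))
      (ℕ.≤-trans (ℕ.+-monoʳ-≤ ∣ H ∣ (ℕ.n≢0⇒n>0 λ none → ∣p∣≡0⇒∉ none (∈-rootsIn⁺ G ∈⊤ root))) (ℕ.≤-reflexive (size F))))

    to : ∀ {H} → Partial H → ∣ H ∣ ≡ n → IsSpanningTree H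
    to {H} F eq with ∣p∣≡1⇒∃! (ℕ.+-cancelˡ-≡ ∣ H ∣ _ _ (trans (size F) (trans (cong suc (sym eq)) (ℕ.+-comm 1 ∣ H ∣))))
    ... | r , r∈ , unique = r , rooted⇒isForest (record
      { roots = λ v∈ → subst (Root H) (sym (x∈⁅y⁆⇒x≡y r v∈)) (proj₂ (∈-rootsIn⁻ G {⊤} {H} r∈))
      ; functional = Partial.functional F
      ; reaches = λ v → let r′ , root , π = acyclic⇒path-to-root (Partial.acyclic F) v in
          r , x∈⁅x⁆ r , subst (Path H v) (sym (unique (∈-rootsIn⁺ G ∈⊤ root))) π })

    from : ∀ {H} → IsSpanningTree H → Partial H × ∣ H ∣ ≡ n
    from {H} (r , isTree) = F , ℕ.suc-injective (trans (ℕ.+-comm 1 ∣ H ∣) (trans (cong (∣ H ∣ ℕ.+_) (sym oneRoot)) (size F)))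
      where
      rooted = isForest⇒rooted isTree
      F : Partial H
      F = partial (λ _ → ∈⊤) (Rooted.functional rooted) (proj₂ (proj₂ isTree))
      oneRoot : ∣ rootsIn G ⊤ H ∣ ≡ 1
      oneRoot = ∃!⇒∣p∣≡1 (∈-rootsIn⁺ G ∈⊤ (Rooted.roots rooted (x∈⁅x⁆ r))) λ v∈ →
        sym (x∈⁅y⁆⇒x≡y r (rooted-root rooted (proj₂ (∈-rootsIn⁻ G {⊤} {H} v∈))))

-- Traces as sums over lazy walks

module Traces {c ℓ} (R : CommutativeRing c ℓ) {n m} (G : Digraph n m) (simple : Simple G)
              (x : Fin m → CommutativeRing.Carrier R) where
  open CommutativeRing R hiding (zero; refl; sym; trans; reflexive)
  private
    module ≈ = CommutativeRing R
    module N = BigSum ℕ.+-*-commutativeSemiring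
  open BigSum commutativeSemiring
  open Multiplicities G simple
  open Simple simple
  open TreeGraph G using (order; tree; isMove?)
  open import Algebra.Properties.Semiring.Mult semiring using (×-congˡ; ×-congʳ; ×-homo-+) renaming (_×_ to _·_)
  open import Algebra.Properties.Ring ring using (-‿distribˡ-*; -‿distribʳ-*)
  open ≈-Reasoning setoid

  words : ℕ → List Word
  words zero    = [] ∷ []
  words (suc k) = map (λ (l , ω) → l ∷ ω) (cartesianProduct (cartesianProduct (allFin m) (true ∷ false ∷ [])) (words k))

  -- The signs are those of B = X - D: a stay along `e` selects the term -x_e of the diagonal entry
  -- at its source.
  wt : Word → Carrier
  wt []                = 1#
  wt ((e , true) ∷ ω)  = x e * wt ω
  wt ((e , false) ∷ ω) = - x e * wt ω

  ⨁-words : ∀ k {f} → ⨁ (words (suc k)) f ≈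
    ⨁ (allFin m) (λ e → ⨁ (words k) (λ ω → f ((e , true) ∷ ω)) + ⨁ (words k) (λ ω → f ((e , false) ∷ ω)))
  ⨁-words k {f} = begin
    ⨁ (words (suc k)) f
      ≡⟨ ⨁-map (λ (l , ω) → l ∷ ω) (cartesianProduct (cartesianProduct (allFin m) (true ∷ false ∷ [])) (words k)) ⟩
    ⨁ (cartesianProduct (cartesianProduct (allFin m) (true ∷ false ∷ [])) (words k)) (λ (l , ω) → f (l ∷ ω))
      ≈⟨ ⨁-cartesianProduct (cartesianProduct (allFin m) (true ∷ false ∷ [])) (words k) ⟩
    ⨁ (cartesianProduct (allFin m) (true ∷ false ∷ [])) (λ l → ⨁ (words k) (λ ω → f (l ∷ ω)))
      ≈⟨ ⨁-cartesianProduct (allFin m) (true ∷ false ∷ []) ⟩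
    ⨁ (allFin m) (λ e → ⨁ (words k) (λ ω → f ((e , true) ∷ ω)) + (⨁ (words k) (λ ω → f ((e , false) ∷ ω)) + 0#))
      ≈⟨ ⨁-cong (allFin m) (λ e → +-congˡ (+-identityʳ _)) ⟩
    ⨁ (allFin m) (λ e → ⨁ (words k) (λ ω → f ((e , true) ∷ ω)) + ⨁ (words k) (λ ω → f ((e , false) ∷ ω))) ∎

  -- One multiplication by B, shared by `G` and its tree graph: `D` is the condition on the first
  -- edge, `C₁` and `C₀` those on the rest of the word after a move and after a stay.
  ⨁-words-when : ∀ k {C : Word → Set} {D : Fin m → Set} {C₁ C₀ : Fin m → Word → Set}
    (C? : ∀ ω → Dec (C ω)) (D? : ∀ e → Dec (D e)) (C₁? : ∀ e ω → Dec (C₁ e ω)) (C₀? : ∀ e ω → Dec (C₀ e ω)) →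
    (∀ e ω → C ((e , true) ∷ ω) → D e × C₁ e ω) → (∀ e ω → D e × C₁ e ω → C ((e , true) ∷ ω)) →
    (∀ e ω → C ((e , false) ∷ ω) → D e × C₀ e ω) → (∀ e ω → D e × C₀ e ω → C ((e , false) ∷ ω)) →
    ⨁ (words (suc k)) (λ ω → when (C? ω) (wt ω)) ≈
    ⨁ (allFin m) (λ e → when (D? e) (x e * (⨁ (words k) (λ ω → when (C₁? e ω) (wt ω)) - ⨁ (words k) (λ ω → when (C₀? e ω) (wt ω)))))
  ⨁-words-when k C? D? C₁? C₀? to₁ from₁ to₀ from₀ = ≈.trans (⨁-words k) (⨁-cong (allFin m) λ e → begin
    ⨁ (words k) (λ ω → when (C? ((e , true) ∷ ω)) (x e * wt ω)) + ⨁ (words k) (λ ω → when (C? ((e , false) ∷ ω)) (- x e * wt ω))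
      ≈⟨ +-cong (part (D? e) (C₁? e) (λ ω → C? ((e , true) ∷ ω)) (x e) (to₁ e) (from₁ e))
                (part (D? e) (C₀? e) (λ ω → C? ((e , false) ∷ ω)) (- x e) (to₀ e) (from₀ e)) ⟩
    when (D? e) (x e * ⨁ (words k) (λ ω → when (C₁? e ω) (wt ω))) + when (D? e) (- x e * ⨁ (words k) (λ ω → when (C₀? e ω) (wt ω)))
      ≈⟨ when-∙ (D? e) ⟨
    when (D? e) (x e * ⨁ (words k) (λ ω → when (C₁? e ω) (wt ω)) + - x e * ⨁ (words k) (λ ω → when (C₀? e ω) (wt ω)))
      ≈⟨ when-congʳ (D? e) (λ _ → ≈.trans (+-congˡ (≈.trans (≈.sym (-‿distribˡ-* _ _)) (-‿distribʳ-* _ _))) (≈.sym (distribˡ _ _ _))) ⟩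
    when (D? e) (x e * (⨁ (words k) (λ ω → when (C₁? e ω) (wt ω)) - ⨁ (words k) (λ ω → when (C₀? e ω) (wt ω)))) ∎)
    where
    part : ∀ {D : Set} {C C′ : Word → Set} (D? : Dec D) (C′? : ∀ ω → Dec (C′ ω)) (C? : ∀ ω → Dec (C ω)) a →
           (∀ ω → C ω → D × C′ ω) → (∀ ω → D × C′ ω → C ω) →
           ⨁ (words k) (λ ω → when (C? ω) (a * wt ω)) ≈ when D? (a * ⨁ (words k) (λ ω → when (C′? ω) (wt ω)))
    part D? C′? C? a to from = begin
      ⨁ (words k) (λ ω → when (C? ω) (a * wt ω))
        ≈⟨ ⨁-cong (words k) (λ ω → ≈.trans (when-cong (C? ω) (D? ×-dec C′? ω) (to ω) (from ω) (λ _ _ → ≈.refl))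
             (≈.trans (≈.reflexive (when-× D? (C′? ω))) (when-congʳ D? λ _ → ≈.sym (*-when a (C′? ω))))) ⟩
      ⨁ (words k) (λ ω → when D? (a * when (C′? ω) (wt ω)))
        ≈⟨ when-⨁ D? (words k) ⟨
      when D? (⨁ (words k) (λ ω → a * when (C′? ω) (wt ω)))
        ≈⟨ when-congʳ D? (λ _ → *-⨁ a (words k)) ⟨
      when D? (a * ⨁ (words k) (λ ω → when (C′? ω) (wt ω))) ∎

  module _ (W : Subset n) where
    open PartialForests G W using (out; members)
    open ForestSeries R G W x using (walks; trace)

    within? : ∀ i ω j → Dec (Walk i ω j × support i ω ⊆ W)
    within? i ω j = walk? i ω j ×-dec support i ω ⊆? W

    -- The hypothesis on `j` matters for the empty word: its support `⁅ j ⁆` has to lie in `W`,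
    -- whereas B⁰ is written with 1 on the whole diagonal.
    walks≈ : ∀ k i {j} → j ∈ W → walks k i j ≈ ⨁ (words k) (λ ω → when (within? i ω j) (wt ω))
    walks≈ zero    i {j} j∈W = ≈.trans (when-cong (i ≟ j) (within? i [] j)
      (λ { refl → refl , ⁅⁆⊆ j∈W }) proj₁ (λ _ _ → ≈.refl)) (≈.sym (+-identityʳ _))
    walks≈ (suc k) i {j} j∈W = begin
      when (i ∈? W) (⨁ (out i) (λ e → x e * (walks k (target e) j - walks k i j)))
        ≈⟨ when-congʳ (i ∈? W) (λ _ → ⨁-filter (λ e → source e ≟ i) (allFin m)) ⟩
      when (i ∈? W) (⨁ (allFin m) (λ e → when (source e ≟ i) (x e * (walks k (target e) j - walks k i j))))
        ≈⟨ when-⨁ (i ∈? W) (allFin m) ⟩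
      ⨁ (allFin m) (λ e → when (i ∈? W) (when (source e ≟ i) (x e * (walks k (target e) j - walks k i j))))
        ≈⟨ ⨁-cong (allFin m) (λ e → ≈.trans (≈.reflexive (sym (when-× (i ∈? W) (source e ≟ i))))
             (when-congʳ (i ∈? W ×-dec source e ≟ i) λ _ →
               *-congˡ (+-cong (walks≈ k (target e) j∈W) (-‿cong (walks≈ k i j∈W))))) ⟩
      ⨁ (allFin m) (λ e → when (i ∈? W ×-dec source e ≟ i)
        (x e * (⨁ (words k) (λ ω → when (within? (target e) ω j) (wt ω)) - ⨁ (words k) (λ ω → when (within? i ω j) (wt ω)))))
        ≈⟨ ⨁-words-when k (λ ω → within? i ω j) (λ e → i ∈? W ×-dec source e ≟ i) (λ e ω → within? (target e) ω j) (λ e ω → within? i ω j)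
             (λ e → to {e} {true}) (λ e → from {e} {true}) (λ e → to {e} {false}) (λ e → from {e} {false}) ⟨
      ⨁ (words (suc k)) (λ ω → when (within? i ω j) (wt ω)) ∎
      where
      to : ∀ {e b} ω → Walk i ((e , b) ∷ ω) j × support i ((e , b) ∷ ω) ⊆ W →
           (i ∈ W × source e ≡ i) × Walk (next i (e , b)) ω j × support (next i (e , b)) ω ⊆ W
      to ω ((s≡ , walk) , ⊆W) = (⊆W (∪ˡ (x∈⁅x⁆ i)) , s≡) , walk , ⊆W ∘ ∪ʳ
      from : ∀ {e b} ω → (i ∈ W × source e ≡ i) × Walk (next i (e , b)) ω j × support (next i (e , b)) ω ⊆ W →
             Walk i ((e , b) ∷ ω) j × support i ((e , b) ∷ ω) ⊆ W
      from {e} {b} ω ((i∈W , s≡) , walk , ⊆W) = (s≡ , walk) ,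
        λ u∈ → [ ⁅⁆⊆ i∈W , ⊆W ]′ (x∈p∪q⁻ ⁅ i ⁆ (support (next i (e , b)) ω) u∈)

    trace≈ : ∀ k → trace k ≈ ⨁ (allFin n) (λ v → ⨁ (words k) (λ ω → when (within? v ω v) (wt ω)))
    trace≈ k = begin
      ⨁ members (λ v → walks k v v)
        ≈⟨ ⨁-filter (_∈? W) (allFin n) ⟩
      ⨁ (allFin n) (λ v → when (v ∈? W) (walks k v v))
        ≈⟨ ⨁-cong (allFin n) (λ v → begin
             when (v ∈? W) (walks k v v)
               ≈⟨ when-congʳ (v ∈? W) (walks≈ k v) ⟩
             when (v ∈? W) (⨁ (words k) (λ ω → when (within? v ω v) (wt ω)))
               ≈⟨ when-⨁ (v ∈? W) (words k) ⟩
             ⨁ (words k) (λ ω → when (v ∈? W) (when (within? v ω v) (wt ω)))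
               ≈⟨ ⨁-cong (words k) (λ ω → ≈.trans (≈.reflexive (sym (when-× (v ∈? W) (within? v ω v))))
                    (when-cong (v ∈? W ×-dec within? v ω v) (within? v ω v) proj₂
                      (λ (walk , ⊆W) → ⊆W (start∈support v ω) , walk , ⊆W) (λ _ _ → ≈.refl))) ⟩
             ⨁ (words k) (λ ω → when (within? v ω v) (wt ω)) ∎) ⟩
      ⨁ (allFin n) (λ v → ⨁ (words k) (λ ω → when (within? v ω v) (wt ω))) ∎

  -- A tree rooted at `source e` has exactly one outgoing edge labelled `e` in the tree graph, so
  -- lazy walks from a given tree are words in the same letters as lazy walks in `G`.
  TreeWalk : Subset m → Word → Set
  TreeWalk T []      = Unit
  TreeWalk T ((e , b) ∷ ω) = IsTree (source e) T × TreeWalk (if b then move T e else T) ω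

  treeWalk? : ∀ T ω → Dec (TreeWalk T ω)
  treeWalk? T []      = yes tt
  treeWalk? T ((e , b) ∷ ω) = isTree? (source e) T ×-dec treeWalk? (if b then move T e else T) ω

  leadsFrom? : ∀ T ω U → Dec (TreeWalk T ω × act ω T ≡ U)
  leadsFrom? T ω U = treeWalk? T ω ×-dec act ω T ≟ˢ U

  -- The roots of the successive trees trace a walk in `G`, since a move along `e` takes the root
  -- from `source e` to `target e`.
  treeWalk⇒walk : ∀ {u v T} ω → Rooted ⁅ u ⁆ T → TreeWalk T ω → Rooted ⁅ v ⁆ (act ω T) → Walk u ω v
  treeWalk⇒walk [] F _ F′ = tree-root-unique F F′
  treeWalk⇒walk ((e , b) ∷ ω) F (isTree , walk) F′ with tree-root-unique (isForest⇒rooted isTree) F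
  treeWalk⇒walk ((e , true) ∷ ω)  F (isTree , walk) F′ | refl = refl , treeWalk⇒walk ω (move-tree (noLoop e) F) walk F′
  treeWalk⇒walk ((e , false) ∷ ω) F (isTree , walk) F′ | refl = refl , treeWalk⇒walk ω F walk F′

  walk⇒treeWalk : ∀ {u v T} ω → Rooted ⁅ u ⁆ T → Walk u ω v → TreeWalk T ω
  walk⇒treeWalk [] F _ = tt
  walk⇒treeWalk ((e , true) ∷ ω)  F (refl , walk) = rooted⇒isForest F , walk⇒treeWalk ω (move-tree (noLoop e) F) walk
  walk⇒treeWalk ((e , false) ∷ ω) F (refl , walk) = rooted⇒isForest F , walk⇒treeWalk ω F walk

  -- The trace of the tree graph

  private
    𝒯 = treeGraph G
    module 𝒯 = Digraph 𝒯
    y = x ∘ addedEdge G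
  open PartialForests 𝒯 ⊤ using () renaming (out to out𝒯; members to members𝒯)
  open ForestSeries R 𝒯 ⊤ y using () renaming (walks to walks𝒯; trace to trace𝒯)

  spanningTrees-unique : Unique spanningTrees
  spanningTrees-unique = Unique.filter⁺ isSpanningTree? (allSubsets-unique m)

  tree-index : ∀ {T} → IsSpanningTree T → ∃ λ a → tree a ≡ T
  tree-index {T} isTree = Any.index T∈ , sym (lookup-index T∈)
    where
    T∈ = ∈-filter⁺ isSpanningTree? (∈-allSubsets T) isTree

  -- Edges of the tree graph are positions in the list of moves; sums over those out of `a` become
  -- sums over label and target.
  ⨁-labelled : ∀ {N} {P : Pred (Fin N × Fin m × Fin N) 0ℓ} (P? : Decidable P) (F : Fin m → Fin N → Carrier) a →
    let edges = filter P? (cartesianProduct (allFin N) (cartesianProduct (allFin m) (allFin N))) in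
    ⨁ (filter (λ i → proj₁ (lookup edges i) ≟ a) (allFin (length edges)))
      (λ i → F (proj₁ (proj₂ (lookup edges i))) (proj₂ (proj₂ (lookup edges i)))) ≈
    ⨁ (allFin m) (λ e → ⨁ (allFin N) (λ b → when (P? (a , e , b)) (F e b)))
  ⨁-labelled {N} P? F a = begin
    ⨁ (filter (λ i → proj₁ (lookup edges i) ≟ a) (allFin (length edges))) (λ i → F (proj₁ (proj₂ (lookup edges i))) (proj₂ (proj₂ (lookup edges i))))
      ≈⟨ ⨁-filter (λ i → proj₁ (lookup edges i) ≟ a) (allFin (length edges)) ⟩
    ⨁ (allFin (length edges)) (f ∘ lookup edges)
      ≡⟨ ⨁-lookup edges {f} ⟩
    ⨁ edges f
      ≈⟨ ⨁-filter P? (cartesianProduct (allFin N) (cartesianProduct (allFin m) (allFin N))) ⟩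
    ⨁ (cartesianProduct (allFin N) (cartesianProduct (allFin m) (allFin N))) (λ t → when (P? t) (f t))
      ≈⟨ ≈.trans (⨁-cartesianProduct (allFin N) _) (⨁-cong (allFin N) λ a′ → ⨁-cartesianProduct (allFin m) (allFin N)) ⟩
    ⨁ (allFin N) (λ a′ → ⨁ (allFin m) (λ e → ⨁ (allFin N) (λ b → when (P? (a′ , e , b)) (when (a′ ≟ a) (F e b)))))
      ≈⟨ ⨁-cong (allFin N) (λ a′ → ≈.trans (⨁-cong (allFin m) λ e → ≈.trans (⨁-cong (allFin N) λ b → when-comm (P? (a′ , e , b)) (a′ ≟ a))
           (≈.sym (when-⨁ (a′ ≟ a) (allFin N)))) (≈.sym (when-⨁ (a′ ≟ a) (allFin m)))) ⟩
    ⨁ (allFin N) (λ a′ → when (a′ ≟ a) (⨁ (allFin m) (λ e → ⨁ (allFin N) (λ b → when (P? (a′ , e , b)) (F e b)))))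
      ≈⟨ ⨁-only (_≟ a) (Unique.allFin⁺ N) (∈-allFin a) refl (λ _ → id) ⟩
    ⨁ (allFin m) (λ e → ⨁ (allFin N) (λ b → when (P? (a , e , b)) (F e b))) ∎
    where
    edges = filter P? (cartesianProduct (allFin N) (cartesianProduct (allFin m) (allFin N)))
    f : Fin N × Fin m × Fin N → Carrier
    f (a′ , e , b) = when (a′ ≟ a) (F e b)

  only-move : ∀ (h : Subset m → Carrier) a e →
    ⨁ (allFin order) (λ b → when (isMove? (a , e , b)) (x e * (h (tree b) - h (tree a)))) ≈
    when (isTree? (source e) (tree a)) (x e * (h (move (tree a) e) - h (tree a)))
  only-move h a e = begin
    ⨁ (allFin order) (λ b → when (isMove? (a , e , b)) (f (tree b)))
      ≈⟨ ⨁-cong (allFin order) (λ b → ≈.reflexive (when-× (isTree? (source e) (tree a)) (tree b ≟ˢ move (tree a) e))) ⟩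
    ⨁ (allFin order) (λ b → when (isTree? (source e) (tree a)) (when (tree b ≟ˢ move (tree a) e) (f (tree b))))
      ≈⟨ when-⨁ (isTree? (source e) (tree a)) (allFin order) ⟨
    when (isTree? (source e) (tree a)) (⨁ (allFin order) (λ b → when (tree b ≟ˢ move (tree a) e) (f (tree b))))
      ≈⟨ when-congʳ (isTree? (source e) (tree a)) (λ isTree →
           let b₀ , eq = tree-index (target e , rooted⇒isForest (move-tree (noLoop e) (isForest⇒rooted isTree))) in
           ≈.trans (⨁-only (λ b → tree b ≟ˢ move (tree a) e) {f = f ∘ tree} (Unique.allFin⁺ order) (∈-allFin b₀) eq
                     (λ b eq′ → lookup-injective spanningTrees-unique b b₀ (trans eq′ (sym eq))))
                   (≈.reflexive (cong f eq))) ⟩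
    when (isTree? (source e) (tree a)) (f (move (tree a) e)) ∎
    where
    f : Subset m → Carrier
    f T = x e * (h T - h (tree a))

  -- `h` extends the entries of the k-th power from indices of trees to arbitrary edge sets, so that
  -- `move` can be applied without looking up an index.
  walks𝒯-suc : ∀ k a {b} (h : Subset m → Carrier) → (∀ b′ → walks𝒯 k b′ b ≈ h (tree b′)) →
    walks𝒯 (suc k) a b ≈ ⨁ (allFin m) (λ e → when (isTree? (source e) (tree a)) (x e * (h (move (tree a) e) - h (tree a))))
  walks𝒯-suc k a {b} h walks≈h = begin
    walks𝒯 (suc k) a b
      ≡⟨ when-yes (a ∈? ⊤) ∈⊤ ⟩
    ⨁ (out𝒯 a) (λ i → y i * (walks𝒯 k (𝒯.target i) b - walks𝒯 k a b))
      ≈⟨ ⨁-labelled isMove? (λ e b′ → x e * (walks𝒯 k b′ b - walks𝒯 k a b)) a ⟩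
    ⨁ (allFin m) (λ e → ⨁ (allFin order) (λ b′ → when (isMove? (a , e , b′)) (x e * (walks𝒯 k b′ b - walks𝒯 k a b))))
      ≈⟨ ⨁-cong (allFin m) (λ e → ≈.trans (⨁-cong (allFin order) λ b′ → when-congʳ (isMove? (a , e , b′)) λ _ →
           *-congˡ (+-cong (walks≈h b′) (-‿cong (walks≈h a)))) (only-move h a e)) ⟩
    ⨁ (allFin m) (λ e → when (isTree? (source e) (tree a)) (x e * (h (move (tree a) e) - h (tree a)))) ∎

  leadsFrom-suc : ∀ k T U → ⨁ (words (suc k)) (λ ω → when (leadsFrom? T ω U) (wt ω)) ≈
    ⨁ (allFin m) (λ e → when (isTree? (source e) T)
      (x e * (⨁ (words k) (λ ω → when (leadsFrom? (move T e) ω U) (wt ω)) - ⨁ (words k) (λ ω → when (leadsFrom? T ω U) (wt ω)))))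
  leadsFrom-suc k T U = ⨁-words-when k (λ ω → leadsFrom? T ω U) (λ e → isTree? (source e) T)
    (λ e ω → leadsFrom? (move T e) ω U) (λ e ω → leadsFrom? T ω U)
    (λ e ω ((t , walk) , eq) → t , walk , eq) (λ e ω (t , walk , eq) → (t , walk) , eq)
    (λ e ω ((t , walk) , eq) → t , walk , eq) (λ e ω (t , walk , eq) → (t , walk) , eq)

  walks𝒯≈ : ∀ k a {b} → walks𝒯 k a b ≈ ⨁ (words k) (λ ω → when (leadsFrom? (tree a) ω (tree b)) (wt ω))
  walks𝒯≈ zero    a {b} = ≈.trans (when-cong (a ≟ b) (leadsFrom? (tree a) [] (tree b))
    (λ { refl → tt , refl }) (λ (_ , eq) → lookup-injective spanningTrees-unique a b eq) (λ _ _ → ≈.refl))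
    (≈.sym (+-identityʳ _))
  walks𝒯≈ (suc k) a {b} = ≈.trans
    (walks𝒯-suc k a (λ T → ⨁ (words k) (λ ω → when (leadsFrom? T ω (tree b)) (wt ω))) (λ b′ → walks𝒯≈ k b′))
    (≈.sym (leadsFrom-suc k (tree a) (tree b)))

  when-spanningTree : ∀ T {a} → when (isSpanningTree? T) a ≈ ⨁ (allFin n) (λ v → when (isTree? v T) a)
  when-spanningTree T {a} = cases (isSpanningTree? T)
    where
    cases : (d : Dec (IsSpanningTree T)) → when d a ≈ ⨁ (allFin n) (λ v → when (isTree? v T) a)
    cases (yes (r , isTree)) = ≈.sym (⨁-only (λ v → isTree? v T) {f = λ _ → a} (Unique.allFin⁺ n) (∈-allFin r) isTree
      (λ v isTree′ → tree-root-unique (isForest⇒rooted isTree′) (isForest⇒rooted isTree)))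
    cases (no ¬tree) = ≈.sym (≈.trans (⨁-cong (allFin n) λ v → ≈.reflexive (when-no (isTree? v T) λ t → ¬tree (v , t))) (⨁-ε (allFin n)))

  fixed? : ∀ v ω T → Dec (IsTree v T × act ω T ≡ T)
  fixed? v ω T = isTree? v T ×-dec act ω T ≟ˢ T

  -- A closed lazy walk of the tree graph is a tree together with a word that is a closed walk at
  -- its root and fixes it. Summing over the word first leaves the number of fixed trees as its
  -- coefficient.
  trace𝒯≈ : ∀ k → trace𝒯 k ≈ ⨁ (allFin n) (λ v → ⨁ (words k) (λ ω →
             when (walk? v ω v) (length (forests (support v ω)) · wt ω)))
  trace𝒯≈ k = begin
    ⨁ members𝒯 (λ a → walks𝒯 k a a)
      ≈⟨ ≈.trans (⨁-filter (_∈? ⊤) (allFin order)) (⨁-cong (allFin order) λ a →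
           ≈.trans (≈.reflexive (when-yes (a ∈? ⊤) ∈⊤)) (walks𝒯≈ k a)) ⟩
    ⨁ (allFin order) (λ a → ⨁ (words k) (λ ω → when (leadsFrom? (tree a) ω (tree a)) (wt ω)))
      ≡⟨ ⨁-lookup spanningTrees ⟩
    ⨁ spanningTrees H
      ≈⟨ ⨁-filter isSpanningTree? edgeSets ⟩
    ⨁ edgeSets (λ T → when (isSpanningTree? T) (H T))
      ≈⟨ ⨁-cong edgeSets (λ T → when-spanningTree T) ⟩
    ⨁ edgeSets (λ T → ⨁ (allFin n) (λ v → when (isTree? v T) (H T)))
      ≈⟨ ⨁-swap edgeSets (allFin n) ⟩
    ⨁ (allFin n) (λ v → ⨁ edgeSets (λ T → when (isTree? v T) (H T)))
      ≈⟨ ⨁-cong (allFin n) (λ v → begin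
           ⨁ edgeSets (λ T → when (isTree? v T) (H T))
             ≈⟨ ⨁-cong edgeSets (λ T → when-⨁ (isTree? v T) (words k)) ⟩
           ⨁ edgeSets (λ T → ⨁ (words k) (λ ω → when (isTree? v T) (when (leadsFrom? T ω T) (wt ω))))
             ≈⟨ ⨁-swap edgeSets (words k) ⟩
           ⨁ (words k) (λ ω → ⨁ edgeSets (λ T → when (isTree? v T) (when (leadsFrom? T ω T) (wt ω))))
             ≈⟨ ⨁-cong (words k) (λ ω → closed v ω) ⟩
           ⨁ (words k) (λ ω → when (walk? v ω v) (length (forests (support v ω)) · wt ω)) ∎) ⟩
    ⨁ (allFin n) (λ v → ⨁ (words k) (λ ω → when (walk? v ω v) (length (forests (support v ω)) · wt ω))) ∎
    where
    H : Subset m → Carrier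
    H T = ⨁ (words k) (λ ω → when (leadsFrom? T ω T) (wt ω))

    closed : ∀ v ω → ⨁ edgeSets (λ T → when (isTree? v T) (when (leadsFrom? T ω T) (wt ω))) ≈
                     when (walk? v ω v) (length (forests (support v ω)) · wt ω)
    closed v ω = begin
      ⨁ edgeSets (λ T → when (isTree? v T) (when (leadsFrom? T ω T) (wt ω)))
        ≈⟨ ⨁-cong edgeSets (λ T → ≈.trans (≈.reflexive (sym (when-× (isTree? v T) (leadsFrom? T ω T))))
             (≈.trans (when-cong (isTree? v T ×-dec leadsFrom? T ω T) (walk? v ω v ×-dec fixed? v ω T)
               (λ (t , walk , eq) → treeWalk⇒walk ω (isForest⇒rooted t) walk (subst (Rooted ⁅ v ⁆) (sym eq) (isForest⇒rooted t)) , t , eq)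
               (λ (walk , t , eq) → t , walk⇒treeWalk ω (isForest⇒rooted t) walk , eq) (λ _ _ → ≈.refl))
             (≈.reflexive (when-× (walk? v ω v) (fixed? v ω T))))) ⟩
      ⨁ edgeSets (λ T → when (walk? v ω v) (when (fixed? v ω T) (wt ω)))
        ≈⟨ when-⨁ (walk? v ω v) edgeSets ⟨
      when (walk? v ω v) (⨁ edgeSets (λ T → when (fixed? v ω T) (wt ω)))
        ≈⟨ when-congʳ (walk? v ω v) (λ walk → ≈.trans (≈.sym (⨁-filter (fixed? v ω) edgeSets))
             (≈.trans (≈.reflexive (⨁-const (filter (fixed? v ω) edgeSets))) (×-congˡ (fixed-count ω walk)))) ⟩
      when (walk? v ω v) (length (forests (support v ω)) · wt ω) ∎

  -- Decomposition of that trace over strongly connected sets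

  ·-when : ∀ {p} {P : Set p} (P? : Dec P) k {a} → N.when P? k · a ≡ when P? (k · a)
  ·-when (yes _) k = refl
  ·-when (no _)  k = refl

  ⨁-· : ∀ {A : Set} (xs : List A) {f : A → ℕ} {a} → N.⨁ xs f · a ≈ ⨁ xs (λ z → f z · a)
  ⨁-· []       = ≈.refl
  ⨁-· (z ∷ xs) {f} {a} = ≈.trans (×-homo-+ a (f z) (N.⨁ xs f)) (+-congˡ (⨁-· xs))

  ·-⨁ : ∀ {A : Set} k (xs : List A) {f : A → Carrier} → k · ⨁ xs f ≈ ⨁ xs (λ z → k · f z)
  ·-⨁ zero    xs = ≈.sym (⨁-ε xs)
  ·-⨁ (suc k) xs = ≈.trans (+-congˡ (·-⨁ k xs)) (≈.sym (⨁-∙ xs))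

  when-· : ∀ {p} {P : Set p} (P? : Dec P) k {a} → k · when P? a ≈ when P? (k · a)
  when-· P? zero    = ≈.sym (when-ε P?)
  when-· P? (suc k) = ≈.trans (+-congˡ (when-· P? k)) (≈.sym (when-∙ P?))

  -- Unlike `ProperStronglyConnected`, the whole vertex set is allowed; when it is strongly
  -- connected, its factor will produce F_G.
  Block : Subset n → Set
  Block W = Nonempty W × StronglyConnected W

  block? : ∀ W → Dec (Block W)
  block? W = nonempty? W ×-dec stronglyConnected? W

  blocks : List (Subset n)
  blocks = filter block? (allSubsets n)

  module _ (w : Subset n → Fin n) (w∈ : ∀ W → Nonempty W → w W ∈ W) where

    μ : Subset n → ℕ
    μ W = multiplicity W (w W)

    -- The coefficient of a closed walk with support S is a sum over the W containing S. Exchanging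
    -- the sums, each W collects the closed walks inside W, which form the trace of the power of
    -- B_W.
    trace-decomposition : ∀ k → trace𝒯 k ≈ ⨁ blocks (λ W → μ W · ForestSeries.trace R G W x k)
    trace-decomposition k = begin
      trace𝒯 k
        ≈⟨ trace𝒯≈ k ⟩
      ⨁ (allFin n) (λ v → ⨁ (words k) (λ ω → when (walk? v ω v) (length (forests (support v ω)) · wt ω)))
        ≈⟨ ⨁-cong (allFin n) (λ v → ≈.trans (⨁-cong (words k) λ ω → distribute v ω) (⨁-swap (words k) (allSubsets n))) ⟩
      ⨁ (allFin n) (λ v → ⨁ (allSubsets n) (λ W → ⨁ (words k) (λ ω → when (block? W) (μ W · when (within? W v ω v) (wt ω)))))
        ≈⟨ ⨁-swap (allFin n) (allSubsets n) ⟩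
      ⨁ (allSubsets n) (λ W → ⨁ (allFin n) (λ v → ⨁ (words k) (λ ω → when (block? W) (μ W · when (within? W v ω v) (wt ω)))))
        ≈⟨ ⨁-cong (allSubsets n) (λ W → begin
             ⨁ (allFin n) (λ v → ⨁ (words k) (λ ω → when (block? W) (μ W · when (within? W v ω v) (wt ω))))
               ≈⟨ ⨁-cong (allFin n) (λ v → ≈.sym (when-⨁ (block? W) (words k))) ⟩
             ⨁ (allFin n) (λ v → when (block? W) (⨁ (words k) (λ ω → μ W · when (within? W v ω v) (wt ω))))
               ≈⟨ when-⨁ (block? W) (allFin n) ⟨
             when (block? W) (⨁ (allFin n) (λ v → ⨁ (words k) (λ ω → μ W · when (within? W v ω v) (wt ω))))
               ≈⟨ when-congʳ (block? W) (λ _ → ≈.trans (⨁-cong (allFin n) λ v → ≈.sym (·-⨁ (μ W) (words k)))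
                    (≈.trans (≈.sym (·-⨁ (μ W) (allFin n))) (×-congʳ (μ W) (≈.sym (trace≈ W k))))) ⟩
             when (block? W) (μ W · ForestSeries.trace R G W x k) ∎) ⟩
      ⨁ (allSubsets n) (λ W → when (block? W) (μ W · ForestSeries.trace R G W x k))
        ≈⟨ ⨁-filter block? (allSubsets n) ⟨
      ⨁ blocks (λ W → μ W · ForestSeries.trace R G W x k) ∎
      where
      distribute : ∀ v ω → when (walk? v ω v) (length (forests (support v ω)) · wt ω) ≈
        ⨁ (allSubsets n) (λ W → when (block? W) (μ W · when (within? W v ω v) (wt ω)))
      distribute v ω = begin
        when (walk? v ω v) (length (forests S) · wt ω)
          ≈⟨ when-congʳ (walk? v ω v) (λ walk → ≈.trans
               (×-congˡ (forests-count-w w w∈ (v , start∈support v ω) (support-stronglyConnected ω walk))) (⨁-· (allSubsets n))) ⟩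
        when (walk? v ω v) (⨁ (allSubsets n) (λ W → N.when (S ⊆? W) (N.when (stronglyConnected? W) (μ W)) · wt ω))
          ≈⟨ when-⨁ (walk? v ω v) (allSubsets n) ⟩
        ⨁ (allSubsets n) (λ W → when (walk? v ω v) (N.when (S ⊆? W) (N.when (stronglyConnected? W) (μ W)) · wt ω))
          ≈⟨ ⨁-cong (allSubsets n) (λ W → begin
               when (walk? v ω v) (N.when (S ⊆? W) (N.when (stronglyConnected? W) (μ W)) · wt ω)
                 ≡⟨ cong (when (walk? v ω v)) (trans (·-when (S ⊆? W) _) (cong (when (S ⊆? W)) (·-when (stronglyConnected? W) (μ W)))) ⟩
               when (walk? v ω v) (when (S ⊆? W) (when (stronglyConnected? W) (μ W · wt ω)))
                 ≡⟨ trans (when-× (walk? v ω v) (S ⊆? W ×-dec stronglyConnected? W)) (cong (when (walk? v ω v)) (when-× (S ⊆? W) (stronglyConnected? W))) ⟨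
               when (walk? v ω v ×-dec (S ⊆? W ×-dec stronglyConnected? W)) (μ W · wt ω)
                 ≈⟨ when-cong (walk? v ω v ×-dec (S ⊆? W ×-dec stronglyConnected? W)) (block? W ×-dec within? W v ω v)
                      (λ (walk , S⊆W , SC) → ((v , S⊆W (start∈support v ω)) , SC) , walk , S⊆W)
                      (λ ((_ , SC) , walk , S⊆W) → walk , S⊆W , SC) (λ _ _ → ≈.refl) ⟩
               when (block? W ×-dec within? W v ω v) (μ W · wt ω)
                 ≡⟨ when-× (block? W) (within? W v ω v) ⟩
               when (block? W) (when (within? W v ω v) (μ W · wt ω))
                 ≈⟨ when-congʳ (block? W) (λ _ → when-· (within? W v ω v) (μ W)) ⟨
               when (block? W) (μ W · when (within? W v ω v) (wt ω)) ∎) ⟩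
        ⨁ (allSubsets n) (λ W → when (block? W) (μ W · when (within? W v ω v) (wt ω))) ∎
        where
        S = support v ω

-- The factorization over a torsion-free ring

module Degrees {n m} (G : Digraph n m) (simple : Simple G) (w : Subset n → Fin n) (w∈ : ∀ W → Nonempty W → w W ∈ W) where
  open TreeGraph G using (order)
  open Multiplicities G simple
  open Traces ℤ.+-*-commutativeRing G simple (λ _ → ℤ.0ℤ) using (blocks; μ; trace-decomposition; ⨁-·)
  open BigSum ℤ.+-*-commutativeSemiring using (⨁; ⨁-cong)
  private module N = BigSum ℕ.+-*-commutativeSemiring
  open import Algebra.Properties.Semiring.Mult ℤ.+-*-semiring using (×-congʳ; ×-assocˡ) renaming (_×_ to _·_)

  -- The trace decomposition at k = 0, where a trace is a number of vertices. It is taken over ℤ,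
  -- where `k · 1` determines `k`.
  order≡⨁ : order ≡ N.⨁ blocks (λ W → μ w w∈ W ℕ.* ∣ W ∣)
  order≡⨁ = ℤ.+-injective (begin
    ℤ.+ order                                              ≡⟨ ·1 order ⟨
    order · ℤ.1ℤ                                           ≡⟨ cong (_· ℤ.1ℤ) (∣⊤∣≡n order) ⟨
    ∣ ⊤ {order} ∣ · ℤ.1ℤ
      ≡⟨ ForestSeries.trace-0 ℤ.+-*-commutativeRing (treeGraph G) ⊤ ((λ _ → ℤ.0ℤ) ∘ addedEdge G) ⟨
    ForestSeries.trace ℤ.+-*-commutativeRing (treeGraph G) ⊤ ((λ _ → ℤ.0ℤ) ∘ addedEdge G) 0
      ≡⟨ trace-decomposition w w∈ 0 ⟩
    ⨁ blocks (λ W → μ w w∈ W · ForestSeries.trace ℤ.+-*-commutativeRing G W (λ _ → ℤ.0ℤ) 0)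
      ≡⟨ ⨁-cong blocks (λ W → trans (×-congʳ (μ w w∈ W) (ForestSeries.trace-0 ℤ.+-*-commutativeRing G W (λ _ → ℤ.0ℤ)))
           (×-assocˡ ℤ.1ℤ (μ w w∈ W) ∣ W ∣)) ⟩
    ⨁ blocks (λ W → (μ w w∈ W ℕ.* ∣ W ∣) · ℤ.1ℤ)           ≡⟨ ⨁-· blocks ⟨
    N.⨁ blocks (λ W → μ w w∈ W ℕ.* ∣ W ∣) · ℤ.1ℤ           ≡⟨ ·1 (N.⨁ blocks (λ W → μ w w∈ W ℕ.* ∣ W ∣)) ⟩
    ℤ.+ N.⨁ blocks (λ W → μ w w∈ W ℕ.* ∣ W ∣)              ∎)
    where
    open ≡-Reasoning
    ·1 : ∀ k → k · ℤ.1ℤ ≡ ℤ.+ k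
    ·1 zero    = refl
    ·1 (suc k) = cong (λ i → ℤ.1ℤ ℤ.+ i) (·1 k)

  -- The only set containing `⊤` is `⊤` itself, so this multiplicity is the number of forests rooted
  -- in `⊤`; the empty edge set is the only one.
  multiplicity-⊤ : Nonempty (⊤ {n}) → StronglyConnected ⊤ → multiplicity ⊤ (w ⊤) ≡ 1
  multiplicity-⊤ nonempty SC = begin
    multiplicity ⊤ (w ⊤)
      ≡⟨ N.when-yes (stronglyConnected? ⊤) SC ⟨
    f ⊤
      ≡⟨ N.⨁-only (⊤ ⊆?_) {f = f} (allSubsets-unique n) (∈-allSubsets ⊤) ⊆-refl (λ W ⊤⊆W → ⊆-antisym ⊆⊤ ⊤⊆W) ⟨
    N.⨁ (allSubsets n) (λ W → N.when (⊤ ⊆? W) (f W))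
      ≡⟨ forests-count-w w w∈ nonempty SC ⟨
    length (forests ⊤)
      ≡⟨ length-filter (isForest? ⊤) edgeSets ⟩
    N.⨁ edgeSets (λ H → N.when (isForest? ⊤ H) 1)
      ≡⟨ N.⨁-only (isForest? ⊤) {f = λ _ → 1} (allSubsets-unique m) (∈-allSubsets ⊥) (rooted⇒isForest record
           { roots = λ _ e∈ → contradiction e∈ ∉⊥ ; functional = λ e∈ → contradiction e∈ ∉⊥ ; reaches = λ v → v , ∈⊤ , nil })
           (λ H isForest → Empty-unique λ (e , e∈) → Rooted.roots (isForest⇒rooted isForest) ∈⊤ e∈ refl) ⟩
    1 ∎
    where
    open ≡-Reasoning
    f : Subset n → ℕ
    f W = N.when (stronglyConnected? W) (multiplicity W (w W))

module Factorization {c ℓ} (R : CommutativeRing c ℓ) (torsionFree : PowerSeries.TorsionFree R)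
                     {p m} (G : Digraph (suc p) m) (simple : Simple G) (SC : Graph.StronglyConnected G ⊤)
                     (x : Fin m → CommutativeRing.Carrier R)
                     (w : Subset (suc p) → Fin (suc p)) (w∈ : ∀ W → Nonempty W → w W ∈ W) where
  open CommutativeRing R hiding (zero; refl; sym; trans; reflexive)
  open PowerSeries R
  private
    module ≈ = CommutativeRing R
    module S = CommutativeRing seriesRing
    module N = BigSum ℕ.+-*-commutativeSemiring
    module Π = BigOp *-commutativeMonoid
    module Πₛ = BigOp S.*-commutativeMonoid
    module Σₛ = BigOp S.+-commutativeMonoid
    n = suc p
  open BigSum commutativeSemiring
  open Multiplicities G simple
  open TreeGraph G using (order)
  open Traces R G simple x using (Block; block?; blocks; trace-decomposition)
  open Weighted R using (treeSum; Ψ; Φ)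
  open import Algebra.Properties.Semiring.Mult semiring using () renaming (_×_ to _·_)
  open import Algebra.Properties.Semiring.Exp semiring using (_^_; ^-congʳ)

  μ : Subset n → ℕ
  μ W = multiplicity W (w W)

  F T : Subset n → Series
  F W = MatrixForest.forestSeries R G W x
  T W = ForestSeries.trace R G W x

  F𝒯 : Series
  F𝒯 = MatrixForest.forestSeries R (treeGraph G) ⊤ (x ∘ addedEdge G)

  F-product : List (Subset n) → Series
  F-product Ws = Πₛ.⨁ Ws (λ W → F W ^ₛ μ W)

  Newton-product : ∀ Ws → Newton (F-product Ws) (Σₛ.⨁ Ws (λ W → μ W ·ₛ T W))
  Newton-product []       = Newton-1
  Newton-product (W ∷ Ws) = Newton-⊛ {F W ^ₛ μ W} {F-product Ws} {μ W ·ₛ T W} {Σₛ.⨁ Ws (λ W → μ W ·ₛ T W)}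
    (Newton-^ {F W} {T W} (μ W) (ForestSeries.newton R G W x)) (Newton-product Ws)

  product-0 : ∀ Ws → F-product Ws 0 ≈ 1#
  product-0 []       = ≈.refl
  product-0 (W ∷ Ws) = ≈.trans (*-cong (power-0 (μ W)) (product-0 Ws)) (*-identityˡ 1#)
    where
    power-0 : ∀ k → (F W ^ₛ k) 0 ≈ 1#
    power-0 zero    = ≈.refl
    power-0 (suc k) = ≈.trans (*-cong (ForestSeries.forestSeries-0 R G W x) (power-0 k)) (*-identityˡ 1#)

  ⨁-at : ∀ Ws k → (Σₛ.⨁ Ws (λ W → μ W ·ₛ T W)) k ≈ ⨁ Ws (λ W → μ W · T W k)
  ⨁-at []       k = ≈.refl
  ⨁-at (W ∷ Ws) k = +-cong (·-at (μ W)) (⨁-at Ws k)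
    where
    ·-at : ∀ j → (j ·ₛ T W) k ≈ j · T W k
    ·-at zero    = ≈.refl
    ·-at (suc j) = +-congˡ (·-at j)

  -- Both series have constant term 1 and satisfy Newton's identities with the same traces.
  F𝒯≋product : F𝒯 ≋ F-product blocks
  F𝒯≋product = Newton-unique torsionFree {F𝒯} {F-product blocks}
    (≈.trans (ForestSeries.forestSeries-0 R (treeGraph G) ⊤ (x ∘ addedEdge G)) (≈.sym (product-0 blocks)))
    (Newton-congʳ {F𝒯} (λ k → ≈.trans (trace-decomposition w w∈ k) (≈.sym (⨁-at blocks k)))
      (ForestSeries.newton R (treeGraph G) ⊤ (x ∘ addedEdge G)))
    (Newton-product blocks)

  -- The whole vertex set contributes the coefficient of degree n − 1, the one
  -- of degree n being zero.
  degree : Subset n → ℕ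
  degree W = if does (W ≟ˢ ⊤) then p else ∣ W ∣

  topCoefficient : Subset n → Carrier
  topCoefficient W = if does (W ≟ˢ ⊤) then treeSum G x else Ψ G x (∁ W)

  F-top : ∀ W → Top (F W) (degree W) (topCoefficient W)
  F-top W = cases (W ≟ˢ ⊤)
    where
    cases : (d : Dec (W ≡ ⊤)) → Top (F W) (if does d then p else ∣ W ∣) (if does d then treeSum G x else Ψ G x (∁ W))
    cases (yes refl) = top-treeSum R refl G x
    cases (no _)     = ForestSeries.top-Ψ R G W x

  product-top : ∀ Ws → Top (F-product Ws) (N.⨁ Ws (λ W → μ W ℕ.* degree W)) (Π.⨁ Ws (λ W → topCoefficient W ^ μ W))
  product-top []       = Top-1
  product-top (W ∷ Ws) = Top-⊛ (Top-^ (μ W) (F-top W)) (product-top Ws)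

  ⊤-block : Block ⊤
  ⊤-block = (zero , ∈⊤) , SC

  μ-⊤ : μ ⊤ ≡ 1
  μ-⊤ = Degrees.multiplicity-⊤ G simple w w∈ (proj₁ ⊤-block) SC

  -- `degree` falls short of the size only at `⊤`, by 1 and with multiplicity 1. So the product ends
  -- exactly in the degree where the series of the tree graph has its sum over spanning trees.
  order≡suc : order ≡ suc (N.⨁ blocks (λ W → μ W ℕ.* degree W))
  order≡suc = begin
    order
      ≡⟨ Degrees.order≡⨁ G simple w w∈ ⟩
    N.⨁ blocks (λ W → μ W ℕ.* ∣ W ∣)
      ≡⟨ N.⨁-cong blocks (λ W → size W (W ≟ˢ ⊤)) ⟩
    N.⨁ blocks (λ W → N.when (W ≟ˢ ⊤) (μ W) ℕ.+ μ W ℕ.* degree W)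
      ≡⟨ N.⨁-∙ blocks ⟩
    N.⨁ blocks (λ W → N.when (W ≟ˢ ⊤) (μ W)) ℕ.+ N.⨁ blocks (λ W → μ W ℕ.* degree W)
      ≡⟨ cong (ℕ._+ N.⨁ blocks (λ W → μ W ℕ.* degree W)) (trans
           (N.⨁-only (_≟ˢ ⊤) {f = μ} (Unique.filter⁺ block? (allSubsets-unique n)) (∈-filter⁺ block? (∈-allSubsets ⊤) ⊤-block) refl (λ _ → id)) μ-⊤) ⟩
    suc (N.⨁ blocks (λ W → μ W ℕ.* degree W)) ∎
    where
    open ≡-Reasoning
    size : ∀ W (d : Dec (W ≡ ⊤)) → μ W ℕ.* ∣ W ∣ ≡ N.when d (μ W) ℕ.+ μ W ℕ.* (if does d then p else ∣ W ∣)
    size W (yes refl) = trans (cong (μ W ℕ.*_) (∣⊤∣≡n n)) (ℕ.*-suc (μ W) p)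
    size W (no _)     = refl

  coefficients : Π.⨁ blocks (λ W → topCoefficient W ^ μ W) ≈ Φ G x w * treeSum G x
  coefficients = begin
    Π.⨁ blocks (λ W → topCoefficient W ^ μ W)
      ≈⟨ Π.⨁-filter block? (allSubsets n) ⟩
    Π.⨁ (allSubsets n) (λ W → Π.when (block? W) (topCoefficient W ^ μ W))
      ≈⟨ Π.⨁-cong (allSubsets n) (λ W → split W (W ≟ˢ ⊤)) ⟩
    Π.⨁ (allSubsets n) (λ W → Π.when (properStronglyConnected? W) (Ψ G x (∁ W) ^ μ W) * Π.when (W ≟ˢ ⊤) (treeSum G x))
      ≈⟨ Π.⨁-∙ (allSubsets n) ⟩
    Π.⨁ (allSubsets n) (λ W → Π.when (properStronglyConnected? W) (Ψ G x (∁ W) ^ μ W)) *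
      Π.⨁ (allSubsets n) (λ W → Π.when (W ≟ˢ ⊤) (treeSum G x))
      ≈⟨ *-cong (≈.sym (Π.⨁-filter properStronglyConnected? (allSubsets n)))
           (Π.⨁-only (_≟ˢ ⊤) (allSubsets-unique n) (∈-allSubsets ⊤) refl (λ _ → id)) ⟩
    Φ G x w * treeSum G x ∎
    where
    open ≈-Reasoning setoid
    split : ∀ W (d : Dec (W ≡ ⊤)) → Π.when (block? W) ((if does d then treeSum G x else Ψ G x (∁ W)) ^ μ W) ≈
            Π.when (properStronglyConnected? W) (Ψ G x (∁ W) ^ μ W) * Π.when d (treeSum G x)
    split W (yes refl) = begin
      Π.when (block? W) (treeSum G x ^ μ W)  ≡⟨ Π.when-yes (block? W) ⊤-block ⟩
      treeSum G x ^ μ W                      ≈⟨ ^-congʳ (treeSum G x) μ-⊤ ⟩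
      treeSum G x * 1#                       ≈⟨ *-identityʳ _ ⟩
      treeSum G x                            ≈⟨ *-identityˡ _ ⟨
      1# * treeSum G x                       ≡⟨ cong (_* treeSum G x) (Π.when-no (properStronglyConnected? W) λ (_ , W⊂⊤ , _) → ⊂-irref refl W⊂⊤) ⟨
      Π.when (properStronglyConnected? W) (Ψ G x (∁ W) ^ μ W) * treeSum G x ∎
    split W (no W≢⊤) = ≈.trans (Π.when-cong (block? W) (properStronglyConnected? W)
      (λ (ne , SC) → ne , (⊆⊤ , missing) , SC) (λ (ne , _ , SC) → ne , SC) (λ _ _ → ≈.refl)) (≈.sym (*-identityʳ _))
      where
      missing : ∃ λ u → u ∈ ⊤ × u ∉ W
      missing with any? (λ u → ¬? (u ∈? W))
      ... | yes (u , u∉W) = u , ∈⊤ , u∉W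
      ... | no all∈ = contradiction (⊆-antisym ⊆⊤ λ {u} _ → case u ∈? W of λ where
        (yes u∈W) → u∈W
        (no u∉W)  → contradiction (u , u∉W) all∈) W≢⊤

  factorization : treeSum (treeGraph G) (x ∘ addedEdge G) ≈ Φ G x w * treeSum G x
  factorization = begin
    treeSum (treeGraph G) (x ∘ addedEdge G) ≈⟨ top (top-treeSum R order≡suc (treeGraph G) (x ∘ addedEdge G)) ⟨
    F𝒯 d                                    ≈⟨ F𝒯≋product d ⟩
    F-product blocks d                      ≈⟨ top (product-top blocks) ⟩
    Π.⨁ blocks (λ W → topCoefficient W ^ μ W) ≈⟨ coefficients ⟩
    Φ G x w * treeSum G x                   ∎
    where
    open ≈-Reasoning setoid
    d = N.⨁ blocks (λ W → μ W ℕ.* degree W)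

-- Specialization

module Specialization {a b ℓ₁ ℓ₂} (A : CommutativeRing a ℓ₁) (B : CommutativeRing b ℓ₂) (h : A ⟶ B) where
  private
    module A = CommutativeRing A
    module B = CommutativeRing B
    module WA = Weighted A
    module WB = Weighted B
    ⟦_⟧ = proj₁ h
  open IsSemiringHomomorphism (proj₂ h) using (+-homo; *-homo; 0#-homo; 1#-homo)
  open import Algebra.Properties.Semiring.Exp A.semiring using () renaming (_^_ to _^₁_)
  open import Algebra.Properties.Semiring.Exp B.semiring using () renaming (_^_ to _^₂_)

  sumOver-homo : ∀ {I : Set} (is : List I) {f g} → (∀ i → ⟦ f i ⟧ B.≈ g i) → ⟦ WA.sumOver is f ⟧ B.≈ WB.sumOver is g
  sumOver-homo []       f≈g = 0#-homo
  sumOver-homo (i ∷ is) f≈g = B.trans (+-homo _ _) (B.+-cong (f≈g i) (sumOver-homo is f≈g))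

  productOver-homo : ∀ {I : Set} (is : List I) {f g} → (∀ i → ⟦ f i ⟧ B.≈ g i) → ⟦ WA.productOver is f ⟧ B.≈ WB.productOver is g
  productOver-homo []       f≈g = 1#-homo
  productOver-homo (i ∷ is) f≈g = B.trans (*-homo _ _) (B.*-cong (f≈g i) (productOver-homo is f≈g))

  ^-homo : ∀ {y z} k → ⟦ y ⟧ B.≈ z → ⟦ y ^₁ k ⟧ B.≈ z ^₂ k
  ^-homo zero    _   = 1#-homo
  ^-homo (suc k) y≈z = B.trans (*-homo _ _) (B.*-cong y≈z (^-homo k y≈z))

  module _ {n m} (G : Digraph n m) {x : Fin m → A.Carrier} {y : Fin m → B.Carrier} (x≈y : ∀ e → ⟦ x e ⟧ B.≈ y e) where
    open Graph G

    weight-homo : ∀ H → ⟦ WA.weight x H ⟧ B.≈ WB.weight y H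
    weight-homo H = productOver-homo (filter (_∈? H) (allFin m)) x≈y

    treeSum-homo : ⟦ WA.treeSum G x ⟧ B.≈ WB.treeSum G y
    treeSum-homo = sumOver-homo spanningTrees weight-homo

    Φ-homo : ∀ w → ⟦ WA.Φ G x w ⟧ B.≈ WB.Φ G y w
    Φ-homo w = productOver-homo (filter properStronglyConnected? (allSubsets n))
      λ W → ^-homo (multiplicity W (w W)) (sumOver-homo (forests (∁ W)) weight-homo)

theorem3p3 : ∀ {c ℓ} (R : CommutativeRing c ℓ) →
    let open CommutativeRing R
        open Weighted R in
    ∀ {n m : ℕ} (G : Digraph n m) →
    Simple G →
    Graph.StronglyConnected G ⊤ →
    (x : Fin m → Carrier) →
    (w : Subset n → Fin n) →
    (∀ W → Nonempty W → w W ∈ W) →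
    treeSum (treeGraph G) (x ∘ addedEdge G) ≈ Φ G x w * treeSum G x
-- With no vertices, `w ⊤` would be an element of the empty `Fin 0`.
theorem3p3 R {zero} G simple SC x w w∈ = case w ⊤ of λ ()
theorem3p3 R {suc p} G simple SC x w w∈ = begin
  treeSum (treeGraph G) (x ∘ addedEdge G)
    ≈⟨ treeSum-homo (treeGraph G) (λ i → hom-var (addedEdge G i)) ⟨
  ⟦ Weighted.treeSum ring (treeGraph G) (var ∘ addedEdge G) ⟧
    ≈⟨ ⟦⟧-cong (Factorization.factorization ring torsionFree G simple SC var w w∈) ⟩
  ⟦ Weighted.Φ ring G var w A.* Weighted.treeSum ring G var ⟧
    ≈⟨ *-homo _ _ ⟩
  ⟦ Weighted.Φ ring G var w ⟧ * ⟦ Weighted.treeSum ring G var ⟧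
    ≈⟨ *-cong (Φ-homo G hom-var w) (treeSum-homo G hom-var) ⟩
  Φ G x w * treeSum G x ∎
  where
  open CommutativeRing R using (setoid; _*_; *-cong)
  open Weighted R using (treeSum; Φ)
  open TorsionFreeCover (torsionFreeCover R x)
  open Specialization ring R hom
  open IsSemiringHomomorphism (proj₂ hom) using (⟦⟧-cong; *-homo)
  open ≈-Reasoning setoid
  module A = CommutativeRing ring
  ⟦_⟧ = proj₁ hom
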